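{- Let $k$ and $s$ be positive integers, and let $I_0(k,s)$ denote the set of indices $\mathbf{k}=(k_1,\ldots,k_r)$ (tuples of positive integers, $r\ge1$) with $k_1>1$, weight $k_1+\cdots+k_r=k$, and height $s$. Then the following identities hold in $\mathcal{A}$: \[ \sum_{\mathbf{k}\in I_0(k,s)} \zeta_{\mathcal{A}}^\star(\mathbf{k}) = 2\binom{k-1}{2s-1}(1-2^{1-k})Z(k), \] \[ \sum_{\mathbf{k}\in I_0(k,s)} (-1)^{\mathrm{dep}(\mathbf{k})}\zeta_{\mathcal{A}}(\mathbf{k}) = 2\binom{k-1}{2s-1}(1-2^{1-k})Z(k). \]
   Context: For an index $\mathbf{k}=(k_1,\ldots,k_r)$ of positive integers, its weight is $k_1+\cdots+k_r$, its depth $\mathrm{dep}(\mathbf{k})$ is $r$, and its height is the number of $i$ with $k_i>1$. Let $\mathcal{A}=\left(\prod_p \mathbb{Z}/p\mathbb{Z}\right)/\left(\bigoplus_p \mathbb{Z}/p\mathbb{Z}\right)$, where $p$ runs over all primes. The finite multiple zeta value $\zeta_{\mathcal{A}}(\mathbf{k})$ and finite multiple zeta-star value $\zeta_{\mathcal{A}}^\star(\mathbf{k})$ are the elements of $\mathcal{A}$ represented respectively by $\left(\sum_{p>m_1>\cdots>m_r>0} \frac{1}{m_1^{k_1}\cdots m_r^{k_r}} \bmod p\right)_p$ and $\left(\sum_{p>m_1\ge\cdots\ge m_r>0} \frac{1}{m_1^{k_1}\cdots m_r^{k_r}} \bmod p\right)_p$. For a positive integer $k$, $Z(k)\in\mathcal{A}$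 is the element represented by $\left(\frac{B_{p-k}}{k} \bmod p\right)_p$ (defined for all sufficiently large $p$), where $B_n$ denotes the $n$-th Bernoulli number. -}

module Defs where

open import Data.Nat as ℕ using (ℕ; zero; suc; _∸_; _<_)
open import Data.Nat.Combinatorics using (_C_)
open import Data.Nat.Divisibility using (_∣_)
open import Data.Nat.Primality using (Prime)
open import Data.Integer as ℤ using (ℤ; +_; ∣_∣)
open import Data.Rational as ℚ using (ℚ; 0ℚ; 1ℚ; _+_; _*_; _-_; -_; _/_; ↥_)
open import Data.List using (List; []; _∷_; map; _++_; filter; foldr; upTo; length)
open import Data.Bool using (Bool; true; false; _∧_)
open import Data.Product using (Σ; ∃; _×_)
open import Relation.Nullary.Decidable using (Dec; yes; no)
open import Relation.Binary.PropositionalEquality using (_≡_)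

_^ℚ_ : ℚ → ℕ → ℚ
q ^ℚ zero  = 1ℚ
q ^ℚ suc n = q * (q ^ℚ n)

-- 1/n for a natural n (convention: invℕ 0 = 0; only used for n > 0)
invℕ : ℕ → ℚ
invℕ zero    = 0ℚ
invℕ (suc n) = + 1 / suc n

ℕtoℚ : ℕ → ℚ
ℕtoℚ n = + n / 1

sumℚ : List ℚ → ℚ
sumℚ = foldr _+_ 0ℚ

sumRange : ℕ → (ℕ → ℚ) → ℚ
sumRange n f = sumℚ (map (λ j → f (suc j)) (upTo (n ∸ 1)))

-- Bernoulli numbers (B₀ = 1, B₁ = -1/2):
--   B_n = - 1/(n+1)   (n ≥ 1) * Σ_{j<n} C(n+1, j) B_j
-- computed as a list [B_{n-1}, ..., B_0] to keep recursion structural.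

private
  bernList : ℕ → List ℚ
  bernNext : ℕ → List ℚ → ℚ

  bernNext zero    bs = 1ℚ
  bernNext (suc m) bs = - (invℕ (suc n) * go bs)
    where
      n = suc m
      -- bs = [B_{n-1}, …, B_0]; index of head is length bs - 1
      go : List ℚ → ℚ
      go []       = 0ℚ
      go (b ∷ bs′) = ℕtoℚ (suc n C length bs′) * b + go bs′

  bernList zero    = []
  bernList (suc n) = bernNext n (bernList n) ∷ bernList n

bernoulli : ℕ → ℚ
bernoulli n = bernNext n (bernList n)

private
  bumpHeads : List (List ℕ) → List (List ℕ)
  bumpHeads []             = []
  bumpHeads ([] ∷ r)       = bumpHeads r
  bumpHeads ((h ∷ t) ∷ r)  = (suc h ∷ t) ∷ bumpHeads r

compositions : ℕ → List (List ℕ)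
compositions zero    = [] ∷ []
compositions (suc n) = map (1 ∷_) (compositions n) ++ bumpHeads (compositions n)

weight : List ℕ → ℕ
weight = foldr ℕ._+_ 0

depth : List ℕ → ℕ
depth = length

height : List ℕ → ℕ
height []       = 0
height (k ∷ ks) with 1 ℕ.<ᵇ k
... | true  = suc (height ks)
... | false = height ks

firstGt1 : List ℕ → Bool
firstGt1 []      = false
firstGt1 (k ∷ _) = 1 ℕ.<ᵇ k

I₀ : ℕ → ℕ → List (List ℕ)
I₀ k s = filter (λ 𝐤 → Data.Bool.T? (firstGt1 𝐤 ∧ (height 𝐤 ℕ.≡ᵇ s))) (compositions k)
  where import Data.Bool

zetaLT : List ℕ → ℕ → ℚ
zetaLT []       n = 1ℚ
zetaLT (k ∷ ks) n = sumRange n (λ m → (invℕ m ^ℚ k) * zetaLT ks m)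

zetaLE : List ℕ → ℕ → ℚ
zetaLE []       n = 1ℚ
zetaLE (k ∷ ks) n = sumRange n (λ m → (invℕ m ^ℚ k) * zetaLE ks (suc m))

ζ𝒜 : List ℕ → ℕ → ℚ
ζ𝒜 𝐤 p = zetaLT 𝐤 p

ζ⋆𝒜 : List ℕ → ℕ → ℚ
ζ⋆𝒜 𝐤 p = zetaLE 𝐤 p

Z : ℕ → ℕ → ℚ
Z k p = bernoulli (p ∸ k) * invℕ k

-- The ring 𝒜 = (∏_p 𝔽_p)/(⊕_p 𝔽_p).
-- An element is represented by a family (a_p)_p of rationals which are
-- p-integral for all large p; a_p is reduced mod p.  Two rationals x, y
-- (both in ℤ_(p)) have equal reductions mod p iff v_p(x - y) ≥ 1, i.e.
-- iff p divides the (reduced) numerator of x - y.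

_≡ℚ_[mod_] : ℚ → ℚ → ℕ → Set
x ≡ℚ y [mod p ] = p ∣ ∣ ↥ (x - y) ∣

_≈𝒜_ : (ℕ → ℚ) → (ℕ → ℚ) → Set
a ≈𝒜 b = ∃ λ N → ∀ p → Prime p → N < p → a p ≡ℚ b p [mod p ]

sign : ℕ → ℚ
sign zero    = 1ℚ
sign (suc n) = - sign n

rhs : ℕ → ℕ → ℕ → ℚ
rhs k s p = ℕtoℚ 2 * ℕtoℚ ((k ∸ 1) C (2 ℕ.* s ∸ 1))
            * (1ℚ - invℕ (2 ℕ.^ (k ∸ 1))) * Z k p

-- Let w = z²t² and d_j = (t - j)² - w. Grouping equal summation variables, the generating function (weight in t,
-- height in z²) of the star sums with first entry > 1 becomes Σ_m w Π_{j<m} j(j-t) / Π_{j≤m} d_j, and reflecting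
-- j ↦ p - j turns the signed non-star sums into minus the same series at -t. Let F_i be the series shifted by
-- t ↦ t - i, completed by a boundary term. Then F_i + F_{i+1} = 2 w / d_{i+1}; solving this p-periodic recurrence
-- and using Π_{0<j<p} (x - j) = x^{p-1} - 1 leaves Σ_m (-1)^{m-1} w / d_m up to O(t^{p-1}). The coefficients of the
-- latter are C(k-1, 2s-1) Σ_m (-1)^{m-1} m^{-k}, and these alternating sums satisfy the recurrence of the Genocchi
-- numbers 2 (1 - 2^N) B_N at N = p - k.
module Submission where

open import Defs
open import Algebra.Bundles using (CommutativeMonoid; CommutativeRing)
import Algebra.Properties.CommutativeSemiring.Exp
import Algebra.Properties.Ring
import Algebra.Properties.Semiring.Mult
import Algebra.Solver.Ring
import Algebra.Solver.Ring.AlmostCommutativeRing as ACR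
open import Data.Bool using (Bool; true; false; not; if_then_else_; _∧_; T?)
open import Data.Integer as ℤ using (ℤ; -[1+_]; _⊖_; _◃_)
import Data.Integer.Divisibility.Signed as ℤ
import Data.Integer.Properties as ℤ
open import Data.Integer.Tactic.RingSolver using () renaming (solve-∀ to ℤ-solve-∀)
open import Data.List using (List; []; _∷_; map; _++_; length; applyUpTo; filter)
open import Data.List.Properties using (map-applyUpTo)
open import Data.List.Relation.Unary.All as All using (All; []; _∷_)
import Data.List.Relation.Unary.All.Properties as All
open import Data.Maybe using (Maybe; just; nothing)
open import Data.Nat as ℕ using (ℕ; zero; suc; _<_; _≤_; _∸_; _≡ᵇ_; _!; s≤s; z≤n)
open import Data.Nat.Combinatorics
  using (_C_; nCk+nC[k+1]≡[n+1]C[k+1]; nCk≡n!/k![n-k]!; nCk≡nC[n∸k]; nCn≡1; nC1≡n; k>n⇒nCk≡0; k![n∸k]!∣n!)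
open import Data.Nat.Coprimality using (prime⇒coprime; coprime-Bézout)
open import Data.Nat.DivMod using (m/n*n≡m)
open import Data.Nat.Divisibility using (_∣_; divides; ∣⇒≤; _∣0; m∣m*n; n∣m*n)
open import Data.Nat.GCD using (module Bézout)
open import Data.Nat.Primality using (Prime; euclidsLemma; prime⇒irreducible; prime⇒nonTrivial)
import Data.Nat.Properties as ℕ
open import Data.Nat.Tactic.RingSolver using (solve-∀)
open import Data.Product using (∃; _×_; _,_; proj₁; proj₂)
open import Data.Rational as ℚ using (ℚ; 0ℚ; 1ℚ; ↥_; toℚᵘ)
import Data.Rational.Properties as ℚ
open import Data.Rational.Unnormalised as ℚᵘ using (mkℚᵘ; _≃_; *≡*)
import Data.Rational.Unnormalised.Properties as ℚᵘ
import Data.Sign as Sign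
open import Data.Sum using (_⊎_; inj₁; inj₂; [_,_]′)
open import Function using (_∘_; id)
open import Level using (0ℓ)
open import Relation.Binary.PropositionalEquality as ≡ using (_≡_)
import Relation.Binary.Reasoning.Setoid
open import Relation.Nullary using (¬_; contradiction; yes; no)

-- The generating functions live in 𝔽ₚ[[z]][[t]], and w is written z²t² because its square root zt
-- splits d_j into (t + zt - j)(t - zt - j); only then does the formula for Π (x - j) reach Π d_j.
-- The obstacle is the index j = p: there d_p = t² - w = t²(1 - z²) is not a unit. Every identity is
-- therefore kept free of denominators, with J_i standing for F_i times a product of d over all
-- residues (up to the factor w), and t² and 1 - z² are cancelled only at the end, in the power
-- series ring. Since p is odd, one trip around the period gives J_0 = 2S - J_0, which is what makes
-- the recurrence solvable. On the arithmetic side, the Bernoulli recurrence divides by n + 1 and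
-- cannot be read modulo p for all n, whereas the Genocchi recurrence divides only by 2. The
-- Genocchi recurrence is therefore derived over ℚ, and it alone is compared with the recurrence of
-- the power sums modulo p.

-- Primes

prime>1 : ∀ {p} → Prime p → 1 < p
prime>1 pr = ℕ.nonTrivial⇒n>1 _ {{prime⇒nonTrivial pr}}

prime∤factorial : ∀ {p} → Prime p → ∀ k → k < p → ¬ (p ∣ k !)
prime∤factorial pr zero    k<p p∣1 = contradiction (∣⇒≤ p∣1) (ℕ.<⇒≱ (prime>1 pr))
prime∤factorial pr (suc k) k<p p∣k! =
  [ (λ p∣k → contradiction (∣⇒≤ p∣k) (ℕ.<⇒≱ k<p)) , prime∤factorial pr k (ℕ.<⇒≤ k<p) ]′
      (euclidsLemma (suc k) (k !) pr p∣k!)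

prime∣binomial : ∀ {p} → Prime p → ∀ k → 0 < k → k < p → p ∣ p C k
prime∣binomial {suc n} pr (suc j) _ k<p =
  [ (λ d → d) , (λ d → contradiction d k!k′!) ]′ (euclidsLemma _ (k ! ℕ.* (p ∸ k) !) pr p∣)
  where
  p = suc n
  k = suc j
  k≤p = ℕ.<⇒≤ k<p
  instance _ = ℕ._!*_!≢0 k (p ∸ k)
  p∣ : p ∣ (p C k) ℕ.* (k ! ℕ.* (p ∸ k) !)
  p∣ = ≡.subst (p ∣_) (≡.sym (≡.trans (≡.cong (ℕ._* (k ! ℕ.* (p ∸ k) !)) (nCk≡n!/k![n-k]! k≤p))
      (m/n*n≡m (k![n∸k]!∣n! k≤p)))) (m∣m*n (n !))
  k!k′! : ¬ (p ∣ k ! ℕ.* (p ∸ k) !)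
  k!k′! = [ prime∤factorial pr k k<p , prime∤factorial pr (p ∸ k) (ℕ.∸-monoʳ-< ℕ.z<s k≤p) ]′ ∘ euclidsLemma (k !)
      ((p ∸ k) !) pr

even⊎odd : ∀ m → (∃ λ h → m ≡ h ℕ.+ h) ⊎ (∃ λ h → m ≡ suc (h ℕ.+ h))
even⊎odd zero    = inj₁ (0 , ≡.refl)
even⊎odd (suc m) with even⊎odd m
... | inj₁ (h , ≡.refl) = inj₂ (h , ≡.refl)
... | inj₂ (h , ≡.refl) = inj₁ (suc h , ≡.cong suc (≡.sym (ℕ.+-suc h h)))

prime-pred-even : ∀ {n} → Prime (suc n) → 2 < suc n → ∃ λ h → n ≡ h ℕ.+ h
prime-pred-even {n} pr 2<p with even⊎odd n
... | inj₁ even        = even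
... | inj₂ (h , ≡.refl) with prime⇒irreducible pr (divides (suc h)
    (≡.cong (suc ∘ suc) (≡.trans (≡.cong (h ℕ.+_) (≡.sym (ℕ.+-identityʳ h))) (ℕ.*-comm 2 h))))
...   | inj₁ ()
...   | inj₂ 2≡p = contradiction 2≡p (ℕ.<⇒≢ 2<p)

-- Sums, products and the ring solver

module Fold (M : CommutativeMonoid 0ℓ 0ℓ) where
  open CommutativeMonoid M

  fold : (ℕ → Carrier) → ℕ → Carrier
  fold f zero    = ε
  fold f (suc n) = fold f n ∙ f n

  fold-cong< : ∀ {f g} n → (∀ i → i < n → f i ≈ g i) → fold f n ≈ fold g n
  fold-cong< zero    h = refl
  fold-cong< (suc n) h = ∙-cong (fold-cong< n λ i i<n → h i (ℕ.m<n⇒m<1+n i<n)) (h n ℕ.≤-refl)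

  fold-cong : ∀ {f g} n → (∀ i → f i ≈ g i) → fold f n ≈ fold g n
  fold-cong n h = fold-cong< n λ i _ → h i

  fold-first : ∀ f n → fold f (suc n) ≈ f 0 ∙ fold (f ∘ suc) n
  fold-first f zero    = comm ε (f 0)
  fold-first f (suc n) = trans (∙-congʳ (fold-first f n)) (assoc _ _ _)

  fold-∙ : ∀ f g n → fold (λ i → f i ∙ g i) n ≈ fold f n ∙ fold g n
  fold-∙ f g zero    = sym (identityˡ ε)
  fold-∙ f g (suc n) = trans (∙-congʳ (fold-∙ f g n)) (begin
    (fold f n ∙ fold g n) ∙ (f n ∙ g n)  ≈⟨ assoc _ _ _ ⟩
    fold f n ∙ (fold g n ∙ (f n ∙ g n))  ≈⟨ ∙-congˡ (sym (assoc _ _ _)) ⟩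
    fold f n ∙ ((fold g n ∙ f n) ∙ g n)  ≈⟨ ∙-congˡ (∙-congʳ (comm _ _)) ⟩
    fold f n ∙ ((f n ∙ fold g n) ∙ g n)  ≈⟨ ∙-congˡ (assoc _ _ _) ⟩
    fold f n ∙ (f n ∙ (fold g n ∙ g n))  ≈⟨ sym (assoc _ _ _) ⟩
    (fold f n ∙ f n) ∙ (fold g n ∙ g n)  ∎)
    where open Relation.Binary.Reasoning.Setoid setoid

  -- The reflection i ↦ n - 1 - i is given as a relation between i and j instead of by truncated
  -- subtraction. For n = p - 1 it pairs i + 1 with j + 1 = p - (i + 1).
  fold-reverse : ∀ {f g} n → (∀ i j → suc (i ℕ.+ j) ≡ n → f i ≈ g j) → fold f n ≈ fold g n
  fold-reverse         zero    h = refl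
  fold-reverse {f} {g} (suc n) h = begin
    fold f n ∙ f n          ≈⟨ ∙-cong (fold-reverse n λ i j e → h i (suc j) (≡.cong suc (≡.trans (ℕ.+-suc i j) e)))
                                      (h n 0 (≡.cong suc (ℕ.+-identityʳ n))) ⟩
    fold (g ∘ suc) n ∙ g 0  ≈⟨ comm _ _ ⟩
    g 0 ∙ fold (g ∘ suc) n  ≈⟨ sym (fold-first g n) ⟩
    fold g (suc n)          ∎
    where open Relation.Binary.Reasoning.Setoid setoid

module RingTheory (R : CommutativeRing 0ℓ 0ℓ) where
  open CommutativeRing R renaming (zero to *-zero) public
  open Algebra.Properties.Ring ring public
    using (-‿distribˡ-*; -‿distribʳ-*; -0#≈0#; -‿involutive; -‿+-comm)
  open Algebra.Properties.CommutativeSemiring.Exp commutativeSemiring public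
    using (_^_; ^-congˡ; ^-homo-*; ^-distrib-*)
  open Algebra.Properties.Semiring.Mult semiring public
    using (×-homo-+; ×1-homo-*) renaming (_×_ to _×ⁿ_)
  module ≈-R = Relation.Binary.Reasoning.Setoid setoid
  module ∑ = Fold +-commutativeMonoid
  module ∏ = Fold *-commutativeMonoid
  open ∑ public using () renaming (fold to ∑)
  open ∏ public using () renaming (fold to ∏)

  ι : ℕ → Carrier
  ι n = n ×ⁿ 1#

  ι-+ : ∀ m n → ι (m ℕ.+ n) ≈ ι m + ι n
  ι-+ = ×-homo-+ 1#

  ι-* : ∀ m n → ι (m ℕ.* n) ≈ ι m * ι n
  ι-* = ×1-homo-*

  ι-≡ : ∀ {m n} → m ≡ n → ι m ≈ ι n
  ι-≡ ≡.refl = refl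

  ι1≈1 : ι 1 ≈ 1#
  ι1≈1 = +-identityʳ 1#

  private
    open ≈-R

    ⟦_⟧ℤ : ℤ → Carrier
    ⟦ ℤ.+ n ⟧ℤ     = ι n
    ⟦ -[1+ n ] ⟧ℤ = - ι (suc n)

    swap-inner : ∀ a b c → (a + b) + (- a + c) ≈ b + c
    swap-inner a b c = begin
      (a + b) + (- a + c)  ≈⟨ +-congʳ (+-comm a b) ⟩
      (b + a) + (- a + c)  ≈⟨ +-assoc _ _ _ ⟩
      b + (a + (- a + c))  ≈⟨ +-congˡ (sym (+-assoc _ _ _)) ⟩
      b + ((a - a) + c)    ≈⟨ +-congˡ (+-congʳ (-‿inverseʳ a)) ⟩
      b + (0# + c)         ≈⟨ +-congˡ (+-identityˡ c) ⟩
      b + c                ∎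

    ⟦⊖⟧ : ∀ m n → ⟦ m ⊖ n ⟧ℤ ≈ ι m - ι n
    ⟦⊖⟧ zero    zero    = sym (-‿inverseʳ 0#)
    ⟦⊖⟧ zero    (suc n) = sym (+-identityˡ _)
    ⟦⊖⟧ (suc m) zero    = sym (trans (+-congˡ -0#≈0#) (+-identityʳ _))
    ⟦⊖⟧ (suc m) (suc n) rewrite ℤ.[1+m]⊖[1+n]≡m⊖n m n = begin
      ⟦ m ⊖ n ⟧ℤ                   ≈⟨ ⟦⊖⟧ m n ⟩
      ι m - ι n                    ≈⟨ sym (swap-inner 1# (ι m) (- ι n)) ⟩
      (1# + ι m) + (- 1# + - ι n)  ≈⟨ +-congˡ (-‿+-comm 1# (ι n)) ⟩
      (1# + ι m) - (1# + ι n)      ∎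

    ⟦neg⟧ : ∀ i → ⟦ ℤ.- i ⟧ℤ ≈ - ⟦ i ⟧ℤ
    ⟦neg⟧ (ℤ.+ zero)    = sym -0#≈0#
    ⟦neg⟧ (ℤ.+ suc n)   = refl
    ⟦neg⟧ -[1+ n ]      = sym (-‿involutive _)

    ⟦+⟧ : ∀ i j → ⟦ i ℤ.+ j ⟧ℤ ≈ ⟦ i ⟧ℤ + ⟦ j ⟧ℤ
    ⟦+⟧ (ℤ.+ m)  (ℤ.+ n)  = ι-+ m n
    ⟦+⟧ (ℤ.+ m)  -[1+ n ] = ⟦⊖⟧ m (suc n)
    ⟦+⟧ -[1+ m ] (ℤ.+ n)  = trans (⟦⊖⟧ n (suc m)) (+-comm _ _)
    ⟦+⟧ -[1+ m ] -[1+ n ] = begin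
      - (1# + (1# + ι (m ℕ.+ n)))  ≈⟨ -‿cong (ι-≡ (≡.cong suc (≡.sym (ℕ.+-suc m n)))) ⟩
      - ι (suc m ℕ.+ suc n)        ≈⟨ -‿cong (ι-+ (suc m) (suc n)) ⟩
      - (ι (suc m) + ι (suc n))    ≈⟨ sym (-‿+-comm _ _) ⟩
      - ι (suc m) - ι (suc n)      ∎

    ⟦-◃⟧ : ∀ n → ⟦ Sign.- ◃ n ⟧ℤ ≈ - ι n
    ⟦-◃⟧ zero    = sym -0#≈0#
    ⟦-◃⟧ (suc n) = refl

    ⟦+◃⟧ : ∀ n → ⟦ Sign.+ ◃ n ⟧ℤ ≈ ι n
    ⟦+◃⟧ zero    = refl
    ⟦+◃⟧ (suc n) = refl

    ⟦*⟧ : ∀ i j → ⟦ i ℤ.* j ⟧ℤ ≈ ⟦ i ⟧ℤ * ⟦ j ⟧ℤ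
    ⟦*⟧ (ℤ.+ m)  (ℤ.+ n)  = trans (⟦+◃⟧ (m ℕ.* n)) (ι-* m n)
    ⟦*⟧ (ℤ.+ m)  -[1+ n ] = trans (⟦-◃⟧ (m ℕ.* suc n)) (trans (-‿cong (ι-* m (suc n))) (-‿distribʳ-* _ _))
    ⟦*⟧ -[1+ m ] (ℤ.+ n)  = trans (⟦-◃⟧ (suc m ℕ.* n)) (trans (-‿cong (ι-* (suc m) n)) (-‿distribˡ-* _ _))
    ⟦*⟧ -[1+ m ] -[1+ n ] = begin
      ι (suc m ℕ.* suc n)          ≈⟨ ι-* (suc m) (suc n) ⟩
      ι (suc m) * ι (suc n)        ≈⟨ sym (-‿involutive _) ⟩
      - - (ι (suc m) * ι (suc n))  ≈⟨ -‿cong (-‿distribˡ-* _ _) ⟩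
      - (- ι (suc m) * ι (suc n))  ≈⟨ -‿distribʳ-* _ _ ⟩
      - ι (suc m) * - ι (suc n)    ∎

    -- The solver evaluates the constant 1 to 1# rather than to ι 1.
    ⟦_⟧ : ℤ → Carrier
    ⟦ ℤ.+ 1 ⟧ = 1#
    ⟦ i ⟧     = ⟦ i ⟧ℤ

    ⟦⟧≈⟦⟧ℤ : ∀ i → ⟦ i ⟧ ≈ ⟦ i ⟧ℤ
    ⟦⟧≈⟦⟧ℤ (ℤ.+ 0)           = refl
    ⟦⟧≈⟦⟧ℤ (ℤ.+ 1)           = sym ι1≈1
    ⟦⟧≈⟦⟧ℤ (ℤ.+ suc (suc n)) = refl
    ⟦⟧≈⟦⟧ℤ -[1+ n ]          = refl

    -- Integer coefficients make the solver constant 2 evaluate to `ι 2`, so that numerals are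
    -- available in every commutative ring.
    ℤ⟶R : ℤ.+-*-rawRing ACR.-Raw-AlmostCommutative⟶ ACR.fromCommutativeRing R
    ℤ⟶R = record
      { ⟦_⟧    = ⟦_⟧
      ; +-homo = λ i j → trans (⟦⟧≈⟦⟧ℤ (i ℤ.+ j)) (trans (⟦+⟧ i j) (sym (+-cong (⟦⟧≈⟦⟧ℤ i) (⟦⟧≈⟦⟧ℤ j))))
      ; *-homo = λ i j → trans (⟦⟧≈⟦⟧ℤ (i ℤ.* j)) (trans (⟦*⟧ i j) (sym (*-cong (⟦⟧≈⟦⟧ℤ i) (⟦⟧≈⟦⟧ℤ j))))
      ; -‿homo = λ i → trans (⟦⟧≈⟦⟧ℤ (ℤ.- i)) (trans (⟦neg⟧ i) (sym (-‿cong (⟦⟧≈⟦⟧ℤ i))))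
      ; 0-homo = refl
      ; 1-homo = refl
      }

    _coeff≟_ : ∀ i j → Maybe (⟦ i ⟧ ≈ ⟦ j ⟧)
    i coeff≟ j with i ℤ.≟ j
    ... | yes ≡.refl = just refl
    ... | no  _      = nothing

  module Solver = Algebra.Solver.Ring ℤ.+-*-rawRing (ACR.fromCommutativeRing R) ℤ⟶R _coeff≟_

  open Solver using (solve; _:=_; _:+_; _:-_)

  x≈y⇒x-y≈0 : ∀ {x y} → x ≈ y → x - y ≈ 0#
  x≈y⇒x-y≈0 eq = trans (+-congʳ eq) (-‿inverseʳ _)

  x-y≈0⇒x≈y : ∀ x y → x - y ≈ 0# → x ≈ y
  x-y≈0⇒x≈y x y eq = trans (solve 2 (λ x y → x := x :- y :+ y) refl x y) (trans (+-congʳ eq) (+-identityˡ y))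

  1^≈1 : ∀ m → 1# ^ m ≈ 1#
  1^≈1 zero    = refl
  1^≈1 (suc m) = trans (*-identityˡ _) (1^≈1 m)

  ι-^ : ∀ m j → ι (m ℕ.^ j) ≈ ι m ^ j
  ι-^ m zero    = ι1≈1
  ι-^ m (suc j) = trans (ι-* m (m ℕ.^ j)) (*-congˡ (ι-^ m j))

  ∑-zero : ∀ {f : ℕ → Carrier} n → (∀ i → i < n → f i ≈ 0#) → ∑ f n ≈ 0#
  ∑-zero zero    h = refl
  ∑-zero (suc n) h = trans (+-cong (∑-zero n λ i i<n → h i (ℕ.m<n⇒m<1+n i<n)) (h n ℕ.≤-refl)) (+-identityˡ 0#)

  ∑-*ˡ : ∀ c (f : ℕ → Carrier) n → ∑ (λ i → c * f i) n ≈ c * ∑ f n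
  ∑-*ˡ c f zero    = sym (zeroʳ c)
  ∑-*ˡ c f (suc n) = trans (+-congʳ (∑-*ˡ c f n)) (sym (distribˡ _ _ _))

  ∑-trim : ∀ {f : ℕ → Carrier} m k → (∀ i → m ≤ i → i < m ℕ.+ k → f i ≈ 0#) → ∑ f (m ℕ.+ k) ≈ ∑ f m
  ∑-trim {f} m zero    h = reflexive (≡.cong (∑ f) (ℕ.+-identityʳ m))
  ∑-trim {f} m (suc k) h = begin
    ∑ f (m ℕ.+ suc k)              ≈⟨ reflexive (≡.cong (∑ f) (ℕ.+-suc m k)) ⟩
    ∑ f (m ℕ.+ k) + f (m ℕ.+ k)
      ≈⟨ +-cong (∑-trim m k λ i m≤i i<m+k → h i m≤i (ℕ.<-trans i<m+k m+k<)) (h (m ℕ.+ k) (ℕ.m≤m+n m k) m+k<) ⟩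
    ∑ f m + 0#                     ≈⟨ +-identityʳ _ ⟩
    ∑ f m                          ∎
    where
    m+k< : m ℕ.+ k < m ℕ.+ suc k
    m+k< = ℕ.≤-reflexive (≡.sym (ℕ.+-suc m k))

  -- Cancellability is asked of each factor separately, because the rings in use are not known to be
  -- domains.
  ∏-cancel : ∀ {f : ℕ → Carrier} m → (∀ i → i < m → ∀ x → x * f i ≈ 0# → x ≈ 0#) → ∀ x → x * ∏ f m ≈ 0# → x ≈ 0#
  ∏-cancel zero    h x eq = trans (sym (*-identityʳ x)) eq
  ∏-cancel (suc m) h x eq = ∏-cancel m (λ i i<m → h i (ℕ.m<n⇒m<1+n i<m)) x
    (h m ℕ.≤-refl _ (trans (*-assoc _ _ _) eq))

  ∏-zero : ∀ {f : ℕ → Carrier} i m → i < m → f i ≈ 0# → ∏ f m ≈ 0#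
  ∏-zero i (suc m) (s≤s i≤m) eq with ℕ.m≤n⇒m<n∨m≡n i≤m
  ... | inj₁ i<m    = trans (*-congʳ (∏-zero i m i<m eq)) (zeroˡ _)
  ... | inj₂ ≡.refl = trans (*-congˡ eq) (zeroʳ _)

-- The telescoping identity

module Telescope (R : CommutativeRing 0ℓ 0ℓ) where
  open RingTheory R
  open ≈-R
  open Solver using (solve; _:=_; _:+_; _:*_; _:-_; :-_; con)

  -- mixed u d n = Σ_{m<n} u₀⋯u_{m-1} d_{m+1}⋯d_{n-1}
  mixed : (u d : ℕ → Carrier) → ℕ → Carrier
  mixed u d zero    = 0#
  mixed u d (suc n) = d n * mixed u d n + ∏ u n

  -- The defining recursion splits off the largest index, this one the smallest; reversal turns one
  -- into the other.
  mixed-first : ∀ u d n → mixed u d (suc n) ≈ ∏ (d ∘ suc) n + u 0 * mixed (u ∘ suc) (d ∘ suc) n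
  mixed-first u d zero    = begin
    d 0 * 0# + 1#   ≈⟨ +-congʳ (zeroʳ _) ⟩
    0# + 1#         ≈⟨ +-comm _ _ ⟩
    1# + 0#         ≈⟨ +-congˡ (sym (zeroʳ _)) ⟩
    1# + u 0 * 0#   ∎
  mixed-first u d (suc n) = begin
    d (suc n) * mixed u d (suc n) + ∏ u (suc n)
      ≈⟨ +-cong (*-congˡ (mixed-first u d n)) (∏.fold-first u n) ⟩
    d (suc n) * (∏ (d ∘ suc) n + u 0 * mixed (u ∘ suc) (d ∘ suc) n) + u 0 * ∏ (u ∘ suc) n
      ≈⟨ solve 5 (λ a b c e f → a :* (b :+ c :* e) :+ c :* f := b :* a :+ c :* (a :* e :+ f)) refl _ _ _ _ _ ⟩
    ∏ (d ∘ suc) (suc n) + u 0 * mixed (u ∘ suc) (d ∘ suc) (suc n) ∎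

  -- In each summand the factors of `u` precede the omitted index and those of `d` follow it, so
  -- reading the indices backwards interchanges the two sequences.
  mixed-reverse : ∀ {u d u′ d′} n → (∀ i j → suc (i ℕ.+ j) ≡ n → u i ≈ u′ j) →
                  (∀ i j → suc (i ℕ.+ j) ≡ n → d i ≈ d′ j) → mixed u d n ≈ mixed d′ u′ n
  mixed-reverse                     zero    hu hd = refl
  mixed-reverse {u} {d} {u′} {d′} (suc n) hu hd = begin
    d n * mixed u d n + ∏ u n
      ≈⟨ +-cong (*-cong (hd n 0 (≡.cong suc (ℕ.+-identityʳ n))) (mixed-reverse n (shift hu) (shift hd)))
                (∏.fold-reverse n (shift hu)) ⟩
    d′ 0 * mixed (d′ ∘ suc) (u′ ∘ suc) n + ∏ (u′ ∘ suc) n  ≈⟨ +-comm _ _ ⟩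
    ∏ (u′ ∘ suc) n + d′ 0 * mixed (d′ ∘ suc) (u′ ∘ suc) n  ≈⟨ sym (mixed-first d′ u′ n) ⟩
    mixed d′ u′ (suc n) ∎
    where
    shift : ∀ {f g : ℕ → Carrier} → (∀ i j → suc (i ℕ.+ j) ≡ suc n → f i ≈ g j) →
            ∀ i j → suc (i ℕ.+ j) ≡ n → f i ≈ g (suc j)
    shift h i j e = h i (suc j) (≡.cong suc (≡.trans (ℕ.+-suc i j) e))

  mixed-cong : ∀ {u d u′ d′} n → (∀ i → u i ≈ u′ i) → (∀ i → d i ≈ d′ i) → mixed u d n ≈ mixed u′ d′ n
  mixed-cong zero    hu hd = refl
  mixed-cong (suc n) hu hd = +-cong (*-cong (hd n) (mixed-cong n hu hd)) (∏.fold-cong n hu)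

  sgn : ℕ → Carrier
  sgn zero    = 1#
  sgn (suc n) = - sgn n

  sgn-+ : ∀ i j → sgn (i ℕ.+ j) ≈ sgn i * sgn j
  sgn-+ zero    j = sym (*-identityˡ _)
  sgn-+ (suc i) j = trans (-‿cong (sgn-+ i j)) (-‿distribˡ-* _ _)

  sgn² : ∀ i → sgn i * sgn i ≈ 1#
  sgn² zero    = *-identityˡ _
  sgn² (suc i) = trans (solve 1 (λ a → (:- a) :* (:- a) := a :* a) refl (sgn i)) (sgn² i)

  sgn-prime-pred : ∀ {n} → Prime (suc n) → 2 < suc n → sgn n ≈ 1#
  sgn-prime-pred pr 2<p with prime-pred-even pr 2<p
  ... | h , ≡.refl = trans (sgn-+ h h) (sgn² h)

  alternating-sum : ∀ (x h : ℕ → Carrier) → (∀ i → x i + x (suc i) ≈ ι 2 * h i) →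
                    ∀ n → x 0 ≈ ι 2 * ∑ (λ i → sgn i * h i) n + sgn n * x n
  alternating-sum x h e zero    = solve 1 (λ a → a := con (ℤ.+ 2) :* con (ℤ.+ 0) :+ con (ℤ.+ 1) :* a) refl (x 0)
  alternating-sum x h e (suc n) = begin
    x 0                                         ≈⟨ alternating-sum x h e n ⟩
    ι 2 * S + sgn n * x n
      ≈⟨ solve 4 (λ a s b c → con (ℤ.+ 2) :* s :+ a :* b := con (ℤ.+ 2) :* s :+ a :* (b :+ c) :+ (:- a) :* c) refl
           (sgn n) S (x n) (x (suc n)) ⟩
    ι 2 * S + sgn n * (x n + x (suc n)) + - sgn n * x (suc n) ≈⟨ +-congʳ (+-congˡ (*-congˡ (e n))) ⟩
    ι 2 * S + sgn n * (ι 2 * h n) + - sgn n * x (suc n)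
      ≈⟨ solve 4 (λ a s b c → con (ℤ.+ 2) :* s :+ a :* (con (ℤ.+ 2) :* b) :+ (:- a) :* c := con (ℤ.+ 2) :*
           (s :+ a :* b) :+ (:- a) :* c) refl (sgn n) S (h n) (x (suc n)) ⟩
    ι 2 * (S + sgn n * h n) + - sgn n * x (suc n) ∎
    where S = ∑ (λ i → sgn i * h i) n

  module Core (t w : Carrier) where

    e d u : ℕ → Carrier
    e j = t - ι j
    d j = e j * e j - w
    u j = - ι j * e j

    -- Jᵢ is the mixed sum of the sequences u and d shifted by i, the factor ι j being left unshifted.
    J : ℕ → ℕ → Carrier
    J i = mixed (λ j → - ι (suc j) * e (i ℕ.+ suc j)) (λ j → d (i ℕ.+ suc j))

    private
      Y : ℕ → ℕ → Carrier
      Y i = ∏ (λ j → - ι (suc j) * e (i ℕ.+ suc j))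

      e-≡ : ∀ {m n} → m ≡ n → e m ≈ e n
      e-≡ ≡.refl = refl

      e-+ : ∀ i n → e (i ℕ.+ n) ≈ e i - ι n
      e-+ i n = begin
        t - ι (i ℕ.+ n)  ≈⟨ +-congˡ (-‿cong (ι-+ i n)) ⟩
        t - (ι i + ι n)  ≈⟨ solve 3 (λ a b c → a :- (b :+ c) := (a :- b) :- c) refl _ _ _ ⟩
        t - ι i - ι n    ∎

      -- `Y i (suc n)` pairs the factors 1, ..., n + 1 of `ι` with the arguments i + 1, ..., i + n +
      -- 1 of `e`. Taking out the largest of the former and the smallest of the latter leaves the
      -- product of the same kind, shifted by one.
      Y-suc : ∀ i n → Y i (suc n) ≈ - ι (suc n) * e (suc i) * Y (suc i) n
      Y-suc i zero    = begin
        1# * (- ι 1 * e (i ℕ.+ 1))  ≈⟨ *-identityˡ _ ⟩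
        - ι 1 * e (i ℕ.+ 1)         ≈⟨ *-congˡ (e-≡ (ℕ.+-comm i 1)) ⟩
        - ι 1 * e (suc i)           ≈⟨ sym (*-identityʳ _) ⟩
        - ι 1 * e (suc i) * 1#      ∎
      Y-suc i (suc n) = begin
        Y i (suc n) * (- ι (suc (suc n)) * e (i ℕ.+ suc (suc n)))
          ≈⟨ *-cong (Y-suc i n) (*-congˡ (e-≡ (ℕ.+-suc i (suc n)))) ⟩
        - ι (suc n) * e (suc i) * Y (suc i) n * (- ι (suc (suc n)) * e (suc i ℕ.+ suc n))
          ≈⟨ solve 5 (λ a b c f g → a :* b :* c :* (f :* g) := f :* b :* (c :* (a :* g))) refl _ _ _ _ _ ⟩
        - ι (suc (suc n)) * e (suc i) * (Y (suc i) n * (- ι (suc n) * e (suc i ℕ.+ suc n))) ∎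

    -- Induction on n: by `Y-suc` the new terms regroup into `d′` times the previous identity plus
    -- `Y₁` times d₁ + ν(e₁ + e′) - d′. That bracket is a difference of squares and vanishes because
    -- e′ = e₁ + ν. At n = p - 1 periodicity identifies `d (suc i)` with `d (suc i + p)`, and the
    -- left side becomes the sum of two consecutive J of length p.
    telescope : ∀ i n → d (suc i) * J (suc i) n + J i (suc n) + Y (suc i) n ≈ ι 2 * ∏ (λ j → d (suc i ℕ.+ suc j)) n
    telescope i zero    = solve 2 (λ a b → a :* con (ℤ.+ 0) :+ (b :* con (ℤ.+ 0) :+ con (ℤ.+ 1)) :+ con (ℤ.+ 1) := con
        (ℤ.+ 2) :* con (ℤ.+ 1)) refl (d (suc i)) (d (i ℕ.+ 1))
    telescope i (suc n) = begin
      d₁ * (d′ * J₁ + Y₁) + (d (i ℕ.+ suc (suc n)) * J₀ + Y i (suc n)) + Y₁ * (ν * e′)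
        ≈⟨ +-congʳ (+-congˡ (+-cong (*-congʳ (-≡d (ℕ.+-suc i (suc n)))) (Y-suc i n))) ⟩
      d₁ * (d′ * J₁ + Y₁) + (d′ * J₀ + ν * e₁ * Y₁) + Y₁ * (ν * e′)
        ≈⟨ solve 8 (λ d₁ d′ j y j₀ f e₁ e′ → d₁ :* (d′ :* j :+ y) :+ (d′ :* j₀ :+ f :* e₁ :* y) :+ y :* (f :* e′)
              := d′ :* (d₁ :* j :+ j₀ :+ y) :+ y :* (d₁ :+ f :* (e₁ :+ e′) :- d′)) refl d₁ d′ J₁ Y₁ J₀ ν e₁ e′ ⟩
      d′ * (d₁ * J₁ + J₀ + Y₁) + Y₁ * (d₁ + ν * (e₁ + e′) - d′)
        ≈⟨ +-cong (*-congˡ (telescope i n)) (trans (*-congˡ vanish) (zeroʳ _)) ⟩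
      d′ * (ι 2 * H) + 0#
        ≈⟨ solve 2 (λ a b → a :* (con (ℤ.+ 2) :* b) :+ con (ℤ.+ 0) := con (ℤ.+ 2) :* (b :* a)) refl d′ H ⟩
      ι 2 * (H * d′) ∎
      where
      d₁ = d (suc i)
      d′ = d (suc i ℕ.+ suc n)
      J₁ = J (suc i) n
      J₀ = J i (suc n)
      Y₁ = Y (suc i) n
      ν  = - ι (suc n)
      e₁ = e (suc i)
      e′ = e (suc i ℕ.+ suc n)
      -≡d : ∀ {m n} → m ≡ n → d m ≈ d n
      -≡d ≡.refl = refl
      H  = ∏ (λ j → d (suc i ℕ.+ suc j)) n
      vanish : d₁ + ν * (e₁ + e′) - d′ ≈ 0#
      vanish = begin
        d₁ + ν * (e₁ + e′) - (e′ * e′ - w)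
          ≈⟨ +-cong (+-congˡ (*-congˡ (+-congˡ e-eq))) (-‿cong (+-congʳ (*-cong e-eq e-eq))) ⟩
        d₁ + ν * (e₁ + (e₁ + ν)) - ((e₁ + ν) * (e₁ + ν) - w)
          ≈⟨ solve 3 (λ e f w → e :* e :- w :+ f :* (e :+ (e :+ f)) :- ((e :+ f) :* (e :+ f) :- w) := con (ℤ.+ 0))
               refl e₁ ν w ⟩
        0# ∎
        where e-eq = e-+ (suc i) (suc n)

    -- In characteristic p = n + 1 the shifts are p-periodic, so that Jᵢ + Jᵢ₊₁ = 2 Hᵢ can be solved for J₀.
    module Periodic (n : ℕ) (char : ι (suc n) ≈ 0#) (n-even : sgn n ≈ 1#) (half : Carrier)
        (half-2 : half * ι 2 ≈ 1#) where

      p : ℕ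
      p = suc n

      private
        H C : ℕ → Carrier
        H i = ∏ (λ j → d (suc i ℕ.+ suc j)) n
        C i = ∏ (λ j → d (i ℕ.+ suc j)) p

        e-periodic : ∀ i → e (i ℕ.+ p) ≈ e i
        e-periodic i = begin
          e (i ℕ.+ p)  ≈⟨ e-+ i p ⟩
          e i - ι p    ≈⟨ +-congˡ (trans (-‿cong char) -0#≈0#) ⟩
          e i + 0#     ≈⟨ +-identityʳ _ ⟩
          e i          ∎

        d-periodic : ∀ i → d (i ℕ.+ p) ≈ d i
        d-periodic i = +-congʳ (*-cong (e-periodic i) (e-periodic i))

        e-periodic′ : ∀ i → e (p ℕ.+ i) ≈ e i
        e-periodic′ i = trans (e-≡ (ℕ.+-comm p i)) (e-periodic i)

        d-periodic′ : ∀ i → d (p ℕ.+ i) ≈ d i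
        d-periodic′ i = +-congʳ (*-cong (e-periodic′ i) (e-periodic′ i))

        J-step : ∀ i → J i p + J (suc i) p ≈ ι 2 * H i
        J-step i = begin
          J i p + (d (suc i ℕ.+ p) * J (suc i) n + Y (suc i) n)  ≈⟨ +-congˡ (+-congʳ (*-congʳ (d-periodic (suc i)))) ⟩
          J i p + (d (suc i) * J (suc i) n + Y (suc i) n)
            ≈⟨ solve 3 (λ a b c → a :+ (b :+ c) := b :+ a :+ c) refl _ _ _ ⟩
          d (suc i) * J (suc i) n + J i p + Y (suc i) n          ≈⟨ telescope i n ⟩
          ι 2 * H i                                              ∎

        J-periodic : J p p ≈ J 0 p
        J-periodic = mixed-cong p (λ j → *-congˡ (e-periodic′ (suc j))) (λ j → d-periodic′ (suc j))

        -- As p is odd and J is p-periodic in its shift, `alternating-sum` reads J₀ = 2S - J₀;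
        -- `half` then removes the factor 2.
        J-alternating : J 0 p ≈ ∑ (λ i → sgn i * H i) p
        J-alternating = begin
          x                      ≈⟨ sym (*-identityˡ x) ⟩
          1# * x                 ≈⟨ *-congʳ (sym half-2) ⟩
          half * ι 2 * x         ≈⟨ solve 2 (λ h x → h :* con (ℤ.+ 2) :* x := h :* (x :+ x)) refl half x ⟩
          half * (x + x)         ≈⟨ *-congˡ (+-congʳ (alternating-sum (λ i → J i p) H J-step p)) ⟩
          half * (ι 2 * S + - sgn n * J p p + x)  ≈⟨ *-congˡ (+-congʳ (+-congˡ (*-cong (-‿cong n-even) J-periodic))) ⟩
          half * (ι 2 * S + - 1# * x + x)
            ≈⟨ solve 3 (λ h s x → h :* (con (ℤ.+ 2) :* s :+ (:- con (ℤ.+ 1)) :* x :+ x) := h :* con (ℤ.+ 2) :* s) refl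
                 half S x ⟩
          half * ι 2 * S         ≈⟨ *-congʳ half-2 ⟩
          1# * S                 ≈⟨ *-identityˡ S ⟩
          S                      ∎
          where
          x = J 0 p
          S = ∑ (λ i → sgn i * H i) p

        d-≡ : ∀ {m n} → m ≡ n → d m ≈ d n
        d-≡ ≡.refl = refl

        C-first : ∀ i → C i ≈ d (suc i) * H i
        C-first i = trans (∏.fold-first (λ j → d (i ℕ.+ suc j)) n)
          (*-cong (d-≡ (ℕ.+-comm i 1)) (∏.fold-cong n λ j → d-≡ (ℕ.+-suc i (suc j))))

        -- `C i` is the product of `d` over a complete residue system, so a shift only moves one
        -- factor from the front to the back.
        C-suc : ∀ i → C (suc i) ≈ C i
        C-suc i = begin
          H i * d (suc i ℕ.+ p)  ≈⟨ *-congˡ (d-periodic (suc i)) ⟩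
          H i * d (suc i)        ≈⟨ *-comm _ _ ⟩
          d (suc i) * H i        ≈⟨ sym (C-first i) ⟩
          C i                    ∎

        C-constant : ∀ i → C i ≈ C 0
        C-constant zero    = refl
        C-constant (suc i) = trans (C-suc i) (C-constant i)

      -- `H i` is the full period product with `d (suc i)` left out, so multiplying by w = d (suc i)
      -- U (suc i) restores it. The last term i = n would require an inverse of `d p`, which is not
      -- a unit in the application; it is kept apart as the summand w times the product of d₁, ...,
      -- dₙ.
      evaluation : ∀ (U : ℕ → Carrier) → (∀ i → i < n → d (suc i) * U (suc i) ≈ w) →
        w * (d p * J 0 n + ∏ (u ∘ suc) n) ≈ d p * ∏ (d ∘ suc) n * ∑ (λ i → sgn i * U (suc i)) n + w * ∏ (d ∘ suc) n
      evaluation U dU = begin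
        w * J 0 p                                               ≈⟨ *-congˡ J-alternating ⟩
        w * (∑ (λ i → sgn i * H i) n + sgn n * H n)             ≈⟨ distribˡ _ _ _ ⟩
        w * ∑ (λ i → sgn i * H i) n + w * (sgn n * H n)
          ≈⟨ +-cong (wH n ℕ.≤-refl) (*-congˡ (trans (*-cong n-even (∏.fold-cong n λ j → d-periodic′ (suc j)))
               (*-identityˡ _))) ⟩
        d p * P * ∑ (λ i → sgn i * U (suc i)) n + w * P         ∎
        where
        P = ∏ (d ∘ suc) n
        wHᵢ : ∀ i → i < n → w * H i ≈ d p * P * U (suc i)
        wHᵢ i i<n = begin
          w * H i                      ≈⟨ *-congʳ (sym (dU i i<n)) ⟩
          d (suc i) * U (suc i) * H i  ≈⟨ solve 3 (λ a b c → a :* b :* c := a :* c :* b) refl _ _ _ ⟩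
          d (suc i) * H i * U (suc i)  ≈⟨ *-congʳ (trans (sym (C-first i)) (C-constant i)) ⟩
          P * d p * U (suc i)          ≈⟨ *-congʳ (*-comm _ _) ⟩
          d p * P * U (suc i)          ∎
        wH : ∀ m → m ℕ.≤ n → w * ∑ (λ i → sgn i * H i) m ≈ d p * P * ∑ (λ i → sgn i * U (suc i)) m
        wH zero    _   = trans (zeroʳ _) (sym (zeroʳ _))
        wH (suc m) m<n = begin
          w * (∑ (λ i → sgn i * H i) m + sgn m * H m)
            ≈⟨ solve 4 (λ w a s h → w :* (a :+ s :* h) := w :* a :+ s :* (w :* h)) refl _ _ _ _ ⟩
          w * ∑ (λ i → sgn i * H i) m + sgn m * (w * H m)  ≈⟨ +-cong (wH m (ℕ.<⇒≤ m<n)) (*-congˡ (wHᵢ m m<n)) ⟩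
          d p * P * ∑ (λ i → sgn i * U (suc i)) m + sgn m * (d p * P * U (suc m))
            ≈⟨ solve 4 (λ a b s v → a :* b :+ s :* (a :* v) := a :* (b :+ s :* v)) refl _ _ _ _ ⟩
          d p * P * (∑ (λ i → sgn i * U (suc i)) m + sgn m * U (suc m)) ∎

-- Characteristic p

module BinomialTransform (R : CommutativeRing 0ℓ 0ℓ) where
  open RingTheory R
  open ≈-R
  open Solver using (solve; _:=_; _:+_; _:*_; con)

  -- This is Σ_j C(n, j) u_j, the n-th power of 1 + shift evaluated at 0. On exponential generating
  -- functions it is multiplication by e^x; the recursive form gives its laws without handling
  -- binomial sums.
  binomialTransform : (ℕ → Carrier) → ℕ → Carrier
  binomialTransform u zero    = u 0
  binomialTransform u (suc n) = binomialTransform u n + binomialTransform (u ∘ suc) n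

  private
    T = binomialTransform

  binomialTransform-cong : ∀ {u v} n → (∀ i → u i ≈ v i) → T u n ≈ T v n
  binomialTransform-cong zero    h = h 0
  binomialTransform-cong (suc n) h = +-cong (binomialTransform-cong n h) (binomialTransform-cong n (h ∘ suc))

  binomialTransform-+ : ∀ u v n → T (λ i → u i + v i) n ≈ T u n + T v n
  binomialTransform-+ u v zero    = refl
  binomialTransform-+ u v (suc n) = trans
    (+-cong (binomialTransform-+ u v n) (binomialTransform-+ (u ∘ suc) (v ∘ suc) n))
    (solve 4 (λ a b c d → (a :+ b) :+ (c :+ d) := (a :+ c) :+ (b :+ d)) refl _ _ _ _)

  binomialTransform-* : ∀ c u n → T (λ i → c * u i) n ≈ c * T u n
  binomialTransform-* c u zero    = refl
  binomialTransform-* c u (suc n) = trans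
    (+-cong (binomialTransform-* c u n) (binomialTransform-* c (u ∘ suc) n)) (sym (distribˡ _ _ _))

  binomialTransform-∑ : ∀ (u : ℕ → ℕ → Carrier) m n → T (λ i → ∑ (λ j → u j i) m) n ≈ ∑ (λ j → T (u j) n) m
  binomialTransform-∑ u m zero    = refl
  binomialTransform-∑ u m (suc n) = trans
    (+-cong (binomialTransform-∑ u m n) (binomialTransform-∑ (λ j i → u j (suc i)) m n)) (sym (∑.fold-∙ _ _ m))

  binomialTransform-^ : ∀ x n → T (x ^_) n ≈ (1# + x) ^ n
  binomialTransform-^ x zero    = refl
  binomialTransform-^ x (suc n) = begin
    T (x ^_) n + T (λ i → x * x ^ i) n  ≈⟨ +-congˡ (binomialTransform-* x (x ^_) n) ⟩
    T (x ^_) n + x * T (x ^_) n         ≈⟨ solve 2 (λ x a → a :+ x :* a := (con (ℤ.+ 1) :+ x) :* a) refl x _ ⟩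
    (1# + x) * T (x ^_) n               ≈⟨ *-congˡ (binomialTransform-^ x n) ⟩
    (1# + x) ^ suc n                    ∎

  binomialTransform-formula : ∀ u n → T u n ≈ ∑ (λ j → ι (n C j) * u j) (suc n)
  binomialTransform-formula u zero    = begin
    u 0                   ≈⟨ solve 1 (λ a → a := con (ℤ.+ 0) :+ con (ℤ.+ 1) :* a) refl (u 0) ⟩
    0# + 1# * u 0         ≈⟨ +-congˡ (*-congʳ (sym ι1≈1)) ⟩
    0# + ι 1 * u 0        ∎
  binomialTransform-formula u (suc n) = begin
    T u n + T (u ∘ suc) n
      ≈⟨ +-cong (binomialTransform-formula u n) (binomialTransform-formula (u ∘ suc) n) ⟩
    A + B
      ≈⟨ +-congʳ (trans (sym (+-identityʳ A)) (+-congˡ (sym (trans (*-congʳ (ι-≡ (k>n⇒nCk≡0 {n} ℕ.≤-refl)))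
           (zeroˡ _))))) ⟩
    ∑ (λ j → ι (n C j) * u j) (suc (suc n)) + B
      ≈⟨ +-congʳ (∑.fold-first _ (suc n)) ⟩
    ι 1 * u 0 + A′ + B
      ≈⟨ solve 3 (λ a b c → a :+ b :+ c := a :+ (c :+ b)) refl _ _ _ ⟩
    ι 1 * u 0 + (B + A′)
      ≈⟨ +-congˡ (sym (∑.fold-∙ _ _ (suc n))) ⟩
    ι 1 * u 0 + ∑ (λ j → ι (n C j) * u (suc j) + ι (n C suc j) * u (suc j)) (suc n)
      ≈⟨ +-congˡ (∑.fold-cong (suc n) λ j → trans (sym (distribʳ _ _ _))
           (*-congʳ (trans (sym (ι-+ (n C j) (n C suc j))) (ι-≡ (nCk+nC[k+1]≡[n+1]C[k+1] n j))))) ⟩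
    ι 1 * u 0 + ∑ (λ j → ι (suc n C suc j) * u (suc j)) (suc n)
      ≈⟨ sym (∑.fold-first _ (suc n)) ⟩
    ∑ (λ j → ι (suc n C j) * u j) (suc (suc n)) ∎
    where
    A  = ∑ (λ j → ι (n C j) * u j) (suc n)
    A′ = ∑ (λ j → ι (n C suc j) * u (suc j)) (suc n)
    B  = ∑ (λ j → ι (n C j) * u (suc j)) (suc n)

-- Coefficients of xᵐ in the Newton basis Π_{j≤k} (x - j); these are the Stirling numbers S(m+1,k+1).
newtonCoeff : ℕ → ℕ → ℕ
newtonCoeff zero    zero    = 1
newtonCoeff zero    (suc k) = 0
newtonCoeff (suc m) zero    = newtonCoeff m zero
newtonCoeff (suc m) (suc k) = newtonCoeff m k ℕ.+ suc (suc k) ℕ.* newtonCoeff m (suc k)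

newtonCoeff-0 : ∀ m → newtonCoeff m 0 ≡ 1
newtonCoeff-0 zero    = ≡.refl
newtonCoeff-0 (suc m) = newtonCoeff-0 m

newtonCoeff-> : ∀ m k → m < k → newtonCoeff m k ≡ 0
newtonCoeff-> zero    (suc k) _         = ≡.refl
newtonCoeff-> (suc m) (suc k) (s≤s m<k)
  rewrite newtonCoeff-> m k m<k | newtonCoeff-> m (suc k) (ℕ.m<n⇒m<1+n m<k) = ℕ.*-zeroʳ k

newtonCoeff-diag : ∀ m → newtonCoeff m m ≡ 1
newtonCoeff-diag zero    = ≡.refl
newtonCoeff-diag (suc m)
  rewrite newtonCoeff-diag m | newtonCoeff-> m (suc m) ℕ.≤-refl = ≡.cong suc (ℕ.*-zeroʳ m)

module NewtonBasis (R : CommutativeRing 0ℓ 0ℓ) where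
  open RingTheory R
  open ≈-R
  open Solver using (solve; _:=_; _:+_; _:*_; _:-_; con)

  newton : ℕ → Carrier → Carrier
  newton k x = ∏ (λ j → x - ι (suc j)) k

  ^-newton : ∀ x m → x ^ m ≈ ∑ (λ k → ι (newtonCoeff m k) * newton k x) (suc m)
  ^-newton x zero    = begin
    1#                ≈⟨ sym ι1≈1 ⟩
    ι 1               ≈⟨ solve 1 (λ a → a := con (ℤ.+ 0) :+ a :* con (ℤ.+ 1)) refl (ι 1) ⟩
    0# + ι 1 * 1#     ∎
  ^-newton x (suc m) = begin
    x * x ^ m                       ≈⟨ *-congˡ (^-newton x m) ⟩
    x * ∑ (λ k → c k * N k) (suc m) ≈⟨ sym (∑-*ˡ x _ (suc m)) ⟩
    ∑ (λ k → x * (c k * N k)) (suc m)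
      -- Since x N_k = N_(k+1) + (k+1) N_k, the two halves supply the two terms in the recurrence of
      -- `newtonCoeff`.
      ≈⟨ ∑.fold-cong (suc m) (λ k → solve 4 (λ x c N j → x :* (c :* N) := c :* (N :* (x :- j)) :+ c :* j :* N) refl x
           (c k) (N k) (ι (suc k))) ⟩
    ∑ (λ k → A k + B k) (suc m)     ≈⟨ ∑.fold-∙ A B (suc m) ⟩
    ∑ A (suc m) + ∑ B (suc m)
      ≈⟨ +-congˡ (trans (sym (+-identityʳ _)) (+-congˡ (sym B-last))) ⟩
    ∑ A (suc m) + ∑ B (suc (suc m)) ≈⟨ +-congˡ (∑.fold-first B (suc m)) ⟩
    ∑ A (suc m) + (B 0 + ∑ (B ∘ suc) (suc m))
      ≈⟨ solve 3 (λ a b c → a :+ (b :+ c) := b :+ (a :+ c)) refl _ _ _ ⟩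
    B 0 + (∑ A (suc m) + ∑ (B ∘ suc) (suc m))
      ≈⟨ +-cong (*-congʳ (trans (*-congˡ ι1≈1) (*-identityʳ _))) (sym (∑.fold-∙ A (B ∘ suc) (suc m))) ⟩
    c 0 * N 0 + ∑ (λ k → A k + B (suc k)) (suc m)
      ≈⟨ +-congˡ (∑.fold-cong (suc m) λ k → trans
           (solve 4 (λ a N b j → a :* N :+ b :* j :* N := (a :+ j :* b) :* N) refl (c k) (N (suc k)) (c (suc k))
               (ι (suc (suc k))))
           (*-congʳ (trans (+-congˡ (sym (ι-* (suc (suc k)) (newtonCoeff m (suc k)))))
               (sym (ι-+ (newtonCoeff m k) _))))) ⟩
    c 0 * N 0 + ∑ (λ k → ι (newtonCoeff (suc m) (suc k)) * N (suc k)) (suc m)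
      ≈⟨ sym (∑.fold-first _ (suc m)) ⟩
    ∑ (λ k → ι (newtonCoeff (suc m) k) * N k) (suc (suc m)) ∎
    where
    N c A B : ℕ → Carrier
    N k = newton k x
    c k = ι (newtonCoeff m k)
    A k = c k * N (suc k)
    B k = c k * ι (suc k) * N k
    B-last : B (suc m) ≈ 0#
    B-last = trans (*-congʳ (trans (*-congʳ (ι-≡ (newtonCoeff-> m (suc m) ℕ.≤-refl))) (zeroˡ _))) (zeroˡ _)

module PrimeCharacteristic (R : CommutativeRing 0ℓ 0ℓ) (n : ℕ) (prime : Prime (suc n))
                           (char : CommutativeRing._≈_ R (RingTheory.ι R (suc n)) (CommutativeRing.0# R)) where
  open RingTheory R
  open BinomialTransform R
  open NewtonBasis R
  open ≈-R
  open Solver using (solve; _:=_; _:+_; _:*_; _:-_; :-_; con)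

  p : ℕ
  p = suc n

  ι-∣ : ∀ {m} → p ∣ m → ι m ≈ 0#
  ι-∣ (divides q ≡.refl) = trans (ι-* q p) (trans (*-congˡ char) (zeroʳ _))

  ι-complement : ∀ a b → a ℕ.+ b ≡ p → ι a ≈ - ι b
  ι-complement a b eq = begin
    ι a                  ≈⟨ solve 2 (λ a b → a := a :+ b :- b) refl (ι a) (ι b) ⟩
    ι a + ι b - ι b      ≈⟨ +-congʳ (trans (sym (ι-+ a b)) (trans (ι-≡ eq) char)) ⟩
    0# - ι b             ≈⟨ +-identityˡ _ ⟩
    - ι b                ∎

  frobenius-suc : ∀ x → (1# + x) ^ p ≈ 1# + x ^ p
  frobenius-suc x = begin
    (1# + x) ^ p                               ≈⟨ sym (binomialTransform-^ x p) ⟩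
    binomialTransform (x ^_) p                 ≈⟨ binomialTransform-formula (x ^_) p ⟩
    ∑ f p + f p                                ≈⟨ +-cong (∑.fold-first f n) last ⟩
    f 0 + ∑ (f ∘ suc) n + x ^ p
      ≈⟨ +-congʳ (+-cong (trans (*-congʳ ι1≈1) (*-identityˡ _)) (∑-zero n middle)) ⟩
    1# + 0# + x ^ p                            ≈⟨ +-congʳ (+-identityʳ 1#) ⟩
    1# + x ^ p                                 ∎
    where
    f : ℕ → Carrier
    f j = ι (p C j) * x ^ j
    last : f p ≈ x ^ p
    last = trans (*-congʳ (trans (ι-≡ (nCn≡1 p)) ι1≈1)) (*-identityˡ _)
    middle : ∀ i → i < n → f (suc i) ≈ 0#
    middle i i<n = trans (*-congʳ (ι-∣ (prime∣binomial prime (suc i) ℕ.z<s (ℕ.s<s i<n)))) (zeroˡ _)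

  fermat : ∀ a → ι a ^ p ≈ ι a
  fermat zero    = zeroˡ _
  fermat (suc a) = trans (frobenius-suc (ι a)) (+-congˡ (fermat a))

  ι-invertible : ∀ {a} → 0 < a → a < p → ∃ λ b → b * ι a ≈ 1#
  ι-invertible {a@(suc _)} _ a<p with coprime-Bézout (prime⇒coprime prime a<p)
  ... | Bézout.+- x y eq = - ι y , (begin
        - ι y * ι a
          ≈⟨ solve 2 (λ y a → (:- y) :* a := con (ℤ.+ 1) :- (con (ℤ.+ 1) :+ y :* a)) refl (ι y) (ι a) ⟩
        1# - (1# + ι y * ι a)      ≈⟨ +-congˡ (-‿cong (+-congˡ (sym (ι-* y a)))) ⟩
        1# - ι (1 ℕ.+ y ℕ.* a)     ≈⟨ +-congˡ (-‿cong (ι-∣ (divides x eq))) ⟩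
        1# - 0#                    ≈⟨ solve 0 (con (ℤ.+ 1) :- con (ℤ.+ 0) := con (ℤ.+ 1)) refl ⟩
        1#                         ∎)
  ... | Bézout.-+ x y eq = ι y , (begin
        ι y * ι a           ≈⟨ sym (ι-* y a) ⟩
        ι (y ℕ.* a)         ≈⟨ ι-≡ (≡.sym eq) ⟩
        1# + ι (x ℕ.* p)    ≈⟨ +-congˡ (ι-∣ (n∣m*n x)) ⟩
        1# + 0#             ≈⟨ +-identityʳ 1# ⟩
        1#                  ∎)

  ι-cancel : ∀ {a} → 0 < a → a < p → ∀ x → x * ι a ≈ 0# → x ≈ 0#
  ι-cancel {a} 0<a a<p x eq with ι-invertible 0<a a<p
  ... | b , inv = begin
    x                ≈⟨ sym (*-identityʳ x) ⟩
    x * 1#           ≈⟨ *-congˡ (sym inv) ⟩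
    x * (b * ι a)    ≈⟨ solve 3 (λ x b a → x :* (b :* a) := b :* (x :* a)) refl _ _ _ ⟩
    b * (x * ι a)    ≈⟨ *-congˡ eq ⟩
    b * 0#           ≈⟨ zeroʳ b ⟩
    0#               ∎

  fermat′ : ∀ {a} → 0 < a → a < p → ι a ^ n ≈ 1#
  fermat′ {a} 0<a a<p with ι-invertible 0<a a<p
  ... | b , inv = begin
    ι a ^ n              ≈⟨ sym (*-identityˡ _) ⟩
    1# * ι a ^ n         ≈⟨ *-congʳ (sym inv) ⟩
    b * ι a * ι a ^ n    ≈⟨ *-assoc _ _ _ ⟩
    b * ι a ^ p          ≈⟨ *-congˡ (fermat a) ⟩
    b * ι a              ≈⟨ inv ⟩
    1#                   ∎

  -- Unlike the Bézout witness of `ι-invertible`, the power with exponent p - 2 is a total function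
  -- of `a` and can stand in sums without side conditions.
  inv : ℕ → Carrier
  inv a = ι a ^ (n ∸ 1)

  private
    0<n : 0 < n
    0<n = ℕ.s<s⁻¹ (prime>1 prime)

  ι-inv : ∀ {a} → 0 < a → a < p → ι a * inv a ≈ 1#
  ι-inv {a} 0<a a<p = trans (reflexive (≡.cong (ι a ^_) (ℕ.m+[n∸m]≡n 0<n))) (fermat′ 0<a a<p)

  private
    newton-node : ∀ m k → m < k → newton k (ι (suc m)) ≈ 0#
    newton-node m k m<k = ∏-zero m k m<k (-‿inverseʳ _)

    b : ℕ → Carrier
    b k = ι (newtonCoeff n k)

    b0≈1 : b 0 ≈ 1#
    b0≈1 = trans (ι-≡ (newtonCoeff-0 n)) ι1≈1

    -- Fermat's theorem at the node m + 1 isolates b m.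
    b≈0 : ∀ M m → m < M → 0 < m → m < n → b m ≈ 0#
    b≈0 (suc M) m (s≤s m≤M) 0<m m<n = ∏-cancel m node-cancel (b m) (begin
      b m * newton m x                               ≈⟨ solve 1 (λ a → a := con (ℤ.+ 1) :+ a :- con (ℤ.+ 1)) refl _ ⟩
      1# + b m * newton m x - 1#                     ≈⟨ +-congʳ (+-congʳ (sym below)) ⟩
      ∑ f (suc m) - 1#
        ≈⟨ +-congʳ (sym (∑-trim (suc m) (n ∸ m) λ i m<i _ → trans (*-congˡ (newton-node m i m<i)) (zeroʳ _))) ⟩
      ∑ f (suc m ℕ.+ (n ∸ m)) - 1#
        ≈⟨ +-congʳ (reflexive (≡.cong (∑ f ∘ suc) (ℕ.m+[n∸m]≡n (ℕ.<⇒≤ m<n)))) ⟩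
      ∑ f (suc n) - 1#                               ≈⟨ +-congʳ (sym (^-newton x n)) ⟩
      x ^ n - 1#                                     ≈⟨ +-congʳ (fermat′ ℕ.z<s (ℕ.s<s m<n)) ⟩
      1# - 1#                                        ≈⟨ -‿inverseʳ 1# ⟩
      0#                                             ∎)
      where
      x = ι (suc m)
      f : ℕ → Carrier
      f k = b k * newton k x
      below : ∑ f m ≈ 1#
      below = begin
        ∑ f m              ≈⟨ reflexive (≡.cong (∑ f) (≡.sym (ℕ.m+[n∸m]≡n 0<m))) ⟩
        ∑ f (1 ℕ.+ (m ∸ 1)) ≈⟨ ∑-trim 1 (m ∸ 1) (λ i 0<i i<m → let i<m′ = ≡.subst (i <_) (ℕ.m+[n∸m]≡n 0<m) i<m in
                                 trans (*-congʳ (b≈0 M i (ℕ.<-≤-trans i<m′ m≤M) 0<i (ℕ.<-trans i<m′ m<n))) (zeroˡ _))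
                                     ⟩
        0# + b 0 * 1#      ≈⟨ +-congˡ (*-congʳ b0≈1) ⟩
        0# + 1# * 1#       ≈⟨ solve 0 (con (ℤ.+ 0) :+ con (ℤ.+ 1) :* con (ℤ.+ 1) := con (ℤ.+ 1)) refl ⟩
        1#                 ∎
      node-cancel : ∀ j → j < m → ∀ y → y * (x - ι (suc j)) ≈ 0# → y ≈ 0#
      node-cancel j j<m y eq = ι-cancel (ℕ.m<n⇒0<n∸m j<m) (ℕ.≤-<-trans (ℕ.m∸n≤m m j) (ℕ.m<n⇒m<1+n m<n)) y
          (trans (*-congˡ (begin
        ι (m ∸ j)                           ≈⟨ solve 2 (λ a b → a := b :+ a :- b) refl (ι (m ∸ j)) (ι (suc j)) ⟩
        ι (suc j) + ι (m ∸ j) - ι (suc j)   ≈⟨ +-congʳ (sym (ι-+ (suc j) (m ∸ j))) ⟩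
        ι (suc j ℕ.+ (m ∸ j)) - ι (suc j)   ≈⟨ +-congʳ (ι-≡ (≡.cong suc (ℕ.m+[n∸m]≡n (ℕ.<⇒≤ j<m)))) ⟩
        x - ι (suc j)                       ∎)) eq)

  -- Counting roots is not possible, as `R` may have zero divisors. Instead x^n is expanded in the
  -- Newton basis, whose coefficients are natural numbers independent of x. Fermat's theorem at the
  -- nodes kills all inner coefficients, and only the constant 1 and the top product survive.
  ∏-nodes : ∀ x → ∏ (λ j → x - ι (suc j)) n ≈ x ^ n - 1#
  ∏-nodes x = begin
    newton n x
      ≈⟨ solve 1 (λ a → a := con (ℤ.+ 1) :+ con (ℤ.+ 1) :* a :- con (ℤ.+ 1)) refl _ ⟩
    1# + 1# * newton n x - 1#
      ≈⟨ +-congʳ (+-cong (sym below) (*-congʳ (sym (trans (ι-≡ (newtonCoeff-diag n)) ι1≈1)))) ⟩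
    ∑ f (suc n) - 1#                         ≈⟨ +-congʳ (sym (^-newton x n)) ⟩
    x ^ n - 1#                               ∎
    where
    f : ℕ → Carrier
    f k = b k * newton k x
    below : ∑ f n ≈ 1#
    below = begin
      ∑ f n               ≈⟨ reflexive (≡.cong (∑ f) (≡.sym (ℕ.m+[n∸m]≡n 0<n))) ⟩
      ∑ f (1 ℕ.+ (n ∸ 1)) ≈⟨ ∑-trim 1 (n ∸ 1) (λ i 0<i i<n → let i<n′ = ≡.subst (i <_) (ℕ.m+[n∸m]≡n 0<n) i<n in
                               trans (*-congʳ (b≈0 n i i<n′ 0<i i<n′)) (zeroˡ _)) ⟩
      0# + b 0 * 1#       ≈⟨ +-congˡ (*-congʳ b0≈1) ⟩
      0# + 1# * 1#        ≈⟨ solve 0 (con (ℤ.+ 0) :+ con (ℤ.+ 1) :* con (ℤ.+ 1) := con (ℤ.+ 1)) refl ⟩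
      1#                  ∎

-- Power series

module PowerSeries (R : CommutativeRing 0ℓ 0ℓ) where
  open RingTheory R
  open Solver using (solve; _:=_; _:+_; _:*_; _:-_; :-_; con)

  Series : Set
  Series = ℕ → Carrier

  infix  4 _≋_
  infixl 6 _⊕_
  infixl 7 _⊛_ _·_

  _≋_ : Series → Series → Set
  f ≋ g = ∀ n → f n ≈ g n

  _⊕_ _⊛_ : Series → Series → Series
  (f ⊕ g) n = f n + g n
  (f ⊛ g) zero    = f 0 * g 0
  (f ⊛ g) (suc n) = f 0 * g (suc n) + (f ∘ suc ⊛ g) n

  _·_ : Carrier → Series → Series
  (c · f) n = c * f n

  ⊖_ : Series → Series
  (⊖ f) n = - f n

  cst : Carrier → Series
  cst c zero    = c
  cst c (suc n) = 0#

  ⊛-cong : ∀ {f f′ g g′} → f ≋ f′ → g ≋ g′ → f ⊛ g ≋ f′ ⊛ g′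
  ⊛-cong p q zero    = *-cong (p 0) (q 0)
  ⊛-cong p q (suc n) = +-cong (*-cong (p 0) (q (suc n))) (⊛-cong (p ∘ suc) q n)

  ⊛-distribʳ : ∀ h f g → (f ⊕ g) ⊛ h ≋ f ⊛ h ⊕ g ⊛ h
  ⊛-distribʳ h f g zero    = distribʳ _ _ _
  ⊛-distribʳ h f g (suc n) = trans (+-congˡ (⊛-distribʳ h (f ∘ suc) (g ∘ suc) n))
    (solve 5 (λ a b c d e → (a :+ b) :* c :+ (d :+ e) := a :* c :+ d :+ (b :* c :+ e)) refl _ _ _ _ _)

  ·-⊛ : ∀ c f g → (c · f) ⊛ g ≋ c · (f ⊛ g)
  ·-⊛ c f g zero    = *-assoc _ _ _
  ·-⊛ c f g (suc n) = trans (+-congˡ (·-⊛ c (f ∘ suc) g n))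
    (solve 4 (λ a b c d → a :* b :* c :+ a :* d := a :* (b :* c :+ d)) refl _ _ _ _)

  -- The mirror image of the definition, splitting off the constant term of the second factor;
  -- commutativity follows from it by induction.
  ⊛-suc : ∀ f g n → (f ⊛ g) (suc n) ≈ g 0 * f (suc n) + (f ⊛ g ∘ suc) n
  ⊛-suc f g zero    = solve 4 (λ a b c d → a :* b :+ c :* d := d :* c :+ a :* b) refl _ _ _ _
  ⊛-suc f g (suc n) = trans (+-congˡ (⊛-suc (f ∘ suc) g n))
    (solve 3 (λ a b c → a :+ (b :+ c) := b :+ (a :+ c)) refl _ _ _)

  ⊛-comm : ∀ f g → f ⊛ g ≋ g ⊛ f
  ⊛-comm f g zero    = *-comm _ _
  ⊛-comm f g (suc n) = trans (⊛-suc f g n) (+-congˡ (⊛-comm f (g ∘ suc) n))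

  ⊛-assoc : ∀ f g h → (f ⊛ g) ⊛ h ≋ f ⊛ (g ⊛ h)
  ⊛-assoc f g h zero    = *-assoc _ _ _
  ⊛-assoc f g h (suc n) = begin
    f 0 * g 0 * h (suc n) + ((f 0 · (g ∘ suc) ⊕ f ∘ suc ⊛ g) ⊛ h) n
      ≈⟨ +-congˡ (⊛-distribʳ h (f 0 · (g ∘ suc)) (f ∘ suc ⊛ g) n) ⟩
    f 0 * g 0 * h (suc n) + (((f 0 · (g ∘ suc)) ⊛ h) n + ((f ∘ suc ⊛ g) ⊛ h) n)
      ≈⟨ +-congˡ (+-cong (·-⊛ (f 0) (g ∘ suc) h n) (⊛-assoc (f ∘ suc) g h n)) ⟩
    f 0 * g 0 * h (suc n) + (f 0 * (g ∘ suc ⊛ h) n + (f ∘ suc ⊛ (g ⊛ h)) n)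
      ≈⟨ solve 5 (λ a b c d e → a :* b :* c :+ (a :* d :+ e) := a :* (b :* c :+ d) :+ e) refl _ _ _ _ _ ⟩
    f 0 * (g 0 * h (suc n) + (g ∘ suc ⊛ h) n) + (f ∘ suc ⊛ (g ⊛ h)) n ∎
    where open ≈-R

  0⊛ : ∀ f → (λ _ → 0#) ⊛ f ≋ λ _ → 0#
  0⊛ f zero    = zeroˡ _
  0⊛ f (suc n) = trans (+-cong (zeroˡ _) (0⊛ f n)) (+-identityˡ 0#)

  cst-⊛ : ∀ c f → cst c ⊛ f ≋ c · f
  cst-⊛ c f zero    = refl
  cst-⊛ c f (suc n) = trans (+-congˡ (0⊛ f n)) (+-identityʳ _)

  ⊛-identityˡ : ∀ f → cst 1# ⊛ f ≋ f
  ⊛-identityˡ f n = trans (cst-⊛ 1# f n) (*-identityˡ _)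

  seriesRing : CommutativeRing 0ℓ 0ℓ
  seriesRing = record
    { Carrier = Series ; _≈_ = _≋_ ; _+_ = _⊕_ ; _*_ = _⊛_ ; -_ = ⊖_ ; 0# = λ _ → 0# ; 1# = cst 1#
    ; isCommutativeRing = record
      { isRing = record
        { +-isAbelianGroup = record
          { isGroup = record
            { isMonoid = record
              { isSemigroup = record
                { isMagma = record
                  { isEquivalence = record
                    { refl = λ _ → refl ; sym = λ p n → sym (p n) ; trans = λ p q n → trans (p n) (q n) }
                  ; ∙-cong = λ p q n → +-cong (p n) (q n) }
                ; assoc = λ f g h n → +-assoc _ _ _ }
              ; identity = (λ f n → +-identityˡ _) , (λ f n → +-identityʳ _) }
            ; inverse = (λ f n → -‿inverseˡ _) , (λ f n → -‿inverseʳ _)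
            ; ⁻¹-cong = λ p n → -‿cong (p n) }
          ; comm = λ f g n → +-comm _ _ }
        ; *-cong = ⊛-cong
        ; *-assoc = ⊛-assoc
        ; *-identity = ⊛-identityˡ , (λ f n → trans (⊛-comm f (cst 1#) n) (⊛-identityˡ f n))
        ; distrib = (λ h f g n → trans (⊛-comm h (f ⊕ g) n)
                      (trans (⊛-distribʳ h f g n) (+-cong (⊛-comm f h n) (⊛-comm g h n))))
                  , ⊛-distribʳ }
      ; *-comm = ⊛-comm } }

  module S = RingTheory seriesRing

  X : Series
  X zero          = 0#
  X (suc zero)    = 1#
  X (suc (suc n)) = 0#

  X⊛-zero : ∀ f → (X ⊛ f) 0 ≈ 0#
  X⊛-zero f = zeroˡ _

  X⊛-suc : ∀ f n → (X ⊛ f) (suc n) ≈ f n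
  X⊛-suc f n = begin
    0# * f (suc n) + ((X ∘ suc) ⊛ f) n  ≈⟨ +-cong (zeroˡ _) (⊛-cong X′ (λ _ → refl) n) ⟩
    0# + (cst 1# ⊛ f) n                 ≈⟨ +-identityˡ _ ⟩
    (cst 1# ⊛ f) n                      ≈⟨ ⊛-identityˡ f n ⟩
    f n                                 ∎
    where
    open ≈-R
    X′ : X ∘ suc ≋ cst 1#
    X′ zero    = refl
    X′ (suc n) = refl

  X-cancel : ∀ {f g} → X ⊛ f ≋ X ⊛ g → f ≋ g
  X-cancel {f} {g} eq n = trans (sym (X⊛-suc f n)) (trans (eq (suc n)) (X⊛-suc g n))

  X^-below : ∀ m f k → k < m → (X S.^ m ⊛ f) k ≈ 0#
  X^-below (suc m) f zero    _         = trans (⊛-assoc X (X S.^ m) f 0) (X⊛-zero (X S.^ m ⊛ f))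
  X^-below (suc m) f (suc k) (s≤s k<m) =
    trans (⊛-assoc X (X S.^ m) f (suc k)) (trans (X⊛-suc _ k) (X^-below m f k k<m))

  ι≋cst : ∀ m → S.ι m ≋ cst (ι m)
  ι≋cst zero    zero    = refl
  ι≋cst zero    (suc n) = refl
  ι≋cst (suc m) zero    = +-congˡ (ι≋cst m 0)
  ι≋cst (suc m) (suc n) = trans (+-congˡ (ι≋cst m (suc n))) (+-identityˡ 0#)

  ι⊛ : ∀ m f n → (S.ι m ⊛ f) n ≈ ι m * f n
  ι⊛ m f n = trans (⊛-cong (ι≋cst m) (λ _ → refl) n) (cst-⊛ (ι m) f n)

  ι-char : ∀ m → ι m ≈ 0# → S.ι m ≋ λ _ → 0#
  ι-char m eq zero    = trans (ι≋cst m 0) eq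
  ι-char m eq (suc n) = ι≋cst m (suc n)

  ∑-coeff : ∀ (f : ℕ → Series) m n → S.∑ f m n ≈ ∑ (λ i → f i n) m
  ∑-coeff f zero    n = refl
  ∑-coeff f (suc m) n = +-congʳ (∑-coeff f m n)

  -- The hypothesis says f = X² f, so every coefficient equals the one two places below it and the
  -- first two vanish.
  1-X²-cancel : ∀ f → (S.1# S.- X ⊛ X) ⊛ f ≋ (λ _ → 0#) → f ≋ λ _ → 0#
  1-X²-cancel f eq = go
    where
    open ≈-R
    key : f ≋ X ⊛ (X ⊛ f)
    key = S.trans (S.Solver.solve 2 (λ x f → f S.Solver.:= (S.Solver.con (ℤ.+ 1) S.Solver.:- x S.Solver.:* x)
        S.Solver.:* f S.Solver.:+ x S.Solver.:* (x S.Solver.:* f)) S.refl X f)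
            (S.trans (S.+-congʳ {X ⊛ (X ⊛ f)} eq) (S.+-identityˡ _))
    go : f ≋ λ _ → 0#
    go zero          = trans (key 0) (X⊛-zero (X ⊛ f))
    go (suc zero)    = trans (key 1) (trans (X⊛-suc (X ⊛ f) 0) (X⊛-zero f))
    go (suc (suc n)) = trans (key (suc (suc n))) (trans (X⊛-suc _ (suc n)) (trans (X⊛-suc f n) (go n)))

-- Generating functions in characteristic p

module GeneratingFunctions
  (R : CommutativeRing 0ℓ 0ℓ) (n : ℕ) (prime : Prime (suc n)) (2<p : 2 < suc n)
  (char : CommutativeRing._≈_ R (RingTheory.ι R (suc n)) (CommutativeRing.0# R))
  (t z : CommutativeRing.Carrier R)
  where
  open RingTheory R
  open Telescope R
  open PrimeCharacteristic R n prime char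
  open ≈-R
  open Solver using (solve; _:=_; _:+_; _:*_; _:-_; :-_; con)

  y w : Carrier
  y = z * z
  w = y * (t * t)

  private
    sgn-n = sgn-prime-pred prime 2<p

  module At (x : Carrier) where
    open Core x w public
    private module P = Periodic n char sgn-n (proj₁ (ι-invertible ℕ.z<s 2<p)) (proj₂ (ι-invertible ℕ.z<s 2<p))
    open P public using (evaluation)

  module C⁺ = At t
  module C⁻ = At (- t)

  -- Congruence to 1 modulo `t ^ n`. As n = p - 1 will exceed the weight in question, such factors
  -- do not affect the coefficient that is finally read off.
  Unital : Carrier → Set
  Unital q = ∃ λ h → q ≈ 1# + t ^ n * h

  private
    Unital-* : ∀ {q r} → Unital q → Unital r → Unital (q * r)
    Unital-* (h , p) (k , q) = h + k + t ^ n * h * k , trans (*-cong p q)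
      (solve 3 (λ τ h k → (con (ℤ.+ 1) :+ τ :* h) :* (con (ℤ.+ 1) :+ τ :* k) := con (ℤ.+ 1) :+ τ :*
          (h :+ k :+ τ :* h :* k)) refl (t ^ n) h k)

    Unital-cong : ∀ {q r} → q ≈ r → Unital r → Unital q
    Unital-cong q≈r (h , e) = h , trans q≈r e

    Unital-neg-* : ∀ {q r} → Unital (- q) → Unital (- r) → Unital (q * r)
    Unital-neg-* {q} {r} u v = Unital-cong (solve 2 (λ q r → q :* r := (:- q) :* (:- r)) refl q r) (Unital-* u v)

    ∏-nodes-unital : ∀ x c → x ≈ t * c → Unital (- ∏ (λ j → x - ι (suc j)) n)
    ∏-nodes-unital x c eq = - (c ^ n) , (begin
      - ∏ (λ j → x - ι (suc j)) n  ≈⟨ -‿cong (∏-nodes x) ⟩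
      - (x ^ n - 1#)               ≈⟨ -‿cong (+-congʳ (trans (^-congˡ n eq) (^-distrib-* t c n))) ⟩
      - (t ^ n * c ^ n - 1#)
        ≈⟨ solve 2 (λ a b → :- (a :* b :- con (ℤ.+ 1)) := con (ℤ.+ 1) :+ a :* (:- b)) refl _ _ ⟩
      1# + t ^ n * - (c ^ n)       ∎)

    module Unit (x c : Carrier) (eq : x ≈ t * c) where
      open At x

      -- Each factor splits as (x + zt - j)(x - zt - j). Both products over j are -1 modulo `t ^ n`
      -- by `∏-nodes`, as x ± zt is a multiple of t.
      ∏d-unital : Unital (∏ (d ∘ suc) n)
      ∏d-unital = Unital-cong
        (trans (∏.fold-cong n λ j → solve 4 (λ x z t k → (x :- k) :* (x :- k) :- z :* z :* (t :* t) :=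
            (x :+ z :* t :- k) :* (x :- z :* t :- k))
                  refl x z t (ι (suc j))) (∏.fold-∙ (λ j → x + z * t - ι (suc j)) (λ j → x - z * t - ι (suc j)) n))
        (Unital-neg-*
          (∏-nodes-unital (x + z * t) (c + z) (trans (+-congʳ eq)
              (solve 3 (λ t c z → t :* c :+ z :* t := t :* (c :+ z)) refl t c z)))
          (∏-nodes-unital (x - z * t) (c - z) (trans (+-congʳ eq)
              (solve 3 (λ t c z → t :* c :- z :* t := t :* (c :- z)) refl t c z))))

      -- Here the node product is taken at 0 and at x; the value at 0 is Wilson's theorem.
      ∏u-unital : Unital (∏ (u ∘ suc) n)
      ∏u-unital = Unital-cong
        (trans (∏.fold-cong n λ j → *-congʳ (sym (+-identityˡ _)))
            (∏.fold-∙ (λ j → 0# - ι (suc j)) (λ j → x - ι (suc j)) n))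
        (Unital-neg-* (∏-nodes-unital 0# 0# (sym (zeroʳ t))) (∏-nodes-unital x c eq))

    d-p : ∀ x → At.d x (suc n) ≈ x * x - w
    d-p x = +-congʳ (*-cong e-p e-p)
      where
      e-p : At.e x (suc n) ≈ x
      e-p = trans (+-congˡ (trans (-‿cong char) -0#≈0#)) (+-identityʳ x)

    -- Both d₀ = t²(1 - y) and w = t² y carry the factor t², so replacing the four unital factors by
    -- 1 costs an error divisible by t² t^n; the witness collects the four errors. In an abstract
    -- ring neither t nor 1 - y can be cancelled, hence the shape of the conclusion.
    conclude : ∀ {V S q₁ q₂ q₃ q₄ d₀} → d₀ ≈ t * t - w → Unital q₁ → Unital q₂ → Unital q₃ → Unital q₄ →
      d₀ * (q₁ * V) + w * q₄ ≈ d₀ * q₂ * S + w * q₃ → ∃ λ h → t * (t * ((1# - y) * (V - S))) ≈ t * (t * (t ^ n * h))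
    conclude {V} {S} {q₁} {q₂} {q₃} {q₄} {d₀} d≈ (h₁ , e₁) (h₂ , e₂) (h₃ , e₃) (h₄ , e₄) eq =
      y * (h₃ - h₄) + (1# - y) * (h₂ * S - h₁ * V) , (begin
      t * (t * ((1# - y) * (V - S)))
        ≈⟨ solve 9 (λ t y V S τ h₁ h₂ h₃ h₄ →
             let I = con (ℤ.+ 1); D = t :* t :- y :* (t :* t) in
             t :* (t :* ((I :- y) :* (V :- S))) :=
             (D :* ((I :+ τ :* h₁) :* V) :+ y :* (t :* t) :* (I :+ τ :* h₄)) :-
                 (D :* (I :+ τ :* h₂) :* S :+ y :* (t :* t) :* (I :+ τ :* h₃))
             :+ t :* (t :* (τ :* (y :* (h₃ :- h₄) :+ (I :- y) :* (h₂ :* S :- h₁ :* V)))))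
             refl t y V S (t ^ n) h₁ h₂ h₃ h₄ ⟩
      (t * t - w) * ((1# + t ^ n * h₁) * V) + w * (1# + t ^ n * h₄) -
          ((t * t - w) * (1# + t ^ n * h₂) * S + w * (1# + t ^ n * h₃)) + rest
        ≈⟨ +-congʳ (+-cong (+-cong (*-cong (sym d≈) (*-congʳ (sym e₁))) (*-congˡ (sym e₄)))
             (-‿cong (+-cong (*-congʳ (*-cong (sym d≈) (sym e₂))) (*-congˡ (sym e₃))))) ⟩
      (d₀ * (q₁ * V) + w * q₄) - (d₀ * q₂ * S + w * q₃) + rest
        ≈⟨ +-congʳ (trans (+-congʳ eq) (-‿inverseʳ _)) ⟩
      0# + rest ≈⟨ +-identityˡ _ ⟩
      rest ∎)
      where
      rest = t * (t * (t ^ n * (y * (h₃ - h₄) + (1# - y) * (h₂ * S - h₁ * V))))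

  -- `W m` belongs to all indices, `V m` to those with first entry > 1, the summation variables
  -- being at most m. The terms in which the largest variable equals m + 1 are split into `a` (first
  -- entry 1) and `b` (first entry > 1). Only the relation for `a`, kept outside this record,
  -- distinguishes star sums from signed strict ones.
  record Steps (W V a b : ℕ → Carrier) : Set where
    field
      W-0   : W 0 ≈ 1#
      V-0   : V 0 ≈ 0#
      W-suc : ∀ m → m < n → W (suc m) ≈ W m + (a m + b m)
      V-suc : ∀ m → m < n → V (suc m) ≈ V m + b m
      b-eq  : ∀ m → m < n → ι (suc m) * b m ≈ t * (y * a m + b m)

  module Star {W V a b} (steps : Steps W V a b)
              (a-eq : ∀ m → m < n → ι (suc m) * a m ≈ t * W (suc m))
              (U : ℕ → Carrier) (dU : ∀ i → i < n → C⁺.d (suc i) * U (suc i) ≈ w) where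
    open Steps steps
    open C⁺ using (d; u; J)

    private
      -- `a` and `b` are eliminated without dividing by k - t: the difference of the two sides is an
      -- explicit combination of the defects of `W-suc`, `a-eq` and `b-eq`, each of which is 0. The
      -- same device proves `db`.
      dW : ∀ m → m < n → d (suc m) * W (suc m) ≈ u (suc m) * W m
      dW m m<n = begin
        d (suc m) * W′  ≈⟨ solve 7 (λ t y k W W′ a b →
            ((t :- k) :* (t :- k) :- y :* (t :* t)) :* W′ :=
            (:- k) :* (t :- k) :* W :+ k :* (k :- t) :* (W′ :- (W :+ (a :+ b))) :+ (k :- t) :* (k :* a :- t :* W′)
              :+ k :* (k :* b :- t :* (y :* a :+ b)) :+ t :* y :* (k :* a :- t :* W′))
            refl t y k (W m) W′ (a m) (b m) ⟩
        u (suc m) * W m + k * (k - t) * (W′ - (W m + (a m + b m))) + (k - t) * (k * a m - t * W′)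
          + k * (k * b m - t * (y * a m + b m)) + t * y * (k * a m - t * W′)
          ≈⟨ +-cong (+-cong (+-cong (+-congˡ (*-congˡ (x≈y⇒x-y≈0 (W-suc m m<n)))) (*-congˡ (x≈y⇒x-y≈0 (a-eq m m<n))))
               (*-congˡ (x≈y⇒x-y≈0 (b-eq m m<n)))) (*-congˡ (x≈y⇒x-y≈0 (a-eq m m<n))) ⟩
        u (suc m) * W m + k * (k - t) * 0# + (k - t) * 0# + k * 0# + t * y * 0#
          ≈⟨ solve 5 (λ x p q r s → x :+ p :* con (ℤ.+ 0) :+ q :* con (ℤ.+ 0) :+ r :* con (ℤ.+ 0) :+ s :* con
               (ℤ.+ 0) := x) refl _ _ _ _ _ ⟩
        u (suc m) * W m ∎
        where
        k = ι (suc m)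
        W′ = W (suc m)

      db : ∀ m → m < n → d (suc m) * b m ≈ w * W m
      db m m<n = begin
        d (suc m) * b m  ≈⟨ solve 7 (λ t y k W W′ a b →
            ((t :- k) :* (t :- k) :- y :* (t :* t)) :* b :=
            y :* (t :* t) :* W :+ (k :- t) :* (k :* b :- t :* (y :* a :+ b)) :+ y :* t :* (k :* a :- t :* W′)
              :+ y :* (t :* t) :* (W′ :- (W :+ (a :+ b))))
            refl t y k (W m) W′ (a m) (b m) ⟩
        w * W m + (k - t) * (k * b m - t * (y * a m + b m)) + y * t * (k * a m - t * W′) + y * (t * t) *
            (W′ - (W m + (a m + b m)))
          ≈⟨ +-cong (+-cong (+-congˡ (*-congˡ (x≈y⇒x-y≈0 (b-eq m m<n)))) (*-congˡ (x≈y⇒x-y≈0 (a-eq m m<n))))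
               (*-congˡ (x≈y⇒x-y≈0 (W-suc m m<n))) ⟩
        w * W m + (k - t) * 0# + y * t * 0# + y * (t * t) * 0#
          ≈⟨ solve 4 (λ x p q r → x :+ p :* con (ℤ.+ 0) :+ q :* con (ℤ.+ 0) :+ r :* con (ℤ.+ 0) := x) refl _ _ _ _ ⟩
        w * W m ∎
        where
        k = ι (suc m)
        W′ = W (suc m)

      ∏dW : ∀ m → m ≤ n → ∏ (d ∘ suc) m * W m ≈ ∏ (u ∘ suc) m
      ∏dW zero    _   = trans (*-identityˡ _) W-0
      ∏dW (suc m) m<n = begin
        ∏ (d ∘ suc) m * d (suc m) * W (suc m)    ≈⟨ *-assoc _ _ _ ⟩
        ∏ (d ∘ suc) m * (d (suc m) * W (suc m))  ≈⟨ *-congˡ (dW m m<n) ⟩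
        ∏ (d ∘ suc) m * (u (suc m) * W m)        ≈⟨ solve 3 (λ a b c → a :* (b :* c) := a :* c :* b) refl _ _ _ ⟩
        ∏ (d ∘ suc) m * W m * u (suc m)          ≈⟨ *-congʳ (∏dW m (ℕ.<⇒≤ m<n)) ⟩
        ∏ (u ∘ suc) m * u (suc m)                ∎

      -- By `db` and `∏dW` the increments of V are w Π_{j<m} u_j / Π_{j≤m} d_j; multiplied by all
      -- the d, their sum is a mixed sum, which at m = n is J₀.
      ∏dV : ∀ m → m ≤ n → ∏ (d ∘ suc) m * V m ≈ w * mixed (u ∘ suc) (d ∘ suc) m
      ∏dV zero    _   = trans (*-congˡ V-0) (trans (zeroʳ _) (sym (zeroʳ _)))
      ∏dV (suc m) m<n = begin
        P * d (suc m) * V (suc m)            ≈⟨ *-congˡ (V-suc m m<n) ⟩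
        P * d (suc m) * (V m + b m)
          ≈⟨ solve 4 (λ P d V b → P :* d :* (V :+ b) := d :* (P :* V) :+ P :* (d :* b)) refl _ _ _ _ ⟩
        d (suc m) * (P * V m) + P * (d (suc m) * b m)  ≈⟨ +-cong (*-congˡ (∏dV m (ℕ.<⇒≤ m<n))) (*-congˡ (db m m<n)) ⟩
        d (suc m) * (w * M) + P * (w * W m)
          ≈⟨ solve 5 (λ d w M P W → d :* (w :* M) :+ P :* (w :* W) := w :* (d :* M :+ P :* W)) refl _ _ _ _ _ ⟩
        w * (d (suc m) * M + P * W m)        ≈⟨ *-congˡ (+-congˡ (∏dW m (ℕ.<⇒≤ m<n))) ⟩
        w * (d (suc m) * M + ∏ (u ∘ suc) m)  ∎
        where
        P = ∏ (d ∘ suc) m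
        M = mixed (u ∘ suc) (d ∘ suc) m

    open Unit t 1# (sym (*-identityʳ t))

    result : ∃ λ h → t * (t * ((1# - y) * (V n - ∑ (λ i → sgn i * U (suc i)) n))) ≈ t * (t * (t ^ n * h))
    result = conclude (d-p t) ∏d-unital ∏d-unital ∏d-unital ∏u-unital (begin
      d (suc n) * (∏ (d ∘ suc) n * V n) + w * ∏ (u ∘ suc) n  ≈⟨ +-congʳ (*-congˡ (∏dV n ℕ.≤-refl)) ⟩
      d (suc n) * (w * J 0 n) + w * ∏ (u ∘ suc) n
        ≈⟨ solve 4 (λ d w J o → d :* (w :* J) :+ w :* o := w :* (d :* J :+ o)) refl _ _ _ _ ⟩
      w * (d (suc n) * J 0 n + ∏ (u ∘ suc) n)                ≈⟨ C⁺.evaluation U dU ⟩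
      d (suc n) * ∏ (d ∘ suc) n * ∑ (λ i → sgn i * U (suc i)) n + w * ∏ (d ∘ suc) n ∎)

  module NonStar {W V a b} (steps : Steps W V a b)
                 (a-eq : ∀ m → m < n → ι (suc m) * a m ≈ - (t * W m))
                 (U : ℕ → Carrier) (dU : ∀ i → i < n → C⁻.d (suc i) * U (suc i) ≈ w) where
    open Steps steps
    open C⁺ using (d; u)

    private
      -- For strict sums `a-eq` involves `W m` instead of `W (suc m)`. This interchanges the roles
      -- of `d` and `u`: W becomes Π d / Π u.
      ub : ∀ m → m < n → u (suc m) * b m ≈ - (w * W m)
      ub m m<n = begin
        u (suc m) * b m  ≈⟨ solve 6 (λ t y k W a b →
            (:- k) :* (t :- k) :* b :=
            :- (y :* (t :* t) :* W) :+ k :* (k :* b :- t :* (y :* a :+ b)) :+ t :* y :* (k :* a :- (:- (t :* W))))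
            refl t y k (W m) (a m) (b m) ⟩
        - (w * W m) + k * (k * b m - t * (y * a m + b m)) + t * y * (k * a m - - (t * W m))
          ≈⟨ +-cong (+-congˡ (*-congˡ (x≈y⇒x-y≈0 (b-eq m m<n)))) (*-congˡ (x≈y⇒x-y≈0 (a-eq m m<n))) ⟩
        - (w * W m) + k * 0# + t * y * 0#
          ≈⟨ solve 3 (λ x p q → x :+ p :* con (ℤ.+ 0) :+ q :* con (ℤ.+ 0) := x) refl _ _ _ ⟩
        - (w * W m) ∎
        where k = ι (suc m)

      uW : ∀ m → m < n → u (suc m) * W (suc m) ≈ d (suc m) * W m
      uW m m<n = begin
        u (suc m) * W (suc m)                              ≈⟨ *-congˡ (W-suc m m<n) ⟩
        u (suc m) * (W m + (a m + b m))
          ≈⟨ solve 4 (λ u W a b → u :* (W :+ (a :+ b)) := u :* b :+ u :* (W :+ a)) refl _ _ _ _ ⟩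
        u (suc m) * b m + u (suc m) * (W m + a m)          ≈⟨ +-congʳ (ub m m<n) ⟩
        - (w * W m) + u (suc m) * (W m + a m)              ≈⟨ solve 5 (λ t w k W a →
            :- (w :* W) :+ (:- k) :* (t :- k) :* (W :+ a) :=
            ((t :- k) :* (t :- k) :- w) :* W :+ (k :- t) :* (k :* a :- (:- (t :* W)))) refl t w (ι (suc m)) (W m)
                (a m) ⟩
        d (suc m) * W m + (ι (suc m) - t) * (ι (suc m) * a m - - (t * W m))
          ≈⟨ +-congˡ (trans (*-congˡ (x≈y⇒x-y≈0 (a-eq m m<n))) (zeroʳ _)) ⟩
        d (suc m) * W m + 0#                               ≈⟨ +-identityʳ _ ⟩
        d (suc m) * W m                                    ∎

      ∏uW : ∀ m → m ≤ n → ∏ (u ∘ suc) m * W m ≈ ∏ (d ∘ suc) m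
      ∏uW zero    _   = trans (*-identityˡ _) W-0
      ∏uW (suc m) m<n = begin
        ∏ (u ∘ suc) m * u (suc m) * W (suc m)    ≈⟨ *-assoc _ _ _ ⟩
        ∏ (u ∘ suc) m * (u (suc m) * W (suc m))  ≈⟨ *-congˡ (uW m m<n) ⟩
        ∏ (u ∘ suc) m * (d (suc m) * W m)        ≈⟨ solve 3 (λ a b c → a :* (b :* c) := a :* c :* b) refl _ _ _ ⟩
        ∏ (u ∘ suc) m * W m * d (suc m)          ≈⟨ *-congʳ (∏uW m (ℕ.<⇒≤ m<n)) ⟩
        ∏ (d ∘ suc) m * d (suc m)                ∎

      ∏uV : ∀ m → m ≤ n → ∏ (u ∘ suc) m * - V m ≈ w * mixed (d ∘ suc) (u ∘ suc) m
      ∏uV zero    _   = trans (*-congˡ (trans (-‿cong V-0) -0#≈0#)) (trans (zeroʳ _) (sym (zeroʳ _)))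
      ∏uV (suc m) m<n = begin
        P * u (suc m) * - V (suc m)                    ≈⟨ *-congˡ (-‿cong (V-suc m m<n)) ⟩
        P * u (suc m) * - (V m + b m)
          ≈⟨ solve 4 (λ P u V b → P :* u :* (:- (V :+ b)) := u :* (P :* (:- V)) :- P :* (u :* b)) refl _ _ _ _ ⟩
        u (suc m) * (P * - V m) - P * (u (suc m) * b m)
          ≈⟨ +-cong (*-congˡ (∏uV m (ℕ.<⇒≤ m<n))) (-‿cong (*-congˡ (ub m m<n))) ⟩
        u (suc m) * (w * M) - P * - (w * W m)
          ≈⟨ solve 5 (λ u w M P W → u :* (w :* M) :- P :* (:- (w :* W)) := w :* (u :* M :+ P :* W)) refl _ _ _ _ _ ⟩
        w * (u (suc m) * M + P * W m)                  ≈⟨ *-congˡ (+-congˡ (∏uW m (ℕ.<⇒≤ m<n))) ⟩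
        w * (u (suc m) * M + ∏ (d ∘ suc) m)            ∎
        where
        P = ∏ (u ∘ suc) m
        M = mixed (d ∘ suc) (u ∘ suc) m

      d-opposite : ∀ i j → suc (i ℕ.+ j) ≡ n → d (suc i) ≈ C⁻.d (suc j)
      d-opposite i j eq = trans
        (+-congʳ (*-cong (+-congˡ (-‿cong (ι-complement (suc i) (suc j) (≡.cong suc (≡.trans (ℕ.+-suc i j) eq)))))
            (+-congˡ (-‿cong (ι-complement (suc i) (suc j) (≡.cong suc (≡.trans (ℕ.+-suc i j) eq)))))))
        (solve 3 (λ t k w → (t :- (:- k)) :* (t :- (:- k)) :- w := (:- t :- k) :* (:- t :- k) :- w) refl t
            (ι (suc j)) w)

      u-opposite : ∀ i j → suc (i ℕ.+ j) ≡ n → u (suc i) ≈ C⁻.u (suc j)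
      u-opposite i j eq = trans
        (*-cong (-‿cong (ι-complement (suc i) (suc j) (≡.cong suc (≡.trans (ℕ.+-suc i j) eq))))
            (+-congˡ (-‿cong (ι-complement (suc i) (suc j) (≡.cong suc (≡.trans (ℕ.+-suc i j) eq))))))
        (solve 2 (λ t k → (:- (:- k)) :* (t :- (:- k)) := (:- k) :* (:- t :- k)) refl t (ι (suc j)))

    private
      module U⁺ = Unit t 1# (sym (*-identityʳ t))
      module U⁻ = Unit (- t) (- 1#) (solve 1 (λ t → :- t := t :* (:- con (ℤ.+ 1))) refl t)

    -- The mixed sum for -V has `d` and `u` in the wrong order. Reversal exchanges them, and as the
    -- reflected index is p - j, the sequences turn into those with parameter -t; from there on the
    -- star argument applies to -V.
    result : ∃ λ h → t * (t * ((1# - y) * (- V n - ∑ (λ i → sgn i * U (suc i)) n))) ≈ t * (t * (t ^ n * h))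
    result = conclude (trans (d-p (- t)) (+-congʳ (solve 1 (λ t → (:- t) :* (:- t) := t :* t) refl t)))
      U⁺.∏u-unital U⁻.∏d-unital U⁻.∏d-unital U⁻.∏u-unital (begin
      d⁻ (suc n) * (∏ (u ∘ suc) n * - V n) + w * ∏ (u⁻ ∘ suc) n
        ≈⟨ +-congʳ (*-congˡ (trans (∏uV n ℕ.≤-refl) (*-congˡ (mixed-reverse n d-opposite u-opposite)))) ⟩
      d⁻ (suc n) * (w * C⁻.J 0 n) + w * ∏ (u⁻ ∘ suc) n
        ≈⟨ solve 4 (λ d w J o → d :* (w :* J) :+ w :* o := w :* (d :* J :+ o)) refl _ _ _ _ ⟩
      w * (d⁻ (suc n) * C⁻.J 0 n + ∏ (u⁻ ∘ suc) n)               ≈⟨ C⁻.evaluation U dU ⟩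
      d⁻ (suc n) * ∏ (d⁻ ∘ suc) n * ∑ (λ i → sgn i * U (suc i)) n + w * ∏ (d⁻ ∘ suc) n ∎)
      where
      d⁻ = C⁻.d
      u⁻ = C⁻.u

-- Coefficients of w / ((t - μ)² - w)

isOdd : ℕ → Bool
isOdd zero    = false
isOdd (suc n) = not (isOdd n)

-- The coefficient of z²ˢ is C(k-1, 2s-1); odd powers of z and the row k = 0 vanish.
heightCoeff : ℕ → ℕ → ℕ
heightCoeff zero    n       = 0
heightCoeff (suc k) zero    = 0
heightCoeff (suc k) (suc n) = if isOdd n then k C n else 0

pascal² : ∀ k m → (suc (suc k) C suc (suc m)) ℕ.+ (k C suc (suc m)) ≡ 2 ℕ.* (suc k C suc (suc m)) ℕ.+ (k C m)
pascal² k m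
  rewrite ≡.sym (nCk+nC[k+1]≡[n+1]C[k+1] (suc k) (suc m))
        | ≡.sym (nCk+nC[k+1]≡[n+1]C[k+1] k (suc m))
        | ≡.sym (nCk+nC[k+1]≡[n+1]C[k+1] k m) = lemma (k C m) (k C suc m) (k C suc (suc m))
  where
  lemma : ∀ a b c → a ℕ.+ b ℕ.+ (b ℕ.+ c) ℕ.+ c ≡ 2 ℕ.* (b ℕ.+ c) ℕ.+ a
  lemma = solve-∀

-- For k ≥ 1 the row polynomial is q_k = z((1 + z)^(k-1) - (1 - z)^(k-1)) / 2, so it obeys the
-- linear recurrence with characteristic roots 1 + z and 1 - z, that is q_(k+2) + q_k = 2 q_(k+1) +
-- z² q_k. The recurrence has integer coefficients and needs neither partial fractions nor a
-- division by 2.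
heightCoeff-suc² : ∀ k n → heightCoeff (suc (suc (suc k))) (suc (suc n)) ℕ.+ heightCoeff (suc k) (suc (suc n))
                         ≡ 2 ℕ.* heightCoeff (suc (suc k)) (suc (suc n)) ℕ.+ heightCoeff (suc k) n
heightCoeff-suc² k zero    rewrite nC1≡n (suc (suc k)) | nC1≡n k | nC1≡n (suc k) = lemma k
  where
  lemma : ∀ k → suc (suc k) ℕ.+ k ≡ 2 ℕ.* suc k ℕ.+ 0
  lemma = solve-∀
heightCoeff-suc² k (suc n) with isOdd n
... | true  = pascal² k n
... | false = ≡.refl

module HeightSeries (R : CommutativeRing 0ℓ 0ℓ) where
  open RingTheory R
  open PowerSeries R

  q : ℕ → Series
  q k n = ι (heightCoeff k n)

  private
    XX : ∀ f n → (X ⊛ X ⊛ f) (suc (suc n)) ≈ f n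
    XX f n = trans (⊛-assoc X X f (suc (suc n))) (trans (X⊛-suc (X ⊛ f) (suc n)) (X⊛-suc f n))
    XX0 : ∀ f → (X ⊛ X ⊛ f) 0 ≈ 0#
    XX0 f = trans (⊛-assoc X X f 0) (X⊛-zero (X ⊛ f))
    XX1 : ∀ f → (X ⊛ X ⊛ f) 1 ≈ 0#
    XX1 f = trans (⊛-assoc X X f 1) (trans (X⊛-suc (X ⊛ f) 0) (X⊛-zero f))

  q-0 : q 0 ≋ λ _ → 0#
  q-0 n = refl

  q-1 : q 1 ≋ λ _ → 0#
  q-1 zero          = refl
  q-1 (suc zero)    = refl
  q-1 (suc (suc n)) with not (isOdd n)
  ... | true  = refl
  ... | false = refl

  q-2 : q 2 ≋ X ⊛ X
  q-2 zero                = sym (zeroˡ _)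
  q-2 (suc zero)          = sym (trans (X⊛-suc X 0) refl)
  q-2 (suc (suc zero))    = trans ι1≈1 (sym (X⊛-suc X 1))
  q-2 (suc (suc (suc n))) = trans (zero-case n) (sym (X⊛-suc X (suc (suc n))))
    where
    zero-case : ∀ n → ι (if not (not (isOdd n)) then 1 C suc (suc n) else 0) ≈ 0#
    zero-case n with not (not (isOdd n))
    ... | true  = refl
    ... | false = refl

  q-suc² : ∀ k → q (suc (suc (suc k))) ⊕ q (suc k) ≋ S.ι 2 ⊛ q (suc (suc k)) ⊕ X ⊛ X ⊛ q (suc k)
  q-suc² k zero          = sym (+-cong (trans (ι⊛ 2 (q (suc (suc k))) 0) (zeroʳ _)) (XX0 (q (suc k))))
  q-suc² k (suc zero)    = sym (+-cong (trans (ι⊛ 2 (q (suc (suc k))) 1) (zeroʳ _)) (XX1 (q (suc k))))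
  q-suc² k (suc (suc n)) = begin
    ι (heightCoeff (suc (suc (suc k))) (suc (suc n))) + ι (heightCoeff (suc k) (suc (suc n)))
      ≈⟨ sym (ι-+ (heightCoeff (suc (suc (suc k))) (suc (suc n))) _) ⟩
    ι (heightCoeff (suc (suc (suc k))) (suc (suc n)) ℕ.+ heightCoeff (suc k) (suc (suc n)))
      ≈⟨ ι-≡ (heightCoeff-suc² k n) ⟩
    ι (2 ℕ.* heightCoeff (suc (suc k)) (suc (suc n)) ℕ.+ heightCoeff (suc k) n)
      ≈⟨ ι-+ (2 ℕ.* heightCoeff (suc (suc k)) (suc (suc n))) _ ⟩
    ι (2 ℕ.* heightCoeff (suc (suc k)) (suc (suc n))) + q (suc k) n
      ≈⟨ +-cong (ι-* 2 (heightCoeff (suc (suc k)) (suc (suc n)))) (sym (XX (q (suc k)) n)) ⟩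
    ι 2 * q (suc (suc k)) (suc (suc n)) + (X ⊛ X ⊛ q (suc k)) (suc (suc n))
      ≈⟨ +-congʳ (sym (ι⊛ 2 (q (suc (suc k))) (suc (suc n)))) ⟩
    (S.ι 2 ⊛ q (suc (suc k))) (suc (suc n)) + (X ⊛ X ⊛ q (suc k)) (suc (suc n)) ∎
    where open ≈-R

-- The expansion of w / ((t - μ)² - w), w = z²t², in powers of t, for invertible μ.
module InverseSeries (Q : CommutativeRing 0ℓ 0ℓ) where
  open RingTheory Q
  open PowerSeries Q
  open Solver using (solve; _:=_; _:+_; _:*_; _:-_; :-_; con)

  module Expansion (z : Carrier) (q : ℕ → Carrier) (q-0 : q 0 ≈ 0#) (q-1 : q 1 ≈ 0#) (q-2 : q 2 ≈ z * z)
      (q-suc² : ∀ k → q (suc (suc (suc k))) + q (suc k) ≈ ι 2 * q (suc (suc k)) + z * z * q (suc k)) where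

    w : Series
    w = cst z ⊛ cst z ⊛ (X ⊛ X)

    U : Carrier → Series
    U ρ k = ρ ^ k * q k

    private
      cst⊛cst⊛ : ∀ a b f k → (cst a ⊛ cst b ⊛ f) k ≈ a * (b * f k)
      cst⊛cst⊛ a b f k = trans (⊛-assoc (cst a) (cst b) f k) (trans (cst-⊛ a (cst b ⊛ f) k) (*-congˡ (cst-⊛ b f k)))

    -- At t^(k+2) every μ cancels one ρ, and the left side becomes ρ^k times the defect of the
    -- recurrence of q. The recurrence holds from index 1 on; at index 0 the values q 0 = q 1 = 0
    -- and q 2 = z² leave the surplus z², which is the only nonzero coefficient of w.
    inverse : ∀ μ ρ → μ * ρ ≈ 1# → ((X S.- cst μ) ⊛ (X S.- cst μ) S.- w) ⊛ U ρ ≋ w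
    inverse μ ρ μρ = S.trans expand pointwise
      where
      open S.Solver using () renaming (solve to solveS; _:=_ to _:≋_; _:+_ to _:⊕_; _:*_ to _:⊛_; _:-_ to _:⊖_; con to
          conS)
      u = U ρ
      A = X ⊛ (X ⊛ (u S.- cst z ⊛ cst z ⊛ u))
      B = cst μ ⊛ (X ⊛ u)
      C′ = cst μ ⊛ cst μ ⊛ u
      expand : ((X S.- cst μ) ⊛ (X S.- cst μ) S.- w) ⊛ u ≋ A S.- S.ι 2 ⊛ B ⊕ C′
      expand = solveS 4 (λ x m z u →
        ((x :⊖ m) :⊛ (x :⊖ m) :⊖ z :⊛ z :⊛ (x :⊛ x)) :⊛ u :≋
        x :⊛ (x :⊛ (u :⊖ z :⊛ z :⊛ u)) :⊖ conS (ℤ.+ 2) :⊛ (m :⊛ (x :⊛ u)) :⊕ m :⊛ m :⊛ u) S.refl X (cst μ) (cst z) u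

      open ≈-R
      μU : ∀ k → μ * u (suc k) ≈ ρ ^ k * q (suc k)
      μU k = trans (solve 4 (λ m r p q → m :* (r :* p :* q) := m :* r :* (p :* q)) refl μ ρ (ρ ^ k) (q (suc k)))
               (trans (*-congʳ μρ) (*-identityˡ _))
      B-suc : ∀ k → B (suc k) ≈ μ * u k
      B-suc k = trans (cst-⊛ μ (X ⊛ u) (suc k)) (*-congˡ (X⊛-suc u k))
      C-eq : ∀ k → C′ k ≈ μ * (μ * u k)
      C-eq = cst⊛cst⊛ μ μ u
      A-suc² : ∀ k → A (suc (suc k)) ≈ u k - z * (z * u k)
      A-suc² k = trans (X⊛-suc (X ⊛ (u S.- cst z ⊛ cst z ⊛ u)) (suc k))
        (trans (X⊛-suc (u S.- cst z ⊛ cst z ⊛ u) k) (+-congˡ (-‿cong (cst⊛cst⊛ z z u k))))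
      w-suc² : ∀ k → w (suc (suc k)) ≈ z * (z * cst 1# k)
      w-suc² k = trans (cst⊛cst⊛ z z (X ⊛ X) (suc (suc k))) (*-congˡ (*-congˡ (trans (X⊛-suc X (suc k)) (X-suc k))))
        where
        X-suc : ∀ k → X (suc k) ≈ cst 1# k
        X-suc zero    = refl
        X-suc (suc k) = refl
      u-0 : u 0 ≈ 0#
      u-0 = trans (*-congˡ q-0) (zeroʳ _)
      u-1 : u 1 ≈ 0#
      u-1 = trans (*-congˡ q-1) (zeroʳ _)

      pointwise : A S.- S.ι 2 ⊛ B ⊕ C′ ≋ w
      pointwise zero = begin
        A 0 - (S.ι 2 ⊛ B) 0 + C′ 0
          ≈⟨ +-cong (+-cong (X⊛-zero (X ⊛ (u S.- cst z ⊛ cst z ⊛ u)))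
               (-‿cong (trans (ι⊛ 2 B 0) (*-congˡ (trans (cst-⊛ μ (X ⊛ u) 0) (*-congˡ (X⊛-zero u)))))))
                    (trans (C-eq 0) (*-congˡ (*-congˡ u-0))) ⟩
        0# - ι 2 * (μ * 0#) + μ * (μ * 0#)
          ≈⟨ solve 2 (λ m z → con (ℤ.+ 0) :- con (ℤ.+ 2) :* (m :* con (ℤ.+ 0)) :+ m :* (m :* con (ℤ.+ 0)) := z :*
               (z :* con (ℤ.+ 0))) refl μ z ⟩
        z * (z * 0#)  ≈⟨ sym (trans (cst⊛cst⊛ z z (X ⊛ X) 0) (*-congˡ (*-congˡ (X⊛-zero X)))) ⟩
        w 0 ∎
      pointwise (suc zero) = begin
        A 1 - (S.ι 2 ⊛ B) 1 + C′ 1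
          ≈⟨ +-cong (+-cong (trans (X⊛-suc (X ⊛ (u S.- cst z ⊛ cst z ⊛ u)) 0) (X⊛-zero (u S.- cst z ⊛ cst z ⊛ u)))
                            (-‿cong (trans (ι⊛ 2 B 1) (*-congˡ (trans (B-suc 0) (*-congˡ u-0))))))
                    (trans (C-eq 1) (*-congˡ (*-congˡ u-1))) ⟩
        0# - ι 2 * (μ * 0#) + μ * (μ * 0#)
          ≈⟨ solve 2 (λ m z → con (ℤ.+ 0) :- con (ℤ.+ 2) :* (m :* con (ℤ.+ 0)) :+ m :* (m :* con (ℤ.+ 0)) := z :*
               (z :* con (ℤ.+ 0))) refl μ z ⟩
        z * (z * 0#)  ≈⟨ sym (trans (cst⊛cst⊛ z z (X ⊛ X) 1) (*-congˡ (*-congˡ (X⊛-suc X 0)))) ⟩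
        w 1 ∎
      pointwise (suc (suc k)) = begin
        A (suc (suc k)) - (S.ι 2 ⊛ B) (suc (suc k)) + C′ (suc (suc k))
          ≈⟨ +-cong (+-cong (A-suc² k) (-‿cong (trans (ι⊛ 2 B (suc (suc k)))
               (*-congˡ (trans (B-suc (suc k)) (μU k))))))
                    (trans (C-eq (suc (suc k))) (trans (*-congˡ (μU (suc k))) (trans
                      (solve 4 (λ m r p q → m :* (r :* p :* q) := m :* r :* (p :* q)) refl μ ρ (ρ ^ k)
                          (q (suc (suc k))))
                      (trans (*-congʳ μρ) (*-identityˡ _))))) ⟩
        ρ ^ k * q k - z * (z * (ρ ^ k * q k)) - ι 2 * (ρ ^ k * q (suc k)) + ρ ^ k * q (suc (suc k))
          ≈⟨ solve 5 (λ p a b c z → p :* a :- z :* (z :* (p :* a)) :- con (ℤ.+ 2) :* (p :* b) :+ p :* c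
                        := p :* ((c :+ a) :- (con (ℤ.+ 2) :* b :+ z :* z :* a))) refl (ρ ^ k) (q k) (q (suc k))
                            (q (suc (suc k))) z ⟩
        ρ ^ k * ((q (suc (suc k)) + q k) - (ι 2 * q (suc k) + z * z * q k))
          ≈⟨ recurrence k ⟩
        z * (z * cst 1# k)  ≈⟨ sym (w-suc² k) ⟩
        w (suc (suc k)) ∎
        where
        recurrence : ∀ k → ρ ^ k * ((q (suc (suc k)) + q k) - (ι 2 * q (suc k) + z * z * q k)) ≈ z * (z * cst 1# k)
        recurrence zero = begin
          1# * ((q 2 + q 0) - (ι 2 * q 1 + z * z * q 0))
            ≈⟨ *-congˡ (+-cong (+-cong q-2 q-0) (-‿cong (+-cong (*-congˡ q-1) (*-congˡ q-0)))) ⟩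
          1# * ((z * z + 0#) - (ι 2 * 0# + z * z * 0#))
            ≈⟨ solve 1 (λ z → con (ℤ.+ 1) :* ((z :* z :+ con (ℤ.+ 0)) :-
                 (con (ℤ.+ 2) :* con (ℤ.+ 0) :+ z :* z :* con (ℤ.+ 0))) := z :* (z :* con (ℤ.+ 1))) refl z ⟩
          z * (z * 1#) ∎
        recurrence (suc k) = begin
          ρ ^ suc k * ((q (suc (suc (suc k))) + q (suc k)) - (ι 2 * q (suc (suc k)) + z * z * q (suc k)))
            ≈⟨ *-congˡ (trans (+-congʳ (q-suc² k)) (-‿inverseʳ _)) ⟩
          ρ ^ suc k * 0#  ≈⟨ solve 2 (λ p z → p :* con (ℤ.+ 0) := z :* (z :* con (ℤ.+ 0))) refl _ z ⟩
          z * (z * 0#) ∎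

-- Sums over compositions

-- Names the private function bumpHeads: the `_` is solved by unification in compositions-suc.
mutual
  bump : List (List ℕ) → List (List ℕ)
  bump = _

  compositions-suc : ∀ n → compositions (suc n) ≡ map (1 ∷_) (compositions n) ++ bump (compositions n)
  compositions-suc n with compositions n
  ... | _ = ≡.refl

-- Raising the first entry of a composition makes it exceed 1 only if it was positive before; this
-- is what puts the bumped compositions among the admissible indices.
data HeadPos : List ℕ → Set where
  nil  : HeadPos []
  cons : ∀ {h t} → HeadPos (suc h ∷ t)

bump-headPos : ∀ L → All HeadPos (bump L)
bump-headPos []            = []
bump-headPos ([] ∷ L)      = bump-headPos L
bump-headPos ((h ∷ t) ∷ L) = cons ∷ bump-headPos L

compositions-headPos : ∀ k → All HeadPos (compositions k)
compositions-headPos zero    = nil ∷ []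
compositions-headPos (suc k) = All.++⁺ (All.map⁺ (All.universal (λ _ → cons) (compositions k)))
    (bump-headPos (compositions k))

module ListSum (R : CommutativeRing 0ℓ 0ℓ) where
  open RingTheory R
  open Solver using (solve; _:=_; _:+_)

  listSum : ∀ {A : Set} → (A → Carrier) → List A → Carrier
  listSum φ []       = 0#
  listSum φ (x ∷ xs) = φ x + listSum φ xs

  module _ {A : Set} where

    listSum-congAll : ∀ {P : A → Set} {φ ψ : A → Carrier} {xs} → All P xs →
        (∀ x → P x → φ x ≈ ψ x) → listSum φ xs ≈ listSum ψ xs
    listSum-congAll []         h = refl
    listSum-congAll (px ∷ pxs) h = +-cong (h _ px) (listSum-congAll pxs h)

    listSum-cong : ∀ {φ ψ : A → Carrier} xs → (∀ x → φ x ≈ ψ x) → listSum φ xs ≈ listSum ψ xs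
    listSum-cong []       h = refl
    listSum-cong (x ∷ xs) h = +-cong (h x) (listSum-cong xs h)

    listSum-+ : ∀ (φ ψ : A → Carrier) xs → listSum (λ x → φ x + ψ x) xs ≈ listSum φ xs + listSum ψ xs
    listSum-+ φ ψ []       = sym (+-identityˡ _)
    listSum-+ φ ψ (x ∷ xs) = trans (+-congˡ (listSum-+ φ ψ xs))
      (solve 4 (λ a b c d → (a :+ b) :+ (c :+ d) := (a :+ c) :+ (b :+ d)) refl _ _ _ _)

    listSum-* : ∀ c (φ : A → Carrier) xs → listSum (λ x → c * φ x) xs ≈ c * listSum φ xs
    listSum-* c φ []       = sym (zeroʳ c)
    listSum-* c φ (x ∷ xs) = trans (+-congˡ (listSum-* c φ xs)) (sym (distribˡ _ _ _))

    listSum-zero : ∀ {φ : A → Carrier} xs → (∀ x → φ x ≈ 0#) → listSum φ xs ≈ 0#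
    listSum-zero []       h = refl
    listSum-zero (x ∷ xs) h = trans (+-cong (h x) (listSum-zero xs h)) (+-identityˡ 0#)

    listSum-++ : ∀ (φ : A → Carrier) xs ys → listSum φ (xs ++ ys) ≈ listSum φ xs + listSum φ ys
    listSum-++ φ []       ys = sym (+-identityˡ _)
    listSum-++ φ (x ∷ xs) ys = trans (+-congˡ (listSum-++ φ xs ys)) (sym (+-assoc _ _ _))

    listSum-map : ∀ {B : Set} (φ : B → Carrier) (f : A → B) xs → listSum φ (map f xs) ≈ listSum (φ ∘ f) xs
    listSum-map φ f []       = refl
    listSum-map φ f (x ∷ xs) = +-congˡ (listSum-map φ f xs)

  -- The value 0 at `[]` accounts for the fact that `bump` drops the empty list.
  bumped : (List ℕ → Carrier) → List ℕ → Carrier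
  bumped φ []      = 0#
  bumped φ (h ∷ t) = φ (suc h ∷ t)

  listSum-bump : ∀ φ L → listSum φ (bump L) ≈ listSum (bumped φ) L
  listSum-bump φ []            = refl
  listSum-bump φ ([] ∷ L)      = trans (listSum-bump φ L) (sym (+-identityˡ _))
  listSum-bump φ ((h ∷ t) ∷ L) = +-congˡ (listSum-bump φ L)

  listSum-compositions : ∀ φ k → listSum φ (compositions (suc k)) ≈
                         listSum (φ ∘ (1 ∷_)) (compositions k) + listSum (bumped φ) (compositions k)
  listSum-compositions φ k = trans (listSum-++ φ (map (1 ∷_) (compositions k)) (bump (compositions k)))
    (+-cong (listSum-map φ (1 ∷_) (compositions k)) (listSum-bump φ (compositions k)))

-- Generating functions over compositions by weight and height

module HeightGeneratingFunctions (R : CommutativeRing 0ℓ 0ℓ) where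
  open RingTheory R
  open ≈-R
  open Solver using (solve; _:=_; _:*_)
  module PR = PowerSeries R
  module Q = RingTheory PR.seriesRing
  module PQ = PowerSeries PR.seriesRing
  module S = RingTheory PQ.seriesRing
  open PR using (Series; _·_; _⊛_; _⊕_; _≋_; X; X⊛-suc; X⊛-zero; ⊛-assoc; ι⊛)
  open ListSum R
  module LQ = ListSum PR.seriesRing

  y : Series
  y = X ⊛ X

  y^ : ℕ → Series
  y^ h = y Q.^ h

  t z : PQ.Series
  t = PQ.X
  z = PQ.cst X

  y⊛· : ∀ c f → y ⊛ (c · f) ≋ c · (y ⊛ f)
  y⊛· c f n = trans (PR.⊛-comm y (c · f) n) (trans (PR.·-⊛ c f y n) (*-congˡ (PR.⊛-comm f y n)))

  -- An element of R[[z]][[t]]. With t outermost, a coefficient in t is a finite sum over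
  -- compositions of one weight, and a height h enters as z^(2h).
  genF : (List ℕ → Carrier) → PQ.Series
  genF φ k = LQ.listSum (λ ks → φ ks · y^ (height ks)) (compositions k)

  admissible nonadmissible : (List ℕ → Carrier) → List ℕ → Carrier
  admissible    φ ks = if firstGt1 ks then φ ks else 0#
  nonadmissible φ ks = if firstGt1 ks then 0# else φ ks

  genF-cong : ∀ {φ ψ} → (∀ ks → φ ks ≈ ψ ks) → ∀ k → genF φ k ≋ genF ψ k
  genF-cong h k = LQ.listSum-cong (compositions k) (λ ks n → *-congʳ (h ks))

  genF-+ : ∀ φ ψ k → genF (λ ks → φ ks + ψ ks) k ≋ genF φ k ⊕ genF ψ k
  genF-+ φ ψ k = Q.trans (LQ.listSum-cong (compositions k) (λ ks n → distribʳ _ _ _))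
    (LQ.listSum-+ (λ ks → φ ks · y^ (height ks)) (λ ks → ψ ks · y^ (height ks)) (compositions k))

  module Step (m : ℕ) (r : Carrier) (η : List ℕ → Carrier) where

    -- The terms of the nested sum whose largest variable is m + 1: `r` is the inverse of that
    -- variable and `η` evaluates the remaining entries. The value of the empty index does not
    -- depend on m, hence the increment 0.
    δ : List ℕ → Carrier
    δ []       = 0#
    δ (k ∷ ks) = r ^ k * η ks

    a b : PQ.Series
    a = genF (nonadmissible δ)
    b = genF (admissible δ)

    module Equations (r-inv : ι (suc m) * r ≈ 1#) where

      private
        μ = ι (suc m)

        μr : ∀ h x → μ * (r * h * x) ≈ h * x
        μr h x = trans (solve 4 (λ m r h x → m :* (r :* h :* x) := m :* r :* (h :* x)) refl μ r h x)
          (trans (*-congʳ r-inv) (*-identityˡ _))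

        -- Removing a leading 1 lowers the weight by one, keeps the height, and costs one factor
        -- `r`, which μ cancels. The bumped compositions contribute nothing because their first
        -- entry exceeds 1.
        a-suc : ∀ k → Q.ι (suc m) ⊛ a (suc k) ≋ genF η k
        a-suc k n = begin
          (Q.ι (suc m) ⊛ a (suc k)) n   ≈⟨ ι⊛ (suc m) (a (suc k)) n ⟩
          μ * a (suc k) n
            ≈⟨ *-congˡ (LQ.listSum-compositions (λ ks → nonadmissible δ ks · y^ (height ks)) k n) ⟩
          μ * (LQ.listSum (λ ks → (r * 1# * η ks) · y^ (height ks)) (compositions k) n + LQ.listSum
              (LQ.bumped (λ ks → nonadmissible δ ks · y^ (height ks))) (compositions k) n)
                                        ≈⟨ *-congˡ (trans (+-congˡ
                                             (LQ.listSum-congAll (compositions-headPos k) bumped-zero n))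
                                             (trans (+-congˡ (LQ.listSum-zero (compositions k) (λ _ _ → refl) n))
                                                 (+-identityʳ _))) ⟩
          μ * LQ.listSum (λ ks → (r * 1# * η ks) · y^ (height ks)) (compositions k) n
                                        ≈⟨ sym (ι⊛ (suc m) _ n) ⟩
          (Q.ι (suc m) ⊛ LQ.listSum (λ ks → (r * 1# * η ks) · y^ (height ks)) (compositions k)) n
                                        ≈⟨ sym (LQ.listSum-* (Q.ι (suc m)) (λ ks → (r * 1# * η ks) · y^ (height ks))
                                             (compositions k) n) ⟩
          LQ.listSum (λ ks → Q.ι (suc m) ⊛ ((r * 1# * η ks) · y^ (height ks))) (compositions k) n
                                        ≈⟨ LQ.listSum-cong (compositions k)
                                             (λ ks n′ → trans (ι⊛ (suc m) ((r * 1# * η ks) · y^ (height ks)) n′)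
                                             (trans (sym (*-assoc _ _ _))
                                                 (*-congʳ (trans (μr 1# (η ks)) (*-identityˡ _))))) n ⟩
          genF η k n ∎
          where
          bumped-zero : ∀ ks → HeadPos ks → LQ.bumped (λ ks → nonadmissible δ ks · y^ (height ks)) ks ≋ λ _ → 0#
          bumped-zero .[]      nil  n = refl
          bumped-zero .(_ ∷ _) cons n = zeroˡ _

        -- Lowering the first entry by one also costs one factor `r`. The height changes only when
        -- the entry drops from 2 to 1: those indices form the term in `a`, with the lost height
        -- restored by y.
        b-suc : ∀ k → Q.ι (suc m) ⊛ b (suc k) ≋ y ⊛ a k ⊕ b k
        b-suc k n = begin
          (Q.ι (suc m) ⊛ b (suc k)) n
            ≈⟨ PR.⊛-cong {Q.ι (suc m)} (λ _ → refl) (λ n′ → trans (LQ.listSum-compositions φ k n′)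
                                             (trans (+-congʳ (LQ.listSum-zero (compositions k) (λ _ _ → zeroˡ _) n′))
                                                 (+-identityˡ _))) n ⟩
          (Q.ι (suc m) ⊛ LQ.listSum (LQ.bumped φ) (compositions k)) n
                                        ≈⟨ sym (LQ.listSum-* (Q.ι (suc m)) (LQ.bumped φ) (compositions k) n) ⟩
          LQ.listSum (λ ks → Q.ι (suc m) ⊛ LQ.bumped φ ks) (compositions k) n
                                        ≈⟨ LQ.listSum-congAll (compositions-headPos k) pointwise n ⟩
          LQ.listSum (λ ks → y ⊛ ψ ks ⊕ φ ks) (compositions k) n
                                        ≈⟨ LQ.listSum-+ (λ ks → y ⊛ ψ ks) φ (compositions k) n ⟩
          LQ.listSum (λ ks → y ⊛ ψ ks) (compositions k) n + b k n
                                        ≈⟨ +-congʳ (LQ.listSum-* y ψ (compositions k) n) ⟩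
          (y ⊛ a k) n + b k n ∎
          where
          φ ψ : List ℕ → Series
          φ ks = admissible δ ks · y^ (height ks)
          ψ ks = nonadmissible δ ks · y^ (height ks)
          scale : ∀ c Y n → (Q.ι (suc m) ⊛ (c · Y)) n ≈ (μ * c) * Y n
          scale c Y n = trans (ι⊛ (suc m) (c · Y) n) (sym (*-assoc _ _ _))
          pointwise : ∀ ks → HeadPos ks → Q.ι (suc m) ⊛ LQ.bumped φ ks ≋ y ⊛ ψ ks ⊕ φ ks
          pointwise .[] nil n = sym (begin
            (y ⊛ (0# · y^ 0)) n + 0# * y^ 0 n ≈⟨ +-cong (trans (y⊛· 0# (y^ 0) n) (zeroˡ _)) (zeroˡ _) ⟩
            0# + 0#                           ≈⟨ +-identityˡ 0# ⟩
            0#                                ≈⟨ sym (zeroʳ μ) ⟩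
            μ * 0#                            ≈⟨ sym (ι⊛ (suc m) (λ _ → 0#) n) ⟩
            (Q.ι (suc m) ⊛ λ _ → 0#) n        ∎)
          pointwise .(1 ∷ t) (cons {zero} {t}) n = begin
            (Q.ι (suc m) ⊛ ((r * (r * 1#) * η t) · y^ (suc (height t)))) n  ≈⟨ scale _ (y^ (suc (height t))) n ⟩
            (μ * (r * (r * 1#) * η t)) * y^ (suc (height t)) n              ≈⟨ *-congʳ (μr (r * 1#) (η t)) ⟩
            (r * 1# * η t) * (y ⊛ y^ (height t)) n
              ≈⟨ sym (y⊛· (r * 1# * η t) (y^ (height t)) n) ⟩
            (y ⊛ ((r * 1# * η t) · y^ (height t))) n
              ≈⟨ sym (trans (+-congˡ (zeroˡ _)) (+-identityʳ _)) ⟩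
            (y ⊛ ((r * 1# * η t) · y^ (height t))) n + 0# * y^ (height t) n ∎
          pointwise .(suc (suc h) ∷ t) (cons {suc h} {t}) n = begin
            (Q.ι (suc m) ⊛ ((r * (r * (r * r ^ h)) * η t) · y^ (suc (height t)))) n
              ≈⟨ scale _ (y^ (suc (height t))) n ⟩
            (μ * (r * (r * (r * r ^ h)) * η t)) * y^ (suc (height t)) n
              ≈⟨ *-congʳ (μr (r * (r * r ^ h)) (η t)) ⟩
            (r * (r * r ^ h) * η t) * y^ (suc (height t)) n                          ≈⟨ sym (+-identityˡ _) ⟩
            0# + (r * (r * r ^ h) * η t) * y^ (suc (height t)) n
              ≈⟨ +-congʳ (sym (trans (y⊛· 0# (y^ (suc (height t))) n) (zeroˡ _))) ⟩
            (y ⊛ (0# · y^ (suc (height t)))) n + (r * (r * r ^ h) * η t) * y^ (suc (height t)) n ∎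

      a-eq : S.ι (suc m) S.* a S.≈ t S.* genF η
      a-eq zero    = Q.trans (PQ.ι⊛ (suc m) a 0) (Q.trans (Q.*-congˡ {Q.ι (suc m)}
          (λ n → trans (+-identityʳ _) (zeroˡ _)))
                       (Q.trans (Q.zeroʳ (Q.ι (suc m))) (Q.sym (PQ.X⊛-zero (genF η)))))
      a-eq (suc k) = Q.trans (PQ.ι⊛ (suc m) a (suc k)) (Q.trans (a-suc k) (Q.sym (PQ.X⊛-suc (genF η) k)))

      b-eq : S.ι (suc m) S.* b S.≈ t S.* (z S.* z S.* a S.+ b)
      b-eq zero    = Q.trans (PQ.ι⊛ (suc m) b 0) (Q.trans (Q.*-congˡ {Q.ι (suc m)}
          (λ n → trans (+-identityʳ _) (zeroˡ _)))
                       (Q.trans (Q.zeroʳ (Q.ι (suc m))) (Q.sym (PQ.X⊛-zero (z S.* z S.* a S.+ b)))))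
      b-eq (suc k) = Q.trans (PQ.ι⊛ (suc m) b (suc k)) (Q.trans (b-suc k)
          (Q.sym (Q.trans (PQ.X⊛-suc (z S.* z S.* a S.+ b) k)
                       (Q.+-congʳ {b k} (Q.trans (PQ.⊛-assoc z z a k) (Q.trans (PQ.cst-⊛ X (z S.* a) k)
                         (Q.trans (Q.*-congˡ {X} (PQ.cst-⊛ X a k)) (Q.sym (⊛-assoc X X (a k))))))))))

module SignedCoefficients (R : CommutativeRing 0ℓ 0ℓ) where
  open RingTheory R
  open PowerSeries R
  private
    module TR = Telescope R
    module TS = Telescope seriesRing

  sgn-⊛ : ∀ i f k → (TS.sgn i ⊛ f) k ≈ TR.sgn i * f k
  sgn-⊛ zero    f k = trans (⊛-identityˡ f k) (sym (*-identityˡ _))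
  sgn-⊛ (suc i) f k = trans (sym (S.-‿distribˡ-* (TS.sgn i) f k)) (trans (-‿cong (sgn-⊛ i f k)) (-‿distribˡ-* _ _))

  cst^-⊛ : ∀ c m f k → (cst c S.^ m ⊛ f) k ≈ c ^ m * f k
  cst^-⊛ c zero    f k = trans (⊛-identityˡ f k) (sym (*-identityˡ _))
  cst^-⊛ c (suc m) f k = begin
    (cst c ⊛ (cst c S.^ m) ⊛ f) k    ≈⟨ ⊛-assoc (cst c) (cst c S.^ m) f k ⟩
    (cst c ⊛ (cst c S.^ m ⊛ f)) k    ≈⟨ cst-⊛ c (cst c S.^ m ⊛ f) k ⟩
    c * (cst c S.^ m ⊛ f) k          ≈⟨ *-congˡ (cst^-⊛ c m f k) ⟩
    c * (c ^ m * f k)                ≈⟨ sym (*-assoc _ _ _) ⟩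
    c ^ suc m * f k                  ∎
    where open ≈-R

-- Reading off the height sums

module HeightSums (R : CommutativeRing 0ℓ 0ℓ) (n : ℕ) (prime : Prime (suc n)) (2<p : 2 < suc n)
                  (char : CommutativeRing._≈_ R (RingTheory.ι R (suc n)) (CommutativeRing.0# R)) where
  open RingTheory R
  open ≈-R
  open Telescope R using (sgn)
  open PrimeCharacteristic R n prime char using (inv; ι-inv)
  open ListSum R
  open HeightGeneratingFunctions R
  module HS = HeightSeries R
  module IS = InverseSeries PR.seriesRing
  module E = IS.Expansion PR.X HS.q HS.q-0 HS.q-1 HS.q-2 HS.q-suc²
  module GF = GeneratingFunctions PQ.seriesRing n prime 2<p (PQ.ι-char (suc n) (PR.ι-char (suc n) char)) t z
  module TS = Telescope PQ.seriesRing
  module SR = SignedCoefficients R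
  module SQ = SignedCoefficients PR.seriesRing

  -- `η ks m` is what the remaining entries contribute once the first variable equals m + 1. It is
  -- `ζ ks (suc m)` for star sums, where equality of variables is allowed, and minus `ζ ks m` for
  -- strict sums signed by depth.
  record ZetaFamily : Set where
    field
      ζ η    : List ℕ → ℕ → Carrier
      ζ-nil  : ∀ m → ζ [] m ≈ 1#
      ζ-zero : ∀ k ks → ζ (k ∷ ks) 0 ≈ 0#
      ζ-suc  : ∀ k ks m → m < n → ζ (k ∷ ks) (suc m) ≈ ζ (k ∷ ks) m + inv (suc m) ^ k * η ks m

  module Family (F : ZetaFamily) where
    open ZetaFamily F
    private
      module Inc (m : ℕ) = Step m (inv (suc m)) (λ ks → η ks m)

    W V a b : ℕ → PQ.Series
    W m = genF (λ ks → ζ ks m)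
    V m = genF (admissible (λ ks → ζ ks m))
    a m = Inc.a m
    b m = Inc.b m

    private
      δ-suc : ∀ m → m < n → ∀ ks → ζ ks (suc m) ≈ ζ ks m + Inc.δ m ks
      δ-suc m m<n []       = trans (ζ-nil (suc m)) (sym (trans (+-identityʳ _) (ζ-nil m)))
      δ-suc m m<n (k ∷ ks) = ζ-suc k ks m m<n

      W-0 : W 0 S.≈ S.1#
      W-0 zero    j = trans (+-identityʳ _) (trans (*-congʳ (ζ-nil 0)) (*-identityˡ _))
      W-0 (suc k) j = trans (LQ.listSum-compositions (λ ks → ζ ks 0 PR.· y^ (height ks)) k j)
        (trans (+-cong (LQ.listSum-zero (compositions k) (λ ks _ → trans (*-congʳ (ζ-zero 1 ks)) (zeroˡ _)) j)
                       (LQ.listSum-zero (compositions k) bumped-zero j)) (+-identityˡ 0#))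
        where
        bumped-zero : ∀ ks → LQ.bumped (λ ks → ζ ks 0 PR.· y^ (height ks)) ks PR.≋ λ _ → 0#
        bumped-zero []      j = refl
        bumped-zero (h ∷ t) j = trans (*-congʳ (ζ-zero (suc h) t)) (zeroˡ _)

      V-0 : V 0 S.≈ S.0#
      V-0 k = LQ.listSum-zero (compositions k) (λ ks j → trans (*-congʳ (admissible-zero ks)) (zeroˡ _))
        where
        admissible-zero : ∀ ks → admissible (λ ks → ζ ks 0) ks ≈ 0#
        admissible-zero []       = refl
        admissible-zero (k ∷ ks) with firstGt1 (k ∷ ks)
        ... | true  = ζ-zero k ks
        ... | false = refl

      W-suc : ∀ m → m < n → W (suc m) S.≈ W m S.+ (a m S.+ b m)
      W-suc m m<n k = Q.trans (genF-cong split k) (Q.trans (genF-+ (λ ks → ζ ks m)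
          (λ ks → nonadmissible (Inc.δ m) ks + admissible (Inc.δ m) ks) k)
          (Q.+-congˡ {W m k} (genF-+ (nonadmissible (Inc.δ m)) (admissible (Inc.δ m)) k)))
        where
        split : ∀ ks → ζ ks (suc m) ≈ ζ ks m + (nonadmissible (Inc.δ m) ks + admissible (Inc.δ m) ks)
        split ks with firstGt1 ks
        ... | true  = trans (δ-suc m m<n ks) (+-congˡ (sym (+-identityˡ _)))
        ... | false = trans (δ-suc m m<n ks) (+-congˡ (sym (+-identityʳ _)))

      V-suc : ∀ m → m < n → V (suc m) S.≈ V m S.+ b m
      V-suc m m<n k = Q.trans (genF-cong split k) (genF-+ (admissible (λ ks → ζ ks m)) (admissible (Inc.δ m)) k)
        where
        split : ∀ ks → admissible (λ ks → ζ ks (suc m)) ks ≈ admissible (λ ks → ζ ks m) ks + admissible (Inc.δ m) ks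
        split ks with firstGt1 ks
        ... | true  = δ-suc m m<n ks
        ... | false = sym (+-identityˡ 0#)

    steps : GF.Steps W V a b
    steps = record
      { W-0 = W-0 ; V-0 = V-0 ; W-suc = W-suc ; V-suc = V-suc
      ; b-eq = λ m m<n → Inc.Equations.b-eq m (ι-inv ℕ.z<s (ℕ.s<s m<n)) }

    a-eq : ∀ m → m < n → S.ι (suc m) S.* a m S.≈ t S.* genF (λ ks → η ks m)
    a-eq m m<n = Inc.Equations.a-eq m (ι-inv ℕ.z<s (ℕ.s<s m<n))

  private
    y^-coeff : ∀ h s → y^ h (s ℕ.+ s) ≈ (if h ≡ᵇ s then 1# else 0#)
    y^-coeff zero    zero    = refl
    y^-coeff zero    (suc s) = refl
    y^-coeff (suc h) zero    = trans (PR.⊛-assoc PR.X PR.X (y^ h) 0) (PR.X⊛-zero (PR.X PR.⊛ y^ h))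
    y^-coeff (suc h) (suc s) = begin
      (y PR.⊛ y^ h) (suc (s ℕ.+ suc s))
        ≈⟨ reflexive (≡.cong (λ j → (y PR.⊛ y^ h) (suc j)) (ℕ.+-suc s s)) ⟩
      (y PR.⊛ y^ h) (suc (suc (s ℕ.+ s)))            ≈⟨ PR.⊛-assoc PR.X PR.X (y^ h) (suc (suc (s ℕ.+ s))) ⟩
      (PR.X PR.⊛ (PR.X PR.⊛ y^ h)) (suc (suc (s ℕ.+ s))) ≈⟨ PR.X⊛-suc (PR.X PR.⊛ y^ h) (suc (s ℕ.+ s)) ⟩
      (PR.X PR.⊛ y^ h) (suc (s ℕ.+ s))               ≈⟨ PR.X⊛-suc (y^ h) (s ℕ.+ s) ⟩
      y^ h (s ℕ.+ s)                                 ≈⟨ y^-coeff h s ⟩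
      (if h ≡ᵇ s then 1# else 0#)                    ∎

    listSum-coeff : ∀ {A : Set} (φ : A → PR.Series) xs j → LQ.listSum φ xs j ≈ listSum (λ x → φ x j) xs
    listSum-coeff φ []       j = refl
    listSum-coeff φ (x ∷ xs) j = +-congˡ (listSum-coeff φ xs j)

  heightSum : (List ℕ → Carrier) → ℕ → ℕ → Carrier
  heightSum φ k s = listSum (λ ks → if firstGt1 ks ∧ (height ks ≡ᵇ s) then φ ks else 0#) (compositions k)

  genF-coeff : ∀ φ k s → genF (admissible φ) k (s ℕ.+ s) ≈ heightSum φ k s
  genF-coeff φ k s = trans (listSum-coeff (λ ks → admissible φ ks PR.· y^ (height ks)) (compositions k) (s ℕ.+ s))
    (listSum-cong (compositions k) λ ks → trans (*-congˡ (y^-coeff (height ks) s))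
        (pick (firstGt1 ks) (height ks ≡ᵇ s) (φ ks)))
    where
    pick : ∀ f g x → (if f then x else 0#) * (if g then 1# else 0#) ≈ (if f ∧ g then x else 0#)
    pick true  true  x = *-identityʳ x
    pick true  false x = zeroʳ x
    pick false g     x = zeroˡ _

  private
    module Extract (r : ℕ → Carrier) where
      U : ℕ → PQ.Series
      U j = E.U (PR.cst (r j))

      sumU : PQ.Series
      sumU = S.∑ (λ i → TS.sgn i S.* U (suc i)) n

      sumU-coeff : ∀ k j → sumU k j ≈ ∑ (λ i → sgn i * (r (suc i) ^ k * ι (heightCoeff k j))) n
      sumU-coeff k j = begin
        S.∑ (λ i → TS.sgn i S.* U (suc i)) n k j             ≈⟨ PQ.∑-coeff (λ i → TS.sgn i S.* U (suc i)) n k j ⟩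
        Q.∑ (λ i → (TS.sgn i S.* U (suc i)) k) n j           ≈⟨ PR.∑-coeff (λ i → (TS.sgn i S.* U (suc i)) k) n j ⟩
        ∑ (λ i → (TS.sgn i S.* U (suc i)) k j) n
          ≈⟨ ∑.fold-cong n (λ i → trans (SQ.sgn-⊛ i (U (suc i)) k j)
                                                                   (trans (SR.sgn-⊛ i (U (suc i) k) j)
                                                                       (*-congˡ
                                                                           (SR.cst^-⊛ (r (suc i)) k (HS.q k) j)))) ⟩
        ∑ (λ i → sgn i * (r (suc i) ^ k * HS.q k j)) n       ∎

      -- After t is cancelled twice, the right side has no coefficients below t^n. At weight k < n
      -- this says that 1 - z² times the difference of the two sides is 0 in R[[z]], where 1 - z²
      -- cancels.
      extract : ∀ (V : PQ.Series) → (∃ λ h → t S.* (t S.* ((S.1# S.- GF.y) S.* (V S.- sumU))) S.≈ t S.*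
          (t S.* (t S.^ n S.* h))) →
                ∀ k → k < n → ∀ j → V k j ≈ ∑ (λ i → sgn i * (r (suc i) ^ k * ι (heightCoeff k j))) n
      extract V (h , eq) k k<n j = trans (begin
          V k j                             ≈⟨ solve 2 (λ a b → a := a :- b :+ b) refl (V k j) (sumU k j) ⟩
          V k j - sumU k j + sumU k j       ≈⟨ +-congʳ (PR.1-X²-cancel (D k) D-zero j) ⟩
          0# + sumU k j                     ≈⟨ +-identityˡ _ ⟩
          sumU k j                          ∎) (sumU-coeff k j)
        where
        open Solver using (solve; _:=_; _:+_; _:-_)
        D : PQ.Series
        D = V S.- sumU
        eq′ : (S.1# S.- GF.y) S.* D S.≈ t S.^ n S.* h
        eq′ = PQ.X-cancel {(S.1# S.- GF.y) S.* D} {t S.^ n S.* h}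
            (PQ.X-cancel {t S.* ((S.1# S.- GF.y) S.* D)} {t S.* (t S.^ n S.* h)} eq)
        1-y : PQ.cst (Q.1# Q.- y) S.≈ S.1# S.- GF.y
        1-y zero    = Q.refl
        1-y (suc k) = Q.sym (Q.trans (Q.+-identityˡ (Q.- (GF.y (suc k))))
            (Q.trans (Q.-‿cong (Q.trans (PQ.cst-⊛ PR.X z (suc k)) (Q.zeroʳ PR.X))) Q.-0#≈0#))
        D-zero : (Q.1# Q.- y) Q.* D k Q.≈ Q.0#
        D-zero = Q.trans (Q.sym (PQ.cst-⊛ (Q.1# Q.- y) D k))
          (Q.trans (PQ.⊛-cong {g = D} 1-y (λ _ → Q.refl) k) (Q.trans (eq′ k) (PQ.X^-below n h k k<n)))

  private
    cst-inverse : ∀ j x r → x * r ≈ 1# → j Q.≈ PR.cst x → j Q.* PR.cst r Q.≈ Q.1#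
    cst-inverse j x r e ej = Q.trans (Q.*-congʳ {PR.cst r} ej)
        (Q.trans (PR.cst-⊛ x (PR.cst r)) λ { zero → e ; (suc _) → zeroʳ x })

  starFamily-sum : (F : ZetaFamily) (let open ZetaFamily F) → (∀ ks m → η ks m ≈ ζ ks (suc m)) → ∀ k s → k < n →
    heightSum (λ ks → ζ ks n) k s ≈ ∑ (λ i → sgn i * (inv (suc i) ^ k * ι (heightCoeff k (s ℕ.+ s)))) n
  starFamily-sum F η≈ k s k<n = trans (sym (genF-coeff (λ ks → ζ ks n) k s))
      (Ex.extract (V n) Star.result k k<n (s ℕ.+ s))
    where
    open ZetaFamily F
    open Family F
    module Ex = Extract inv
    dU : ∀ i → i < n → GF.C⁺.d (suc i) S.* Ex.U (suc i) S.≈ GF.w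
    dU i i<n = S.trans (S.*-congʳ {Ex.U (suc i)} (S.+-congʳ {S.- GF.w} (S.*-cong e≈ e≈)))
      (E.inverse (Q.ι (suc i)) (PR.cst (inv (suc i))) (cst-inverse (Q.ι (suc i)) (ι (suc i)) (inv (suc i))
          (ι-inv ℕ.z<s (ℕ.s<s i<n)) (PR.ι≋cst (suc i))))
      where
      e≈ : GF.C⁺.e (suc i) S.≈ t S.- PQ.cst (Q.ι (suc i))
      e≈ = S.+-congˡ {t} (S.-‿cong (PQ.ι≋cst (suc i)))
    module Star = GF.Star {W} {V} {a} {b} steps (λ m m<n → S.trans (a-eq m m<n)
        (S.*-congˡ {t} (genF-cong (λ ks → η≈ ks m)))) Ex.U dU

  nonstarFamily-sum : (F : ZetaFamily) (let open ZetaFamily F) → (∀ ks m → η ks m ≈ - ζ ks m) → ∀ k s → k < n →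
    - heightSum (λ ks → ζ ks n) k s ≈ ∑ (λ i → sgn i * ((- inv (suc i)) ^ k * ι (heightCoeff k (s ℕ.+ s)))) n
  nonstarFamily-sum F η≈ k s k<n = trans (-‿cong (sym (genF-coeff (λ ks → ζ ks n) k s)))
      (Ex.extract (S.- V n) NonStar.result k k<n (s ℕ.+ s))
    where
    open ZetaFamily F
    open Family F
    -- As (-t - j)² = (t - (-j))², the expansion applies with μ = -j, whose inverse is -1/j.
    module Ex = Extract (λ j → - inv j)
    dU : ∀ i → i < n → GF.C⁻.d (suc i) S.* Ex.U (suc i) S.≈ GF.w
    dU i i<n = S.trans (S.*-congʳ {Ex.U (suc i)} (S.+-congʳ {S.- GF.w} (S.trans
        (S.Solver.solve 2 (λ t k → (S.Solver.:- t S.Solver.:- k) S.Solver.:* (S.Solver.:- t S.Solver.:- k) S.Solver.:=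
            (t S.Solver.:+ k) S.Solver.:* (t S.Solver.:+ k)) S.refl t (S.ι (suc i)))
        (S.*-cong e≈ e≈))))
      (E.inverse (Q.- Q.ι (suc i)) (PR.cst (- inv (suc i))) (cst-inverse (Q.- Q.ι (suc i)) (- ι (suc i))
          (- inv (suc i))
        (trans (solve 2 (λ a b → (:- a) :* (:- b) := a :* b) refl _ _) (ι-inv ℕ.z<s (ℕ.s<s i<n))) neg-ι))
      where
      open Solver using (solve; _:=_; _:*_; :-_)
      neg-ι : Q.- Q.ι (suc i) Q.≈ PR.cst (- ι (suc i))
      neg-ι zero    = -‿cong (PR.ι≋cst (suc i) 0)
      neg-ι (suc j) = trans (-‿cong (PR.ι≋cst (suc i) (suc j))) -0#≈0#
      e≈ : t S.+ S.ι (suc i) S.≈ t S.- PQ.cst (Q.- Q.ι (suc i))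
      e≈ = S.+-congˡ {t} (λ { zero → Q.trans (PQ.ι≋cst (suc i) 0) (Q.sym (Q.-‿involutive (Q.ι (suc i))))
                            ; (suc k) → Q.trans (PQ.ι≋cst (suc i) (suc k)) (Q.sym Q.-0#≈0#) })
    genF-neg : ∀ m → genF (λ ks → η ks m) S.≈ S.- W m
    genF-neg m k = Q.trans (genF-cong (λ ks → η≈ ks m) k) (Q.trans
      (LQ.listSum-cong (compositions k) (λ ks j → trans (sym (-‿distribˡ-* (ζ ks m) (y^ (height ks) j)))
        (trans (-‿cong (sym (*-identityˡ _))) (trans (-‿distribˡ-* 1# _)
            (sym (PR.cst-⊛ (- 1#) (ζ ks m PR.· y^ (height ks)) j))))))
      (Q.trans (LQ.listSum-* (PR.cst (- 1#)) (λ ks → ζ ks m PR.· y^ (height ks)) (compositions k))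
        (λ j → trans (PR.cst-⊛ (- 1#) (W m k) j) (trans (sym (-‿distribˡ-* 1# _)) (-‿cong (*-identityˡ _))))))
    module NonStar = GF.NonStar {W} {V} {a} {b} steps
      (λ m m<n → S.trans (a-eq m m<n) (S.trans (S.*-congˡ {t} (genF-neg m)) (S.sym (S.-‿distribʳ-* t (W m))))) Ex.U dU

-- Rational numbers modulo p

module Identities (R : CommutativeRing 0ℓ 0ℓ) where
  open RingTheory R
  open Solver using (solve; _:=_; _:+_; _:*_; _:-_; :-_)

  fraction-+ : ∀ a b v v′ → a * v * v′ + b * v′ * v ≈ (a + b) * (v * v′)
  fraction-+ = solve 4 (λ a b v v′ → a :* v :* v′ :+ b :* v′ :* v := (a :+ b) :* (v :* v′)) refl

  fraction-* : ∀ a b v v′ → a * v * (b * v′) ≈ a * b * (v * v′)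
  fraction-* = solve 4 (λ a b v v′ → a :* v :* (b :* v′) := a :* b :* (v :* v′)) refl

  signed-step : ∀ s x r y → - s * (x + r * y) ≈ - s * x + r * - (s * y)
  signed-step = solve 4 (λ s x r y → (:- s) :* (x :+ r :* y) := (:- s) :* x :+ r :* (:- (s :* y))) refl

module Modular (n : ℕ) (prime : Prime (suc n)) where

  p : ℕ
  p = suc n

  infix 4 _≈ₚ_
  -- The quotient is explicit, so compatibility with the ring operations reduces to polynomial
  -- identities over ℤ, which the ring solver proves.
  record _≈ₚ_ (x y : ℤ) : Set where
    constructor congruent
    field
      quotient : ℤ
      equality : x ≡ y ℤ.+ quotient ℤ.* ℤ.+ p

  ≡⇒≈ₚ : ∀ {x y} → x ≡ y → x ≈ₚ y
  ≡⇒≈ₚ {x} {y} ≡.refl = congruent ℤ.0ℤ (≡.sym (ℤ.+-identityʳ x))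

  ℤ/p : CommutativeRing 0ℓ 0ℓ
  ℤ/p = record
    { Carrier = ℤ ; _≈_ = _≈ₚ_ ; _+_ = ℤ._+_ ; _*_ = ℤ._*_ ; -_ = ℤ.-_ ; 0# = ℤ.0ℤ ; 1# = ℤ.1ℤ
    ; isCommutativeRing = record
      { isRing = record
        { +-isAbelianGroup = record
          { isGroup = record
            { isMonoid = record
              { isSemigroup = record
                { isMagma = record
                  { isEquivalence = record
                    { refl = ≡⇒≈ₚ ≡.refl
                    ; sym = λ { {x} {y} (congruent q ≡.refl) → congruent (ℤ.- q) (sym-eq y q (ℤ.+ p)) }
                    ; trans = λ { {x} {y} {z} (congruent q ≡.refl) (congruent r ≡.refl) → congruent (r ℤ.+ q)
                        (trans-eq z q r (ℤ.+ p)) } }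
                  ; ∙-cong = λ { {x} {y} {u} {v} (congruent q ≡.refl) (congruent r ≡.refl) → congruent (q ℤ.+ r)
                      (+-eq y v q r (ℤ.+ p)) } }
                ; assoc = λ x y z → ≡⇒≈ₚ (ℤ.+-assoc x y z) }
              ; identity = (λ x → ≡⇒≈ₚ (ℤ.+-identityˡ x)) , (λ x → ≡⇒≈ₚ (ℤ.+-identityʳ x)) }
            ; inverse = (λ x → ≡⇒≈ₚ (ℤ.+-inverseˡ x)) , (λ x → ≡⇒≈ₚ (ℤ.+-inverseʳ x))
            ; ⁻¹-cong = λ { {x} {y} (congruent q ≡.refl) → congruent (ℤ.- q) (neg-eq y q (ℤ.+ p)) } }
          ; comm = λ x y → ≡⇒≈ₚ (ℤ.+-comm x y) }
        ; *-cong = λ { {x} {y} {u} {v} (congruent q ≡.refl) (congruent r ≡.refl) → congruent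
            (y ℤ.* r ℤ.+ q ℤ.* v ℤ.+ q ℤ.* r ℤ.* ℤ.+ p) (*-eq y v q r (ℤ.+ p)) }
        ; *-assoc = λ x y z → ≡⇒≈ₚ (ℤ.*-assoc x y z)
        ; *-identity = (λ x → ≡⇒≈ₚ (ℤ.*-identityˡ x)) , (λ x → ≡⇒≈ₚ (ℤ.*-identityʳ x))
        ; distrib = (λ x y z → ≡⇒≈ₚ (ℤ.*-distribˡ-+ x y z)) , (λ x y z → ≡⇒≈ₚ (ℤ.*-distribʳ-+ x y z)) }
      ; *-comm = λ x y → ≡⇒≈ₚ (ℤ.*-comm x y) } }
    where
    sym-eq : ∀ y q P → y ≡ y ℤ.+ q ℤ.* P ℤ.+ ℤ.- q ℤ.* P
    sym-eq = ℤ-solve-∀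
    trans-eq : ∀ z q r P → z ℤ.+ r ℤ.* P ℤ.+ q ℤ.* P ≡ z ℤ.+ (r ℤ.+ q) ℤ.* P
    trans-eq = ℤ-solve-∀
    +-eq : ∀ y v q r P → y ℤ.+ q ℤ.* P ℤ.+ (v ℤ.+ r ℤ.* P) ≡ y ℤ.+ v ℤ.+ (q ℤ.+ r) ℤ.* P
    +-eq = ℤ-solve-∀
    neg-eq : ∀ y q P → ℤ.- (y ℤ.+ q ℤ.* P) ≡ ℤ.- y ℤ.+ ℤ.- q ℤ.* P
    neg-eq = ℤ-solve-∀
    *-eq : ∀ y v q r P → (y ℤ.+ q ℤ.* P) ℤ.* (v ℤ.+ r ℤ.* P) ≡ y ℤ.* v ℤ.+
        (y ℤ.* r ℤ.+ q ℤ.* v ℤ.+ q ℤ.* r ℤ.* P) ℤ.* P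
    *-eq = ℤ-solve-∀

  open RingTheory ℤ/p public
  open ≈-R
  open ListSum ℤ/p public using (listSum)

  ι≡+ : ∀ m → ι m ≡ ℤ.+ m
  ι≡+ zero    = ≡.refl
  ι≡+ (suc m) = ≡.cong (λ x → ℤ.1ℤ ℤ.+ x) (ι≡+ m)

  char : ι p ≈ 0#
  char = congruent ℤ.1ℤ (≡.trans (ι≡+ p) (≡.sym (≡.trans (ℤ.+-identityˡ _) (ℤ.*-identityˡ (ℤ.+ p)))))

  open PrimeCharacteristic ℤ/p n prime char public using (inv; ι-inv; fermat′)

  ≈0⇒∣ : ∀ {x} → x ≈ 0# → p ∣ ℤ.∣ x ∣
  ≈0⇒∣ (congruent q ≡.refl) = divides ℤ.∣ q ∣ (≡.trans (≡.cong ℤ.∣_∣ (ℤ.+-identityˡ (q ℤ.* ℤ.+ p)))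
      (ℤ.abs-* q (ℤ.+ p)))

  -- x is p-integral and reduces to a modulo p.
  record Red (x : ℚ) (a : ℤ) : Set where
    constructor red
    field
      num     : ℤ
      den-1   : ℕ
      value   : toℚᵘ x ≃ mkℚᵘ num den-1
      p∤den   : ¬ (p ∣ suc den-1)
      residue : num ≈ a * ℤ.+ suc den-1

  red-cong : ∀ {x a b} → a ≈ b → Red x a → Red x b
  red-cong a≈b (red u v e p∤ c) = red u v e p∤ (trans c (*-congʳ a≈b))

  private
    p∤* : ∀ {a b} → ¬ (p ∣ a) → ¬ (p ∣ b) → ¬ (p ∣ a ℕ.* b)
    p∤* p∤a p∤b = [ p∤a , p∤b ]′ ∘ euclidsLemma _ _ prime

  red-+ : ∀ {x y a b} → Red x a → Red y b → Red (x ℚ.+ y) (a + b)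
  red-+ {x} {y} {a} {b} (red u v e p∤ c) (red u′ v′ e′ p∤′ c′) =
    red (u * ℤ.+ suc v′ + u′ * ℤ.+ suc v) (v′ ℕ.+ v ℕ.* suc v′)
      (ℚᵘ.≃-trans (ℚ.toℚᵘ-homo-+ x y) (ℚᵘ.+-cong e e′)) (p∤* p∤ p∤′) (begin
      u * V′ + u′ * V                ≈⟨ +-cong (*-congʳ c) (*-congʳ c′) ⟩
      a * V * V′ + b * V′ * V        ≈⟨ Identities.fraction-+ ℤ/p a b V V′ ⟩
      (a + b) * (V * V′)             ∎)
    where
    V  = ℤ.+ suc v
    V′ = ℤ.+ suc v′

  red-* : ∀ {x y a b} → Red x a → Red y b → Red (x ℚ.* y) (a * b)
  red-* {x} {y} {a} {b} (red u v e p∤ c) (red u′ v′ e′ p∤′ c′) =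
    red (u * u′) (v′ ℕ.+ v ℕ.* suc v′)
      (ℚᵘ.≃-trans (ℚ.toℚᵘ-homo-* x y) (ℚᵘ.*-cong e e′)) (p∤* p∤ p∤′) (begin
      u * u′                  ≈⟨ *-cong c c′ ⟩
      a * V * (b * V′)        ≈⟨ Identities.fraction-* ℤ/p a b V V′ ⟩
      a * b * (V * V′)        ∎)
    where
    V  = ℤ.+ suc v
    V′ = ℤ.+ suc v′

  red-neg : ∀ {x a} → Red x a → Red (ℚ.- x) (- a)
  red-neg {x} {a} (red u v e p∤ c) =
    red (- u) v (ℚᵘ.≃-trans (ℚ.toℚᵘ-homo‿- x) (ℚᵘ.-‿cong e)) p∤
      (trans (-‿cong c) (-‿distribˡ-* a (ℤ.+ suc v)))

  red-/ : ∀ u v {a} → ¬ (p ∣ suc v) → u ≈ a * ℤ.+ suc v → Red (u ℚ./ suc v) a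
  red-/ u v p∤ c = red u v (ℚ.toℚᵘ-fromℚᵘ (mkℚᵘ u v)) p∤ c

  private
    p∤1 : ¬ (p ∣ 1)
    p∤1 p∣1 = contradiction (∣⇒≤ p∣1) (ℕ.<⇒≱ (prime>1 prime))

  red-ℕ : ∀ m → Red (ℕtoℚ m) (ι m)
  red-ℕ m = red-/ (ℤ.+ m) 0 p∤1 (≡⇒≈ₚ (≡.sym (≡.trans (ℤ.*-identityʳ (ι m)) (ι≡+ m))))

  red-0 : Red 0ℚ 0#
  red-0 = red-ℕ 0

  red-1 : Red 1ℚ 1#
  red-1 = red-ℕ 1

  red-inv : ∀ m r → ¬ (p ∣ suc m) → ι (suc m) * r ≈ 1# → Red (invℕ (suc m)) r
  red-inv m r p∤ e = red-/ ℤ.1ℤ m p∤ (begin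
    1#               ≈⟨ sym e ⟩
    ι (suc m) * r    ≈⟨ *-comm (ι (suc m)) r ⟩
    r * ι (suc m)    ≈⟨ reflexive (≡.cong (r *_) (ι≡+ (suc m))) ⟩
    r * ℤ.+ suc m    ∎)

  red-^ : ∀ {x a} k → Red x a → Red (x ^ℚ k) (a ^ k)
  red-^ zero    h = red-1
  red-^ (suc k) h = red-* h (red-^ k h)

  red-sign : ∀ k → Red (sign k) (Telescope.sgn ℤ/p k)
  red-sign zero    = red-1
  red-sign (suc k) = red-neg (red-sign k)

  red-applyUpTo : ∀ (f : ℕ → ℚ) (g : ℕ → ℤ) m → (∀ i → i < m → Red (f i) (g i)) → Red (sumℚ (applyUpTo f m)) (∑ g m)
  red-applyUpTo f g zero    h = red-0
  red-applyUpTo f g (suc m) h = red-cong (sym (∑.fold-first g m))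
    (red-+ (h 0 ℕ.z<s) (red-applyUpTo (f ∘ suc) (g ∘ suc) m λ i i<m → h (suc i) (ℕ.s<s i<m)))

  red-sumRange : ∀ (f : ℕ → ℚ) (g : ℕ → ℤ) m → (∀ i → i < m → Red (f (suc i)) (g i)) → Red (sumRange (suc m) f)
      (∑ g m)
  red-sumRange f g m h = ≡.subst (λ l → Red (sumℚ l) (∑ g m)) (≡.sym (map-applyUpTo id (λ j → f (suc j)) m))
      (red-applyUpTo (f ∘ suc) g m h)

  -- The fraction stored in `Red` need not be in lowest terms. Cross-multiplication moves the
  -- divisibility of its numerator to the reduced numerator times a denominator prime to p.
  red-0⇒∣ : ∀ x → Red x 0# → p ∣ ℤ.∣ ↥ x ∣
  red-0⇒∣ x@record{} (red u v (*≡* e) p∤ c) = [ id , (λ d → contradiction d p∤) ]′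
    (euclidsLemma ℤ.∣ ↥ x ∣ (suc v) prime (≡.subst (p ∣_) (ℤ.abs-* (↥ x) (ℤ.+ suc v)) (≈0⇒∣ (begin
      ↥ x * ℤ.+ suc v   ≈⟨ ≡⇒≈ₚ e ⟩
      u * ℚ.↧ x         ≈⟨ *-congʳ (trans c (zeroˡ (ℤ.+ suc v))) ⟩
      0# * ℚ.↧ x        ≈⟨ zeroˡ (ℚ.↧ x) ⟩
      0#                ∎))))

  red-unique : ∀ {x y a} → Red x a → Red y a → x ≡ℚ y [mod p ]
  red-unique {x} {y} {a} rx ry = red-0⇒∣ (x ℚ.- y) (red-cong (-‿inverseʳ a) (red-+ rx (red-neg ry)))

  p∤< : ∀ m → suc m < p → ¬ (p ∣ suc m)
  p∤< m m<p d = contradiction (∣⇒≤ d) (ℕ.<⇒≱ m<p)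

  red-inv< : ∀ i → i < n → Red (invℕ (suc i)) (inv (suc i))
  red-inv< i i<n = red-inv i (inv (suc i)) (p∤< i (ℕ.s<s i<n)) (ι-inv ℕ.z<s (ℕ.s<s i<n))

  -- The bound m is the largest value allowed to the first variable, one less than the strict bound
  -- passed to `zetaLE` and `zetaLT`; the full sums are those with m = n = p - 1.
  zLE zLT : List ℕ → ℕ → ℤ
  zLE []       m = 1#
  zLE (k ∷ ks) m = ∑ (λ i → inv (suc i) ^ k * zLE ks (suc i)) m
  zLT []       m = 1#
  zLT (k ∷ ks) m = ∑ (λ i → inv (suc i) ^ k * zLT ks i) m

  red-zetaLE : ∀ ks m → m ≤ n → Red (zetaLE ks (suc m)) (zLE ks m)
  red-zetaLE []       m m≤n = red-1
  red-zetaLE (k ∷ ks) m m≤n = red-sumRange (λ m → (invℕ m ^ℚ k) ℚ.* zetaLE ks (suc m))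
      (λ i → inv (suc i) ^ k * zLE ks (suc i)) m λ i i<m →
    red-* (red-^ k (red-inv< i (ℕ.<-≤-trans i<m m≤n))) (red-zetaLE ks (suc i) (ℕ.≤-trans i<m m≤n))

  red-zetaLT : ∀ ks m → m ≤ n → Red (zetaLT ks (suc m)) (zLT ks m)
  red-zetaLT []       m m≤n = red-1
  red-zetaLT (k ∷ ks) m m≤n = red-sumRange (λ m → (invℕ m ^ℚ k) ℚ.* zetaLT ks m)
      (λ i → inv (suc i) ^ k * zLT ks i) m λ i i<m →
    red-* (red-^ k (red-inv< i (ℕ.<-≤-trans i<m m≤n))) (red-zetaLT ks i (ℕ.≤-trans (ℕ.<⇒≤ i<m) m≤n))

  red-filter : ∀ (f : List ℕ → ℚ) (g : List ℕ → ℤ) k s → (∀ ks → Red (f ks) (g ks)) →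
    Red (sumℚ (map f (I₀ k s))) (listSum (λ ks → if firstGt1 ks ∧ (height ks ≡ᵇ s) then g ks else 0#)
        (compositions k))
  red-filter f g k s h = go (compositions k)
    where
    go : ∀ L → Red (sumℚ (map f (filter (λ ks → T? (firstGt1 ks ∧ (height ks ≡ᵇ s))) L)))
                   (listSum (λ ks → if firstGt1 ks ∧ (height ks ≡ᵇ s) then g ks else 0#) L)
    go []       = red-0
    go (ks ∷ L) with firstGt1 ks ∧ (height ks ≡ᵇ s)
    ... | true  = red-+ (h ks) (go L)
    ... | false = red-cong (sym (+-identityˡ _)) (go L)

-- Bernoulli numbers

module Genocchi (K : CommutativeRing 0ℓ 0ℓ) where
  open RingTheory K
  open BinomialTransform K
  open ≈-R
  open Solver using (solve; _:=_; _:+_; _:*_; _:-_; :-_; con)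

  private
    T = binomialTransform

  dilate : (ℕ → Carrier) → ℕ → Carrier
  dilate u i = ι 2 ^ i * u i

  δ₁ : ℕ → Carrier
  δ₁ 1 = 1#
  δ₁ _ = 0#

  -- In exponential generating functions: substituting 2x in e^x u(x) gives e^x e^x u(2x).
  dilate-binomialTransform : ∀ u n → dilate (T u) n ≈ T (T (dilate u)) n
  dilate-binomialTransform u zero    = refl
  dilate-binomialTransform u (suc n) = begin
    ι 2 * ι 2 ^ n * (T u n + T (u ∘ suc) n)
      ≈⟨ solve 4 (λ c p a b → c :* p :* (a :+ b) := c :* (p :* a) :+ c :* (p :* b)) refl (ι 2) (ι 2 ^ n) _ _ ⟩
    ι 2 * dilate (T u) n + ι 2 * dilate (T (u ∘ suc)) n
      ≈⟨ +-cong (*-congˡ (dilate-binomialTransform u n)) (*-congˡ (dilate-binomialTransform (u ∘ suc) n)) ⟩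
    ι 2 * T (T v) n + ι 2 * T (T (dilate (u ∘ suc))) n
      ≈⟨ +-cong (solve 1 (λ a → con (ℤ.+ 2) :* a := a :+ a) refl _)
           (sym (binomialTransform-* (ι 2) (T (dilate (u ∘ suc))) n)) ⟩
    T (T v) n + T (T v) n + T (λ i → ι 2 * T (dilate (u ∘ suc)) i) n
      ≈⟨ +-congˡ (binomialTransform-cong n λ i → trans (sym (binomialTransform-* (ι 2) (dilate (u ∘ suc)) i))
           (binomialTransform-cong i λ j → sym (*-assoc _ _ _))) ⟩
    T (T v) n + T (T v) n + T (T (v ∘ suc)) n
      ≈⟨ +-assoc _ _ _ ⟩
    T (T v) n + (T (T v) n + T (T (v ∘ suc)) n)
      ≈⟨ +-congˡ (sym (binomialTransform-+ (T v) (T (v ∘ suc)) n)) ⟩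
    T (T v) n + T (T v ∘ suc) n ∎
    where v = dilate u

  binomialTransform-last : ∀ u n → T u (suc n) ≈ ∑ (λ j → ι (suc n C j) * u j) n + ι (suc n) * u n + u (suc n)
  binomialTransform-last u n = trans (binomialTransform-formula u (suc n))
    (+-cong (+-congˡ (*-congʳ (ι-≡ C-last))) (trans (*-congʳ (trans (ι-≡ (nCn≡1 (suc n))) ι1≈1)) (*-identityˡ _)))
    where
    C-last : suc n C n ≡ suc n
    C-last = ≡.trans (nCk≡nC[n∸k] (ℕ.n≤1+n n)) (≡.trans (≡.cong (suc n C_) (ℕ.m+n∸n≡m 1 n)) (nC1≡n (suc n)))

  module _ (cancel : ∀ m x → ι (suc m) * x ≈ 0# → x ≈ 0#) where

    -- If e^x u = u then u = 0: at n + 1 the equation contains u_n with coefficient n + 1 and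
    -- otherwise only earlier terms. `N` bounds the strong induction. The cancellation of every n +
    -- 1 confines this to characteristic 0.
    binomialTransform-fixed : ∀ u → (∀ i → T u i ≈ u i) → ∀ N n → n < N → u n ≈ 0#
    binomialTransform-fixed u fix (suc N) n (s≤s n≤N) = cancel n (u n) (begin
      ι (suc n) * u n
        ≈⟨ solve 3 (λ s a b → a := s :+ a :+ b :- b :- s) refl S _ (u (suc n)) ⟩
      S + ι (suc n) * u n + u (suc n) - u (suc n) - S
        ≈⟨ +-cong (+-congʳ (trans (sym (binomialTransform-last u n)) (fix (suc n))))
             (-‿cong (∑-zero n λ i i<n → trans (*-congˡ (binomialTransform-fixed u fix N i (ℕ.<-≤-trans i<n n≤N)))
                 (zeroʳ _))) ⟩
      u (suc n) - u (suc n) - 0#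
        ≈⟨ solve 1 (λ a → a :- a :- con (ℤ.+ 0) := con (ℤ.+ 0)) refl _ ⟩
      0# ∎)
      where S = ∑ (λ j → ι (suc n C j) * u j) n

    module _ (B : ℕ → Carrier) (B-rec : ∀ n → T B n ≈ B n + δ₁ n) where

      private
        D : ℕ → Carrier
        D = dilate B

        dilate-δ₁ : ∀ n → ι 2 ^ n * δ₁ n ≈ ι 2 * δ₁ n
        dilate-δ₁ 0             = trans (zeroʳ _) (sym (zeroʳ _))
        dilate-δ₁ 1             = *-congʳ (*-identityʳ _)
        dilate-δ₁ (suc (suc n)) = trans (zeroʳ _) (sym (zeroʳ _))

        -- For B = x / (e^x - 1) and D(x) = B(2x) this is the sequence of (e^x + 1) D - 2 B, which
        -- is zero because e^(2x) - 1 = (e^x + 1)(e^x - 1). Instead of dividing series, `T-x` shows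
        -- that it is fixed by multiplication by e^x.
        x : ℕ → Carrier
        x n = (T D n + D n) + - ι 2 * B n

        T-x : ∀ n → T x n ≈ x n
        T-x n = begin
          T x n
            ≈⟨ trans (binomialTransform-+ (λ i → T D i + D i) (λ i → - ι 2 * B i) n)
                     (+-cong (binomialTransform-+ (T D) D n) (binomialTransform-* (- ι 2) B n)) ⟩
          (T (T D) n + T D n) + - ι 2 * T B n
            ≈⟨ +-cong (+-congʳ (trans (sym (dilate-binomialTransform B n)) (*-congˡ (B-rec n)))) (*-congˡ (B-rec n)) ⟩
          (ι 2 ^ n * (B n + δ₁ n) + T D n) + - ι 2 * (B n + δ₁ n)
            ≈⟨ solve 5 (λ p b d t c → p :* (b :+ d) :+ t :+ (:- c) :* (b :+ d) := t :+ p :* b :+ (:- c) :* b :+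
                 (p :* d :- c :* d))
                 refl (ι 2 ^ n) (B n) (δ₁ n) (T D n) (ι 2) ⟩
          x n + (ι 2 ^ n * δ₁ n - ι 2 * δ₁ n)
            ≈⟨ +-congˡ (trans (+-congʳ (dilate-δ₁ n)) (-‿inverseʳ _)) ⟩
          x n + 0#  ≈⟨ +-identityʳ _ ⟩
          x n ∎

      -- The numbers (1 - 2^n) B_n, half the Genocchi numbers, with generating function x / (e^x +
      -- 1). Their recurrence comes from (e^x + 1)(B - D) = (e^x + 1) B - 2 B = (e^x - 1) B = x.
      genocchi : ℕ → Carrier
      genocchi n = B n - D n

      genocchi-rec : ∀ n → T genocchi n + genocchi n ≈ δ₁ n
      genocchi-rec n = begin
        T genocchi n + genocchi n
          ≈⟨ +-congʳ (trans (binomialTransform-cong n λ i → +-congˡ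
               (sym (trans (sym (-‿distribˡ-* _ _)) (-‿cong (*-identityˡ _)))))
                       (trans (binomialTransform-+ B (λ i → - 1# * D i) n)
                           (+-cong (B-rec n) (binomialTransform-* (- 1#) D n)))) ⟩
        (B n + δ₁ n) + - 1# * T D n + (B n - D n)
          ≈⟨ solve 4 (λ b d t D → (b :+ d) :+ (:- con (ℤ.+ 1)) :* t :+ (b :- D) := d :-
               (t :+ D :+ (:- con (ℤ.+ 2)) :* b)) refl (B n) (δ₁ n) (T D n) (D n) ⟩
        δ₁ n - x n  ≈⟨ +-congˡ (trans (-‿cong (binomialTransform-fixed x T-x (suc n) n ℕ.≤-refl)) -0#≈0#) ⟩
        δ₁ n + 0#   ≈⟨ +-identityʳ _ ⟩
        δ₁ n        ∎

ℚ-ring : CommutativeRing 0ℓ 0ℓ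
ℚ-ring = ℚ.+-*-commutativeRing

module Rat = RingTheory ℚ-ring

ι≡ℕtoℚ : ∀ m → Rat.ι m ≡ ℕtoℚ m
ι≡ℕtoℚ zero    = ≡.refl
ι≡ℕtoℚ (suc m) = ≡.trans (≡.cong (λ x → 1ℚ ℚ.+ x) (ι≡ℕtoℚ m)) (ℚ.toℚᵘ-injective
  (ℚᵘ.≃-trans (ℚ.toℚᵘ-homo-+ 1ℚ (ℕtoℚ m))
  (ℚᵘ.≃-trans (ℚᵘ.+-congʳ (toℚᵘ 1ℚ) (ℚ.toℚᵘ-fromℚᵘ (mkℚᵘ (ℤ.+ m) 0)))
  (ℚᵘ.≃-trans (*≡* (≡.cong (λ x → (ℤ.1ℤ ℤ.+ x) ℤ.* ℤ.1ℤ) (ℤ.*-identityʳ (ℤ.+ m))))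
  (ℚᵘ.≃-sym (ℚ.toℚᵘ-fromℚᵘ (mkℚᵘ (ℤ.+ suc m) 0)))))))

invℕ-inverse : ∀ m → invℕ (suc m) ℚ.* Rat.ι (suc m) ≡ 1ℚ
invℕ-inverse m = ≡.trans (≡.cong (λ x → invℕ (suc m) ℚ.* x) (ι≡ℕtoℚ (suc m))) (ℚ.toℚᵘ-injective
  (ℚᵘ.≃-trans (ℚ.toℚᵘ-homo-* (invℕ (suc m)) (ℕtoℚ (suc m)))
  (ℚᵘ.≃-trans (ℚᵘ.*-cong (ℚ.toℚᵘ-fromℚᵘ (mkℚᵘ ℤ.1ℤ m)) (ℚ.toℚᵘ-fromℚᵘ (mkℚᵘ (ℤ.+ suc m) 0)))
  (*≡* (≡.trans (ℤ.*-identityʳ (ℤ.1ℤ ℤ.* ℤ.+ suc m)) (≡.cong (λ x → ℤ.1ℤ ℤ.* x)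
      (≡.sym (ℤ.*-identityʳ (ℤ.+ suc m)))))))))

ι-cancelℚ : ∀ m x → Rat.ι (suc m) ℚ.* x ≡ 0ℚ → x ≡ 0ℚ
ι-cancelℚ m x eq = begin
  x                                       ≡⟨ ≡.sym (ℚ.*-identityˡ x) ⟩
  1ℚ ℚ.* x                                ≡⟨ ≡.cong (λ c → c ℚ.* x) (≡.sym (invℕ-inverse m)) ⟩
  invℕ (suc m) ℚ.* Rat.ι (suc m) ℚ.* x    ≡⟨ ℚ.*-assoc (invℕ (suc m)) (Rat.ι (suc m)) x ⟩
  invℕ (suc m) ℚ.* (Rat.ι (suc m) ℚ.* x)  ≡⟨ ≡.cong (λ c → invℕ (suc m) ℚ.* c) eq ⟩
  invℕ (suc m) ℚ.* 0ℚ                     ≡⟨ ℚ.*-zeroʳ (invℕ (suc m)) ⟩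
  0ℚ                                      ∎
  where open ≡.≡-Reasoning

bernoulliSum : ℕ → ℕ → ℚ
bernoulliSum m = Rat.∑ (λ j → Rat.ι (suc (suc m) C j) ℚ.* bernoulli j)

-- The auxiliary functions behind bernoulli are private too; each `_` below is solved by the definitional unfolding
-- of bernoulli in the equation that follows it.

mutual
  weightedSum : ℕ → ℚ
  weightedSum = _

  bernoulli-suc : ∀ m → bernoulli (suc m) ≡ ℚ.- (invℕ (suc (suc m)) ℚ.* weightedSum m)
  bernoulli-suc m = ≡.refl

-- Replacing the row index of the binomial coefficient by a variable makes the length of the private list of
-- Bernoulli numbers accessible to unification.
mutual
  generalRow : ℕ → ℚ → ℕ → ℚ
  generalRow = _

  generalRow-eq : ∀ i → weightedSum (suc i) ≡ generalRow (suc (suc (suc i))) (bernoulli (suc i)) i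
  generalRow-eq i with bernoulli (suc i) | suc (suc (suc i))
  ... | _ | _ = ≡.refl

mutual
  listLength : ℕ → ℕ
  listLength = _

  rowCoeff : ℕ → ℕ → ℕ
  rowCoeff = _

  rowRest : ℕ → ℚ → ℕ → ℚ
  rowRest = _

  listLength-eq : ∀ r b i → generalRow r b i ≡ ℕtoℚ (if listLength i ℕ.<ᵇ r then rowCoeff r i else 0) ℚ.* b ℚ.+
      rowRest r b i
  listLength-eq r b i = ≡.refl

mutual
  tailSum : ℕ → ℚ
  tailSum = _

  weightedSum-eq : ∀ m → weightedSum m ≡ ℕtoℚ (suc (suc m) C listLength m) ℚ.* bernoulli m ℚ.+ tailSum m
  weightedSum-eq m = ≡.refl

-- An abstract successor keeps the row index apart from the running index when the sum is unfolded once more.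
abstract
  next : ℕ → ℕ
  next j = suc j

mutual
  tailSum-next : ℕ → ℚ
  tailSum-next = _

  tailSum-next-eq : ∀ j → tailSum (next j) ≡ tailSum-next j
  tailSum-next-eq j with j
  ... | _ = ≡.refl

mutual
  shorterSum : ℕ → ℚ
  shorterSum = _

  abstract
    shorterSum-eq : ∀ j → tailSum-next j ≡ ℕtoℚ (suc (suc (next j)) C listLength j) ℚ.* bernoulli j ℚ.+ shorterSum j
    shorterSum-eq j = ≡.refl

mutual
  partialSum : ℕ → ℕ → ℚ
  partialSum = _

  partialSum-eq : ∀ j → shorterSum j ≡ partialSum (next j) j
  partialSum-eq j with next j
  ... | _ = ≡.refl

listLength≡ : ∀ j → listLength j ≡ j
listLength≡ zero    = ≡.refl
listLength≡ (suc j) = ≡.cong suc (listLength≡ j)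

private
  coeff≡ : ∀ i j → ℕtoℚ (suc (suc i) C listLength j) ≡ Rat.ι (suc (suc i) C j)
  coeff≡ i j = ≡.trans (≡.cong (λ l → ℕtoℚ (suc (suc i) C l)) (listLength≡ j)) (≡.sym (ι≡ℕtoℚ (suc (suc i) C j)))

  partialSum-suc : ∀ i j → partialSum i (suc j) ≡ ℕtoℚ (suc (suc i) C listLength j) ℚ.* bernoulli j ℚ.+ partialSum i j
  partialSum-suc i j = ≡.refl

  tailSum≡ : ∀ i → tailSum i ≡ partialSum i i
  tailSum≡ i = ≡.refl

  append : ∀ {c c′ b s s′ : ℚ} → c ≡ c′ → s ≡ s′ → c ℚ.* b ℚ.+ s ≡ s′ ℚ.+ c′ ℚ.* b
  append {c} {b = b} {s} ≡.refl ≡.refl = ℚ.+-comm (c ℚ.* b) s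

partialSum≡ : ∀ i j → partialSum i j ≡ bernoulliSum i j
partialSum≡ i zero    = ≡.refl
partialSum≡ i (suc j) = ≡.trans (partialSum-suc i j) (append (coeff≡ i j) (partialSum≡ i j))

bernoulli-recurrence : ∀ m → bernoulli (suc m) ≡ ℚ.- (invℕ (suc (suc m)) ℚ.* bernoulliSum m (suc m))
bernoulli-recurrence m = ≡.trans (bernoulli-suc m) (≡.cong (λ x → ℚ.- (invℕ (suc (suc m)) ℚ.* x))
  (≡.trans (weightedSum-eq m) (append (coeff≡ m m) (≡.trans (tailSum≡ m) (partialSum≡ m m)))))

module Gℚ = Genocchi ℚ-ring
module Tℚ = BinomialTransform ℚ-ring

bernoulli-transform : ∀ n → Tℚ.binomialTransform bernoulli n ≡ bernoulli n ℚ.+ Gℚ.δ₁ n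
bernoulli-transform zero          = ≡.refl
bernoulli-transform (suc zero)    = ≡.refl
bernoulli-transform (suc (suc m)) = begin
  Tℚ.binomialTransform bernoulli (suc (suc m))  ≡⟨ Gℚ.binomialTransform-last bernoulli (suc m) ⟩
  S ℚ.+ c ℚ.* bernoulli (suc m) ℚ.+ b           ≡⟨ ≡.cong (λ x → S ℚ.+ x ℚ.+ b) vanish ⟩
  S ℚ.+ ℚ.- S ℚ.+ b                             ≡⟨ ≡.cong (λ x → x ℚ.+ b) (ℚ.+-inverseʳ S) ⟩
  0ℚ ℚ.+ b                                      ≡⟨ ℚ.+-comm 0ℚ b ⟩
  b ℚ.+ 0ℚ                                      ∎
  where
  open ≡.≡-Reasoning
  S = bernoulliSum m (suc m)
  b = bernoulli (suc (suc m))
  c = Rat.ι (suc (suc m))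
  i = invℕ (suc (suc m))
  vanish : c ℚ.* bernoulli (suc m) ≡ ℚ.- S
  vanish = begin
    c ℚ.* bernoulli (suc m)    ≡⟨ ≡.cong (λ x → c ℚ.* x) (bernoulli-recurrence m) ⟩
    c ℚ.* (ℚ.- (i ℚ.* S))      ≡⟨ ≡.sym (ℚ.neg-distribʳ-* c (i ℚ.* S)) ⟩
    ℚ.- (c ℚ.* (i ℚ.* S))      ≡⟨ ≡.cong ℚ.-_ (≡.sym (ℚ.*-assoc c i S)) ⟩
    ℚ.- (c ℚ.* i ℚ.* S)        ≡⟨ ≡.cong (λ x → ℚ.- (x ℚ.* S)) (≡.trans (ℚ.*-comm c i) (invℕ-inverse (suc m))) ⟩
    ℚ.- (1ℚ ℚ.* S)             ≡⟨ ≡.cong ℚ.-_ (ℚ.*-identityˡ S) ⟩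
    ℚ.- S                      ∎

genocchiℚ : ℕ → ℚ
genocchiℚ = Gℚ.genocchi ι-cancelℚ bernoulli bernoulli-transform

genocchiℚ-rec : ∀ n → Tℚ.binomialTransform genocchiℚ n ℚ.+ genocchiℚ n ≡ Gℚ.δ₁ n
genocchiℚ-rec = Gℚ.genocchi-rec ι-cancelℚ bernoulli bernoulli-transform

-- Alternating power sums and Genocchi numbers modulo p

module AlternatingPowerSums (R : CommutativeRing 0ℓ 0ℓ) (n : ℕ) (prime : Prime (suc n)) (2<p : 2 < suc n)
                            (char : CommutativeRing._≈_ R (RingTheory.ι R (suc n)) (CommutativeRing.0# R)) where
  open RingTheory R
  open Telescope R using (sgn; sgn-prime-pred)
  open BinomialTransform R
  open PrimeCharacteristic R n prime char
  open ≈-R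
  open Solver using (solve; _:=_; _:+_; _:*_; _:-_; :-_; con)
  module G = Genocchi R

  -- The derivative of x^m. As a sequence in m it has exponential generating function s e^(xs), so
  -- the binomial transform replaces x by 1 + x, and the factor s produces the right side `δ₁` of
  -- the Genocchi recurrence.
  dpow : Carrier → ℕ → Carrier
  dpow x zero    = 0#
  dpow x (suc m) = ι (suc m) * x ^ m

  dpow-suc : ∀ x m → dpow x (suc m) ≈ x * dpow x m + x ^ m
  dpow-suc x zero    = begin
    ι 1 * 1#       ≈⟨ *-congʳ ι1≈1 ⟩
    1# * 1#        ≈⟨ solve 1 (λ x → con (ℤ.+ 1) :* con (ℤ.+ 1) := x :* con (ℤ.+ 0) :+ con (ℤ.+ 1)) refl x ⟩
    x * 0# + 1#    ∎
  dpow-suc x (suc m) = solve 3 (λ k x y → (con (ℤ.+ 1) :+ k) :* (x :* y) := x :* (k :* y) :+ x :* y) refl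
      (ι (suc m)) x (x ^ m)

  dpow-cong : ∀ {x y} m → x ≈ y → dpow x m ≈ dpow y m
  dpow-cong zero    h = refl
  dpow-cong (suc m) h = *-congˡ (^-congˡ m h)

  binomialTransform-dpow : ∀ x m → binomialTransform (dpow x) m ≈ dpow (1# + x) m
  binomialTransform-dpow x zero    = refl
  binomialTransform-dpow x (suc m) = begin
    binomialTransform (dpow x) m + binomialTransform (dpow x ∘ suc) m
      ≈⟨ +-congˡ (trans (binomialTransform-cong m (dpow-suc x))
           (trans (binomialTransform-+ (λ i → x * dpow x i) (x ^_) m)
           (+-cong (binomialTransform-* x (dpow x) m) (binomialTransform-^ x m)))) ⟩
    binomialTransform (dpow x) m + (x * binomialTransform (dpow x) m + (1# + x) ^ m)
      ≈⟨ +-cong (binomialTransform-dpow x m) (+-congʳ (*-congˡ (binomialTransform-dpow x m))) ⟩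
    dpow (1# + x) m + (x * dpow (1# + x) m + (1# + x) ^ m)
      ≈⟨ solve 3 (λ x a b → a :+ (x :* a :+ b) := (con (ℤ.+ 1) :+ x) :* a :+ b) refl x _ _ ⟩
    (1# + x) * dpow (1# + x) m + (1# + x) ^ m
      ≈⟨ sym (dpow-suc (1# + x) m) ⟩
    dpow (1# + x) (suc m) ∎

  altSum : ℕ → Carrier
  altSum m = ∑ (λ i → sgn i * dpow (ι i) m) p

  private
    telescoping : ∀ (D : ℕ → Carrier) m → ∑ (λ i → sgn i * D (suc i)) m + ∑ (λ i → sgn i * D i) m ≈ D 0 - sgn m * D m
    telescoping D zero    = solve 1 (λ a → con (ℤ.+ 0) :+ con (ℤ.+ 0) := a :- con (ℤ.+ 1) :* a) refl (D 0)
    telescoping D (suc m) = begin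
      A + s * D (suc m) + (B + s * D m)
        ≈⟨ solve 5 (λ A B s x y → A :+ s :* x :+ (B :+ s :* y) := (A :+ B) :+ s :* (x :+ y)) refl A B s (D (suc m))
             (D m) ⟩
      (A + B) + s * (D (suc m) + D m)      ≈⟨ +-congʳ (telescoping D m) ⟩
      D 0 - s * D m + s * (D (suc m) + D m)
        ≈⟨ solve 4 (λ d s x y → d :- s :* y :+ s :* (x :+ y) := d :- (:- s) :* x) refl (D 0) s (D (suc m)) (D m) ⟩
      D 0 - - s * D (suc m)                ∎
      where
      A = ∑ (λ i → sgn i * D (suc i)) m
      B = ∑ (λ i → sgn i * D i) m
      s = sgn m

    dpow-0 : ∀ m → dpow 0# m ≈ G.δ₁ m
    dpow-0 0             = refl
    dpow-0 1             = trans (*-identityʳ _) ι1≈1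
    dpow-0 (suc (suc m)) = trans (*-congˡ (zeroˡ _)) (zeroʳ _)

  -- The transform moves each i to i + 1, so adding the original sum telescopes to the ends i = 0
  -- and i = p. These agree modulo p, and they add up instead of cancelling because p is odd.
  altSum-rec : ∀ m → binomialTransform altSum m + altSum m ≈ ι 2 * G.δ₁ m
  altSum-rec m = begin
    binomialTransform altSum m + altSum m
      ≈⟨ +-congʳ (trans (binomialTransform-∑ (λ i j → sgn i * dpow (ι i) j) p m)
           (∑.fold-cong p λ i → trans (binomialTransform-* (sgn i) (dpow (ι i)) m)
               (*-congˡ (binomialTransform-dpow (ι i) m)))) ⟩
    ∑ (λ i → sgn i * dpow (ι (suc i)) m) p + altSum m
      ≈⟨ telescoping (λ i → dpow (ι i) m) p ⟩
    dpow 0# m - - sgn n * dpow (ι p) m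
      ≈⟨ +-congˡ (-‿cong (*-cong (-‿cong (sgn-prime-pred prime 2<p)) (dpow-cong m char))) ⟩
    dpow 0# m - - 1# * dpow 0# m
      ≈⟨ solve 1 (λ a → a :- (:- con (ℤ.+ 1)) :* a := con (ℤ.+ 2) :* a) refl (dpow 0# m) ⟩
    ι 2 * dpow 0# m
      ≈⟨ *-congˡ (dpow-0 m) ⟩
    ι 2 * G.δ₁ m ∎

module DoubledRecurrence (R : CommutativeRing 0ℓ 0ℓ) where
  open RingTheory R
  open BinomialTransform R
  open ≈-R
  open Solver using (solve; _:=_; _:+_; _:*_; _:-_; :-_; con)

  binomialTransform-top : ∀ u m → binomialTransform u m ≈ ∑ (λ j → ι (m C j) * u j) m + u m
  binomialTransform-top u m = trans (binomialTransform-formula u m)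
    (+-congˡ (trans (*-congʳ (trans (ι-≡ (nCn≡1 m)) ι1≈1)) (*-identityˡ _)))

  -- The top term of the transform is u m itself, so the earlier values determine twice u m; halving
  -- is the only division needed, over ℚ as well as modulo p.
  doubled : ∀ u c m → binomialTransform u m + u m ≈ c → u m + u m ≈ c - ∑ (λ j → ι (m C j) * u j) m
  doubled u c m eq = begin
    u m + u m                            ≈⟨ solve 2 (λ s u → u :+ u := (s :+ u) :+ u :- s) refl S (u m) ⟩
    (S + u m) + u m - S                  ≈⟨ +-congʳ (+-congʳ (sym (binomialTransform-top u m))) ⟩
    binomialTransform u m + u m - S      ≈⟨ +-congʳ eq ⟩
    c - S                                ∎
    where S = ∑ (λ j → ι (m C j) * u j) m

  halve : ∀ h x → h * ι 2 ≈ 1# → h * (x + x) ≈ x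
  halve h x eq = begin
    h * (x + x)     ≈⟨ solve 2 (λ h x → h :* (x :+ x) := h :* con (ℤ.+ 2) :* x) refl h x ⟩
    h * ι 2 * x     ≈⟨ *-congʳ eq ⟩
    1# * x          ≈⟨ *-identityˡ x ⟩
    x               ∎

module GenocchiMod (n : ℕ) (prime : Prime (suc n)) (2<p : 2 < suc n) where
  open Modular n prime
  open AlternatingPowerSums ℤ/p n prime 2<p char public using (altSum; altSum-rec)
  module G = Genocchi ℤ/p

  red-≡ : ∀ {x y a} → x ≡ y → Red x a → Red y a
  red-≡ ≡.refl h = h

  red-ι : ∀ m → Red (Rat.ι m) (ι m)
  red-ι zero    = red-0
  red-ι (suc m) = red-+ red-1 (red-ι m)

  red-∑ : ∀ {f : ℕ → ℚ} {g : ℕ → ℤ} m → (∀ i → i < m → Red (f i) (g i)) → Red (Rat.∑ f m) (∑ g m)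
  red-∑ zero    h = red-0
  red-∑ (suc m) h = red-+ (red-∑ m λ i i<m → h i (ℕ.m<n⇒m<1+n i<m)) (h m ℕ.≤-refl)

  private
    red-δ₁ : ∀ m → Red (Gℚ.δ₁ m) (G.δ₁ m)
    red-δ₁ 0             = red-0
    red-δ₁ 1             = red-1
    red-δ₁ (suc (suc m)) = red-0

  red-halve : ∀ {x a} → Red (x ℚ.+ x) (a + a) → Red x a
  red-halve {x} {a} h = red-≡ (DoubledRecurrence.halve ℚ-ring (invℕ 2) x (invℕ-inverse 1))
    (red-cong (DoubledRecurrence.halve ℤ/p (inv 2) a (trans (*-comm (inv 2) (ι 2)) (ι-inv ℕ.z<s 2<p)))
      (red-* (red-inv 1 (inv 2) (p∤< 1 2<p) (ι-inv ℕ.z<s 2<p)) h))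

  twiceGenocchi : ℕ → ℚ
  twiceGenocchi m = Rat.ι 2 ℚ.* genocchiℚ m

  twiceGenocchi-rec : ∀ m → Tℚ.binomialTransform twiceGenocchi m ℚ.+ twiceGenocchi m ≡ Rat.ι 2 ℚ.* Gℚ.δ₁ m
  twiceGenocchi-rec m = ≡.trans (≡.cong (λ x → x ℚ.+ twiceGenocchi m) (Tℚ.binomialTransform-* (Rat.ι 2) genocchiℚ m))
    (≡.trans (≡.sym (ℚ.*-distribˡ-+ (Rat.ι 2) (Tℚ.binomialTransform genocchiℚ m) (genocchiℚ m)))
      (≡.cong (λ x → Rat.ι 2 ℚ.* x) (genocchiℚ-rec m)))

  -- Both sequences satisfy the same recurrence, and p is odd. This also yields the p-integrality of
  -- 2(1 - 2^m) B_m for every m, including those m for which p divides the denominator of B_m.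
  red-genocchi : ∀ N m → m < N → Red (twiceGenocchi m) (altSum m)
  red-genocchi (suc N) m (s≤s m≤N) = red-halve
    (red-≡ (≡.sym (DoubledRecurrence.doubled ℚ-ring twiceGenocchi (Rat.ι 2 ℚ.* Gℚ.δ₁ m) m (twiceGenocchi-rec m)))
    (red-cong (sym (DoubledRecurrence.doubled ℤ/p altSum (ι 2 * G.δ₁ m) m (altSum-rec m)))
    (red-+ (red-* (red-ι 2) (red-δ₁ m))
           (red-neg (red-∑ m λ j j<m → red-* (red-ι (m C j)) (red-genocchi N j (ℕ.<-≤-trans j<m m≤N)))))))

-- Residues of both sides

module AlternatingInverseSums (R : CommutativeRing 0ℓ 0ℓ) (n : ℕ) (prime : Prime (suc n)) (2<p : 2 < suc n)
                              (char : CommutativeRing._≈_ R (RingTheory.ι R (suc n)) (CommutativeRing.0# R)) where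
  open RingTheory R
  open Telescope R using (sgn; sgn-+; sgn²; sgn-prime-pred)
  open PrimeCharacteristic R n prime char using (inv; ι-inv; fermat′; ι-complement)
  open AlternatingPowerSums R n prime 2<p char using (altSum)
  open ≈-R
  open Solver using (solve; _:=_; _:*_; _:-_; :-_; con)

  A : ℕ → Carrier
  A k = ∑ (λ i → sgn i * inv (suc i) ^ k) n

  private
    ι^-inv^ : ∀ M k → M ℕ.+ k ≡ n → ∀ i → i < n → ι (suc i) ^ M ≈ inv (suc i) ^ k
    ι^-inv^ M k eq i i<n = begin
      x ^ M                      ≈⟨ sym (*-identityʳ _) ⟩
      x ^ M * 1#
        ≈⟨ *-congˡ (sym (trans (sym (^-distrib-* x r k)) (trans (^-congˡ k (ι-inv ℕ.z<s (ℕ.s<s i<n))) (1^≈1 k)))) ⟩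
      x ^ M * (x ^ k * r ^ k)    ≈⟨ sym (*-assoc _ _ _) ⟩
      x ^ M * x ^ k * r ^ k      ≈⟨ *-congʳ (sym (^-homo-* x M k)) ⟩
      x ^ (M ℕ.+ k) * r ^ k      ≈⟨ *-congʳ (trans (reflexive (≡.cong (x ^_) eq)) (fermat′ ℕ.z<s (ℕ.s<s i<n))) ⟩
      1# * r ^ k                 ≈⟨ *-identityˡ _ ⟩
      r ^ k                      ∎
      where
      x = ι (suc i)
      r = inv (suc i)

  -- By Fermat the power M + 1 = p - 1 - k is the inverse k-th power, and the prefactor M + 2 = p -
  -- k is -k modulo p. This sign cancels the one caused by dropping the term i = 0.
  altSum≈ : ∀ M k → suc M ℕ.+ k ≡ n → altSum (suc (suc M)) ≈ ι k * A k
  altSum≈ M k eq = begin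
    altSum (suc (suc M))
      ≈⟨ ∑.fold-first (λ i → sgn i * (N * ι i ^ suc M)) n ⟩
    1# * (N * (0# * 0# ^ M)) + ∑ (λ i → - sgn i * (N * ι (suc i) ^ suc M)) n
      ≈⟨ +-cong (solve 2 (λ N x → con (ℤ.+ 1) :* (N :* (con (ℤ.+ 0) :* x)) := con (ℤ.+ 0)) refl N (0# ^ M))
           (∑.fold-cong< n λ i i<n → trans (*-congˡ (*-cong (ι-complement (suc (suc M)) k (≡.cong suc eq))
               (ι^-inv^ (suc M) k eq i i<n)))
             (solve 3 (λ s κ r → (:- s) :* ((:- κ) :* r) := κ :* (s :* r)) refl (sgn i) (ι k) (inv (suc i) ^ k))) ⟩
    0# + ∑ (λ i → ι k * (sgn i * inv (suc i) ^ k)) n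
      ≈⟨ trans (+-identityˡ _) (∑-*ˡ (ι k) (λ i → sgn i * inv (suc i) ^ k) n) ⟩
    ι k * A k ∎
    where N = ι (suc (suc M))

  private
    scaled : ∀ (r : ℕ → Carrier) c → ∑ (λ i → sgn i * (r i * c)) n ≈ ∑ (λ i → sgn i * r i) n * c
    scaled r c = trans (∑.fold-cong n λ i → solve 3 (λ s r c → s :* (r :* c) := c :* (s :* r)) refl (sgn i) (r i) c)
      (trans (∑-*ˡ c (λ i → sgn i * r i) n) (*-comm _ _))

  positive : ∀ k c → ∑ (λ i → sgn i * (inv (suc i) ^ k * c)) n ≈ A k * c
  positive k c = scaled (λ i → inv (suc i) ^ k) c

  -- The substitution j ↦ p - j negates each inverse and, since p is odd, flips each alternating
  -- sign.
  negative : ∀ k c → ∑ (λ i → sgn i * ((- inv (suc i)) ^ k * c)) n ≈ - (A k * c)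
  negative k c = begin
    ∑ (λ i → sgn i * ((- inv (suc i)) ^ k * c)) n    ≈⟨ scaled (λ i → (- inv (suc i)) ^ k) c ⟩
    ∑ (λ i → sgn i * (- inv (suc i)) ^ k) n * c      ≈⟨ *-congʳ (∑.fold-reverse n reflect) ⟩
    ∑ (λ i → - 1# * (sgn i * inv (suc i) ^ k)) n * c ≈⟨ *-congʳ (∑-*ˡ (- 1#) (λ i → sgn i * inv (suc i) ^ k) n) ⟩
    - 1# * A k * c
      ≈⟨ solve 2 (λ a c → (:- con (ℤ.+ 1)) :* a :* c := :- (a :* c)) refl (A k) c ⟩
    - (A k * c)                                      ∎
    where
    reflect : ∀ i j → suc (i ℕ.+ j) ≡ n → sgn i * (- inv (suc i)) ^ k ≈ - 1# * (sgn j * inv (suc j) ^ k)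
    reflect i j eq = trans (*-cong sgn-eq (^-congˡ k inv-eq))
        (solve 2 (λ s r → (:- s) :* r := (:- con (ℤ.+ 1)) :* (s :* r)) refl (sgn j) (inv (suc j) ^ k))
      where
      i<n : i < n
      i<n = ≡.subst (suc i ≤_) eq (s≤s (ℕ.m≤m+n i j))
      j<n : j < n
      j<n = ≡.subst (suc j ≤_) eq (s≤s (ℕ.m≤n+m j i))
      sgn-eq : sgn i ≈ - sgn j
      sgn-eq = begin
        sgn i                          ≈⟨ sym (*-identityʳ _) ⟩
        sgn i * 1#                     ≈⟨ *-congˡ (sym (sgn² j)) ⟩
        sgn i * (sgn j * sgn j)
          ≈⟨ solve 2 (λ a b → a :* (b :* b) := :- ((:- (a :* b)) :* b)) refl (sgn i) (sgn j) ⟩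
        - (- (sgn i * sgn j) * sgn j)
          ≈⟨ -‿cong (*-congʳ (trans (-‿cong (sym (sgn-+ i j)))
               (trans (reflexive (≡.cong sgn eq)) (sgn-prime-pred prime 2<p)))) ⟩
        - (1# * sgn j)                 ≈⟨ -‿cong (*-identityˡ _) ⟩
        - sgn j                        ∎
      inv-eq : - inv (suc i) ≈ inv (suc j)
      inv-eq = begin
        - r                      ≈⟨ sym (*-identityʳ _) ⟩
        - r * 1#                 ≈⟨ *-congˡ (sym (ι-inv ℕ.z<s (ℕ.s<s j<n))) ⟩
        - r * (ι (suc j) * r′)
          ≈⟨ solve 3 (λ r x r′ → (:- r) :* (x :* r′) := (:- x) :* r :* r′) refl r (ι (suc j)) r′ ⟩
        - ι (suc j) * r * r′
          ≈⟨ *-congʳ (*-congʳ (sym (ι-complement (suc i) (suc j) (≡.cong suc (≡.trans (ℕ.+-suc i j) eq))))) ⟩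
        ι (suc i) * r * r′       ≈⟨ *-congʳ (ι-inv ℕ.z<s (ℕ.s<s i<n)) ⟩
        1# * r′                  ≈⟨ *-identityˡ _ ⟩
        r′                       ∎
        where
        r  = inv (suc i)
        r′ = inv (suc j)

  -- To be read with `β` = B_(p-k), `ρ` = 2^(p-k), which is 2^(1-k) modulo p, `κ` = k with inverse
  -- `r`, `a` the alternating sum of inverse k-th powers, and `c` the binomial coefficient.
  rhs-value : ∀ c ρ β κ r a → ι 2 * (β - ρ * β) ≈ κ * a → κ * r ≈ 1# → ι 2 * c * (1# - ρ) * (β * r) ≈ a * c
  rhs-value c ρ β κ r a eq inverse = begin
    ι 2 * c * (1# - ρ) * (β * r)
      ≈⟨ solve 4 (λ c ρ β r → con (ℤ.+ 2) :* c :* (con (ℤ.+ 1) :- ρ) :* (β :* r) := con (ℤ.+ 2) :*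
           (β :- ρ :* β) :* r :* c) refl c ρ β r ⟩
    ι 2 * (β - ρ * β) * r * c        ≈⟨ *-congʳ (*-congʳ eq) ⟩
    κ * a * r * c                    ≈⟨ solve 4 (λ κ a r c → κ :* a :* r :* c := κ :* r :* (a :* c)) refl κ a r c ⟩
    κ * r * (a * c)                  ≈⟨ *-congʳ inverse ⟩
    1# * (a * c)                     ≈⟨ *-identityˡ _ ⟩
    a * c                            ∎

even-double : ∀ s → not (isOdd (s ℕ.+ s)) ≡ true
even-double zero    = ≡.refl
even-double (suc s) rewrite ℕ.+-suc s s | even-double s = ≡.refl

heightCoeff≡ : ∀ k s → 1 ≤ k → 1 ≤ s → heightCoeff k (s ℕ.+ s) ≡ (k ∸ 1) C (2 ℕ.* s ∸ 1)
heightCoeff≡ (suc k) (suc s) _ _ rewrite ℕ.+-identityʳ s | ℕ.+-suc s s | even-double s = ≡.refl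

module Residues (n : ℕ) (prime : Prime (suc n)) (2<p : 2 < suc n) where
  open Modular n prime
  open GenocchiMod n prime 2<p
  open AlternatingInverseSums ℤ/p n prime 2<p char
  open Telescope ℤ/p using (sgn)
  module H = HeightSums ℤ/p n prime 2<p char

  starFamily : H.ZetaFamily
  starFamily = record
    { ζ = zLE ; η = λ ks m → zLE ks (suc m) ; ζ-nil = λ _ → refl ; ζ-zero = λ _ _ → refl ; ζ-suc = λ _ _ _ _ → refl }

  signedLT : List ℕ → ℕ → ℤ
  signedLT ks m = sgn (length ks) * zLT ks m

  nonstarFamily : H.ZetaFamily
  nonstarFamily = record
    { ζ = signedLT ; η = λ ks m → - signedLT ks m ; ζ-nil = λ _ → *-identityˡ 1# ; ζ-zero = λ k ks → zeroʳ
        (- sgn (length ks))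
    ; ζ-suc = λ k ks m _ → Identities.signed-step ℤ/p (sgn (length ks)) (zLT (k ∷ ks) m) (inv (suc m) ^ k)
        (zLT ks m) }

  value : ℕ → ℕ → ℤ
  value k s = A k * ι (heightCoeff k (s ℕ.+ s))

  red-star : ∀ k s → k < n → Red (sumℚ (map (λ 𝐤 → ζ⋆𝒜 𝐤 p) (I₀ k s))) (value k s)
  red-star k s k<n = red-cong
    (trans (H.starFamily-sum starFamily (λ _ _ → refl) k s k<n) (positive k (ι (heightCoeff k (s ℕ.+ s)))))
    (red-filter (λ 𝐤 → ζ⋆𝒜 𝐤 p) (λ ks → zLE ks n) k s (λ ks → red-zetaLE ks n ℕ.≤-refl))

  red-nonstar : ∀ k s → k < n → Red (sumℚ (map (λ 𝐤 → sign (depth 𝐤) ℚ.* ζ𝒜 𝐤 p) (I₀ k s))) (value k s)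
  red-nonstar k s k<n = red-cong
    (trans (sym (-‿involutive (H.heightSum (λ ks → signedLT ks n) k s)))
      (trans (-‿cong (trans (H.nonstarFamily-sum nonstarFamily (λ _ _ → refl) k s k<n)
          (negative k (ι (heightCoeff k (s ℕ.+ s))))))
        (-‿involutive (value k s))))
    (red-filter (λ 𝐤 → sign (depth 𝐤) ℚ.* ζ𝒜 𝐤 p) (λ ks → signedLT ks n) k s
      (λ ks → red-* (red-sign (length ks)) (red-zetaLT ks n ℕ.≤-refl)))

  red-0-injective : ∀ {a} → Red 0ℚ a → a ≈ 0#
  red-0-injective {a} (red u v (*≡* e) p∤ c) = ∣⇒≈0 ([ id , (λ d → contradiction d p∤) ]′
    (euclidsLemma ℤ.∣ a ∣ (suc v) prime (≡.subst (p ∣_) (ℤ.abs-* a (ℤ.+ suc v)) (≈0⇒∣ (trans (sym c) (≡⇒≈ₚ u≡0))))))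
    where
    u≡0 : u ≡ ℤ.0ℤ
    u≡0 = ≡.trans (≡.sym (ℤ.*-identityʳ u)) (≡.sym e)
    ∣⇒≈0 : ∀ {x} → p ∣ ℤ.∣ x ∣ → x ≈ 0#
    ∣⇒≈0 d with ℤ.∣ᵤ⇒∣ {ℤ.+ p} d
    ... | ℤ.divides q eq = congruent q (≡.trans eq (≡.sym (ℤ.+-identityˡ (q ℤ.* ℤ.+ p))))

  -- Residues are unique; hence two ways of reducing the same rational number, here 2(1 - 2^N) B_N,
  -- give a congruence.
  red-injective : ∀ {x a b} → Red x a → Red x b → a ≈ b
  red-injective {x} {a} {b} ra rb = x-y≈0⇒x≈y a b (red-0-injective (red-≡ (ℚ.+-inverseʳ x) (red-+ ra (red-neg rb))))

  red-pow : ∀ {x a} m → Red x a → Red (x Rat.^ m) (a ^ m)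
  red-pow zero    h = red-1
  red-pow (suc m) h = red-* h (red-pow m h)

  red-∑-exists : ∀ {f : ℕ → ℚ} m → (∀ i → i < m → ∃ (Red (f i))) → ∃ (Red (Rat.∑ f m))
  red-∑-exists zero    h = 0# , red-0
  red-∑-exists (suc m) h with red-∑-exists m (λ i i<m → h i (ℕ.m<n⇒m<1+n i<m)) | h m ℕ.≤-refl
  ... | a , ra | b , rb = a + b , red-+ ra rb

  -- Up to B_(p-2) the recurrence divides only by numbers below p; the next one, B_(p-1), would
  -- divide by p.
  red-bernoulli : ∀ N m → m < N → m < n → ∃ (Red (bernoulli m))
  red-bernoulli (suc N) zero    _         _   = 1# , red-1
  red-bernoulli (suc N) (suc m) (s≤s m<N) m<n =
    - (inv (suc (suc m)) * proj₁ sum) , red-≡ (≡.sym (bernoulli-recurrence m))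
        (red-neg (red-* (red-inv< (suc m) m<n) (proj₂ sum)))
    where
    term : ∀ j → j < suc m → ∃ (Red (Rat.ι (suc (suc m) C j) ℚ.* bernoulli j))
    term j j≤m = ι (suc (suc m) C j) * proj₁ ih , red-* (red-ι (suc (suc m) C j)) (proj₂ ih)
      where ih = red-bernoulli N j (ℕ.<-≤-trans j≤m m<N) (ℕ.<-trans j≤m m<n)
    sum : ∃ (Red (bernoulliSum m (suc m)))
    sum = red-∑-exists {λ j → Rat.ι (suc (suc m) C j) ℚ.* bernoulli j} (suc m) term

  p∤2^ : ∀ j → ¬ (p ∣ 2 ℕ.^ j)
  p∤2^ zero    d = contradiction (∣⇒≤ d) (ℕ.<⇒≱ (prime>1 prime))
  p∤2^ (suc j) d = [ (λ p∣2 → contradiction (∣⇒≤ p∣2) (ℕ.<⇒≱ 2<p)) , p∤2^ j ]′ (euclidsLemma 2 (2 ℕ.^ j) prime d)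

  red-invℕ : ∀ m {r} → ¬ (p ∣ m) → ι m * r ≈ 1# → Red (invℕ m) r
  red-invℕ zero    p∤ eq = contradiction (p ∣0) p∤
  red-invℕ (suc m) p∤ eq = red-inv m _ p∤ eq

  red-rhs : ∀ k s → 1 ≤ k → 1 ≤ s → suc k < n → Red (rhs k s p) (value k s)
  -- For k = 1 the factor `Z` contains B_(p-1), which is not p-integral, so residues cannot be
  -- multiplied. Both sides are zero anyway, as the binomial coefficient has upper index 0 and
  -- positive lower index.
  red-rhs 1 s _ 1≤s _ = red-≡ (≡.sym rhs≡0) (red-cong (sym value≈0) red-0)
    where
    coeff≡0 : 0 C (2 ℕ.* s ∸ 1) ≡ 0
    coeff≡0 = k>n⇒nCk≡0 (ℕ.m<n⇒0<n∸m (ℕ.*-monoʳ-≤ 2 1≤s))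
    value≈0 : value 1 s ≈ 0#
    value≈0 = trans (*-congˡ {A 1} (ι-≡ (≡.trans (heightCoeff≡ 1 s ℕ.≤-refl 1≤s) coeff≡0))) (zeroʳ (A 1))
    rhs≡0 : rhs 1 s p ≡ 0ℚ
    rhs≡0 = ≡.trans (≡.cong (λ c → ℕtoℚ 2 ℚ.* ℕtoℚ c ℚ.* (1ℚ ℚ.- invℕ (2 ℕ.^ 0)) ℚ.* Z 1 p) coeff≡0)
      (≡.trans (≡.cong (λ x → x ℚ.* (1ℚ ℚ.- invℕ (2 ℕ.^ 0)) ℚ.* Z 1 p) (ℚ.*-zeroʳ (ℕtoℚ 2)))
      (≡.trans (≡.cong (λ x → x ℚ.* Z 1 p) (ℚ.*-zeroˡ (1ℚ ℚ.- invℕ (2 ℕ.^ 0)))) (ℚ.*-zeroˡ (Z 1 p))))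
  red-rhs (suc (suc k″)) s _ 1≤s k<n = red-cong
    (trans (rhs-value (ι c) ρ β (ι k) (inv k) (A k) genocchi-value (ι-inv {k} ℕ.z<s (ℕ.m<n⇒m<1+n k<n′)))
      (*-congˡ {A k} (ι-≡ (≡.sym (heightCoeff≡ k s (s≤s z≤n) 1≤s)))))
    (red-* (red-* (red-* (red-ℕ 2) (red-ℕ c)) (red-+ red-1 (red-neg
        (red-invℕ (2 ℕ.^ suc k″) (p∤2^ (suc k″)) 2-inverse))))
      (red-* (red-≡ (≡.cong bernoulli N≡) rβ) (red-inv< (suc k″) (ℕ.<⇒≤ k<n′))))
    where
    k = suc (suc k″)
    c = (k ∸ 1) C (2 ℕ.* s ∸ 1)
    k<n′ : k < n
    k<n′ = ℕ.<⇒≤ k<n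
    M = n ∸ suc k
    N = suc (suc M)
    M+k : suc M ℕ.+ k ≡ n
    M+k = ≡.trans (≡.sym (ℕ.+-suc M k)) (ℕ.m∸n+n≡m {n} {suc k} k<n′)
    N≡ : N ≡ p ∸ k
    N≡ = ≡.sym (≡.trans (≡.cong (λ x → suc x ∸ k) (≡.sym M+k)) (ℕ.m+n∸n≡m N k))
    N<n : N < n
    N<n = ≡.subst (N <_) M+k (≡.subst (λ x → N < suc x) (≡.sym
        (≡.trans (ℕ.+-suc M (suc k″)) (≡.cong suc (ℕ.+-suc M k″)))) (s≤s (s≤s (s≤s (ℕ.m≤m+n M k″)))))
    bern = red-bernoulli (suc N) N ℕ.≤-refl N<n
    β  = proj₁ bern
    rβ = proj₂ bern
    -- As (k - 1) + N = p - 1, this is also the inverse of 2^(k-1). The same residue thus serves as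
    -- the power in 1 - 2^N and as 2^(1-k).
    ρ  = ι 2 ^ N
    genocchi-value : ι 2 * (β - ρ * β) ≈ ι k * A k
    genocchi-value = trans
      (red-injective {twiceGenocchi N} (red-* (red-ι 2) (red-+ rβ (red-neg (red-* (red-pow N (red-ι 2)) rβ))))
          (red-genocchi (suc N) N ℕ.≤-refl))
      (altSum≈ M k M+k)
    2-inverse : ι (2 ℕ.^ suc k″) * ρ ≈ 1#
    2-inverse = trans (*-congʳ {ρ} (ι-^ 2 (suc k″))) (trans (sym (^-homo-* (ι 2) (suc k″) N))
      (trans (reflexive (≡.cong (ι 2 ^_) exponent)) (fermat′ {2} ℕ.z<s 2<p)))
      where
      exponent : suc k″ ℕ.+ N ≡ n
      exponent = ≡.trans (ℕ.+-comm (suc k″) N) (≡.trans (≡.cong suc (≡.sym (ℕ.+-suc M (suc k″)))) M+k)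

open import Data.Rational using (_*_)

mainTheorem1 : (k s : ℕ) → 1 ≤ k → 1 ≤ s →
    ((λ p → sumℚ (map (λ 𝐤 → ζ⋆𝒜 𝐤 p) (I₀ k s))) ≈𝒜 rhs k s)
    × ((λ p → sumℚ (map (λ 𝐤 → sign (depth 𝐤) * ζ𝒜 𝐤 p) (I₀ k s))) ≈𝒜 rhs k s)
-- Beyond p > k + 2 one has p > 2 and k + 1 < p - 1: weight k lies below the error order t^(p-1),
-- and p - k is at least 2, as `altSum≈` requires.
mainTheorem1 k s 1≤k 1≤s = (suc (suc k) , star) , (suc (suc k) , nonstar)
  where
  star : ∀ p → Prime p → suc (suc k) < p → sumℚ (map (λ 𝐤 → ζ⋆𝒜 𝐤 p) (I₀ k s)) ≡ℚ rhs k s p [mod p ]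
  star (suc n) pr k<p = Modular.red-unique n pr (red-star k s (ℕ.<-trans (ℕ.n<1+n k) k<n)) (red-rhs k s 1≤k 1≤s k<n)
    where
    k<n = ℕ.s<s⁻¹ k<p
    open Residues n pr (ℕ.≤-<-trans (s≤s (s≤s z≤n)) k<p)
  nonstar : ∀ p → Prime p → suc (suc k) < p → sumℚ (map (λ 𝐤 → sign (depth 𝐤) ℚ.* ζ𝒜 𝐤 p) (I₀ k s)) ≡ℚ rhs k s p [mod
      p ]
  nonstar (suc n) pr k<p = Modular.red-unique n pr (red-nonstar k s (ℕ.<-trans (ℕ.n<1+n k) k<n))
      (red-rhs k s 1≤k 1≤s k<n)
    where
    k<n = ℕ.s<s⁻¹ k<p
    open Residues n pr (ℕ.≤-<-trans (s≤s (s≤s z≤n)) k<p)
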